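{- Let $q$ be a prime with $q\equiv 1\pmod 3$, and write $4q=L^2+27M^2$ with $L,M\in\mathbb{Z}$ and $L\equiv 1\pmod 3$. Let $p$ be a prime with $p\neq 2,3,q$ and $p\nmid LM$. Then \[ \sum_{k=(p+1)/2}^{\lfloor 2p/3\rfloor}\binom{3k}{k}\frac{M^{2k}}{q^k}\equiv \begin{cases} 0 \pmod{p}, & \text{if } p^{\frac{q-1}{3}}\equiv 1\pmod{q};\\[3pt] \pm\frac{3M}{L} \pmod{p}, & \text{if } p^{\frac{q-1}{3}}\equiv \frac{ -1\pm 9M/L}{2}\pmod{q}, \end{cases} \] and \[ \sum_{k=(p+1)/2}^{\lfloor 2p/3\rfloor}\binom{3k}{k}\frac{L^{2k}}{(27q)^k}\equiv \begin{cases} 0 \pmod{p}, & \text{if } p^{\frac{q-1}{3}}\equiv 1\pmod{q};\\[3pt] \pm\frac{L}{9M} \pmod{p}, & \text{if } p^{\frac{q-1}{3}}\equiv \frac{ -1\pm L/(3M)}{2}\pmod{q}. \end{cases} \]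
   Context: Congruences between rationals whose denominators are prime to the modulus are in the usual sense. In each case the signs $\pm$ correspond. -}

module Defs where

open import Data.Nat as ℕ using (ℕ; zero; suc)
open import Data.Integer as ℤ using (ℤ; +_; -[1+_])
open import Data.Integer.Divisibility using (_∣_)
open import Data.Rational as ℚ using (ℚ; 0ℚ; ↥_; ↧_)

-- Division of an integer by an integer, as a rational number.
-- (Junk value 0 when the divisor is 0; never used with divisor 0 below.)
_//_ : ℤ → ℤ → ℚ
a // (+ zero)   = 0ℚ
a // (+ suc n)  = a ℚ./ suc n
a // -[1+ n ]   = (ℤ.- a) ℚ./ suc n

infixl 7 _//_

-- Congruence of rationals modulo m in the usual sense:
-- a/b ≡ c/d (mod m)  iff  m ∣ a d - c b   (numerators/denominators of the
-- reduced forms; this is the usual notion when the denominators are prime to m).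
infix 4 _≡_[modℚ_]
_≡_[modℚ_] : ℚ → ℚ → ℕ → Set
x ≡ y [modℚ m ] = (+ m) ∣ ((↥ x ℤ.* ↧ y) ℤ.- (↥ y ℤ.* ↧ x))

sumFromTo : ℕ → ℕ → (ℕ → ℚ) → ℚ
sumFromTo a b f = go (suc b ℕ.∸ a) a
  where
  go : ℕ → ℕ → ℚ
  go zero    k = 0ℚ
  go (suc n) k = f k ℚ.+ go n (suc k)

{-# OPTIONS --safe #-}

-- Modulo p, binom(3k,k) ≡ -binom(p-1-k, 2k-p) on the range of summation, so both
-- sums are, up to a factor, the coefficient of y² in yᵖ modulo (p, y³ - a y - b)
-- for a suitable cubic.  In ℤ[ω,ζ]/p, with ω³ = ζ^q = 1, the roots of that cubic
-- are ωⁱ X + ω²ⁱ Y, where X and Y are multiples of the cubic Gauss sums G and G′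
-- modulo q, and the Frobenius map permutes them according to the cubic character
-- of p modulo q.  Comparing coefficients determines the coefficient of y² in yᵖ
-- in terms of the Jacobi sum J = A + B ω, for which G² = J G′ and G G′ = q give
-- 4q = (2A-B)² + 3B²; here 3 ∣ B, and A + B w ≡ 0 (mod q) for the cube root of
-- unity w = (-1+9M/L)/2, which identifies (2A-B, B/3) with ±(L, M).

module Submission where

open import Defs
open import Level using (0ℓ)
open import Algebra.Bundles using (CommutativeRing)
import Algebra.Properties.CommutativeSemiring.Binomial
import Algebra.Properties.CommutativeSemiring.Exp
import Algebra.Properties.Semiring.Exp
import Algebra.Properties.Semiring.Mult
import Algebra.Properties.Semiring.Sum
import Algebra.Solver.Ring
open import Algebra.Solver.Ring.AlmostCommutativeRing using (fromCommutativeRing; _-Raw-AlmostCommutative⟶_)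
open import Data.Empty using (⊥; ⊥-elim)
open import Data.Fin as Fin using (Fin; toℕ; fromℕ; inject₁)
open import Data.Fin.Permutation using (Permutation; permutation)
import Data.Fin.Properties as Fin
open import Data.Integer as ℤ using (ℤ; +_; -[1+_])
open import Data.Integer.Divisibility using (_∣_)
import Data.Integer.Divisibility.Signed as Signed
import Data.Integer.DivMod as ℤ
import Data.Integer.GCD as ℤ
import Data.Integer.Properties as ℤ
open import Data.Integer.Tactic.RingSolver using (solve-∀)
open import Data.List using (List; []; _∷_; _++_)
open import Data.Maybe using (Maybe; just; nothing)
open import Data.Nat as ℕ using (ℕ; zero; suc; _∸_; _/_; _^_)
open import Data.Nat.Combinatorics using (_C_; nCn≡1; nCk+nC[k+1]≡[n+1]C[k+1]; k>n⇒nCk≡0; nCk≡nC[n∸k])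
import Data.Nat.Divisibility as ℕ
import Data.Nat.DivMod as ℕ
open import Data.Nat.Primality using (Prime; euclidsLemma; prime⇒nonTrivial; prime⇒nonZero; prime⇒irreducible; prime?)
import Data.Nat.Properties as ℕ
import Data.Nat.Tactic.RingSolver as ℕSolver
open import Data.Product using (_×_; _,_; ∃; proj₁; proj₂)
open import Data.Rational as ℚ using (ℚ; 0ℚ; 1ℚ; ½; ↥_; ↧_)
import Data.Rational.Properties as ℚ
open import Data.Sum using (_⊎_; inj₁; inj₂; [_,_]′)
open import Data.Vec.Functional using (foldr)
open import Function using (_∘_)
open import Relation.Binary.PropositionalEquality using (_≡_; _≢_; refl; sym; trans; cong; cong₂; subst; subst₂; module ≡-Reasoning)
import Relation.Binary.Reasoning.Setoid as SetoidReasoning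
open import Relation.Nullary using (¬_; Dec; yes; no)
open import Relation.Nullary.Decidable using (¬?; decidable-stable; from-yes)

-- The roots are merely permuted only if Frobenius fixes the coefficient of every power of ζ in
-- them. For p ≡ 2 (mod 3) it exchanges ω and ω², so the multiples of G and G′ must be chosen to
-- make up for this: with θ = ω - ω², θ² = -3, the combinations v + v² and θ (v - v²) of a cubic
-- character value v are fixed in either case. They lead to two cubics y³ = 3n y + nℓ, one with n =
-- q and ℓ = 2A-B for the second sum, one with n = 3q and ℓ = 3B for the first. The ring ℤ[ω,ζ]/p
-- has zero divisors, so nothing is divided: cancellation is confined to integers prime to p, and
-- the last comparison uses only that 1 and ω are independent modulo p. The same ring with modulus 0
-- in place of p yields the exact integer identities for A and B. The sums depend on A and B only
-- through the ratio of 2A-B and B/3, which the sign in ±(L, M) does not affect. What has to be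
-- excluded is the conjugate pair (L, -M), and the congruence A + B w ≡ 0 does this.

infix 4 _≡_[modℤ_]

-- Congruences of integers

record _≡_[modℤ_] (x y : ℤ) (m : ℕ) : Set where
  constructor congruent
  field
    factor   : ℤ
    equality : x ≡ y ℤ.+ factor ℤ.* + m

module _ {m : ℕ} where
  open import Data.Integer using (_+_; _*_; _-_; -_)

  ≡⇒≡mod : ∀ {x y} → x ≡ y → x ≡ y [modℤ m ]
  ≡⇒≡mod {x} refl = congruent (+ 0) (sym (ℤ.+-identityʳ x))

  ≡mod-sym : ∀ {x y} → x ≡ y [modℤ m ] → y ≡ x [modℤ m ]
  ≡mod-sym {_} {y} (congruent k refl) = congruent (- k) (lemma y k (+ m))
    where
    lemma : ∀ y k m → y ≡ y + k * m + - k * m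
    lemma = solve-∀

  ≡mod-trans : ∀ {x y z} → x ≡ y [modℤ m ] → y ≡ z [modℤ m ] → x ≡ z [modℤ m ]
  ≡mod-trans {z = z} (congruent k refl) (congruent l refl) = congruent (l + k) (lemma z k l (+ m))
    where
    lemma : ∀ z k l m → z + l * m + k * m ≡ z + (l + k) * m
    lemma = solve-∀

  +-≡mod : ∀ {x y u v} → x ≡ y [modℤ m ] → u ≡ v [modℤ m ] → x + u ≡ y + v [modℤ m ]
  +-≡mod {_} {y} {_} {v} (congruent k refl) (congruent l refl) = congruent (k + l) (lemma y v k l (+ m))
    where
    lemma : ∀ y v k l m → y + k * m + (v + l * m) ≡ y + v + (k + l) * m
    lemma = solve-∀

  *-≡mod : ∀ {x y u v} → x ≡ y [modℤ m ] → u ≡ v [modℤ m ] → x * u ≡ y * v [modℤ m ]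
  *-≡mod {_} {y} {_} {v} (congruent k refl) (congruent l refl) =
    congruent (y * l + k * v + k * l * + m) (lemma y v k l (+ m))
    where
    lemma : ∀ y v k l m → (y + k * m) * (v + l * m) ≡
        y * v + (y * l + k * v + k * l * m) * m
    lemma = solve-∀

  +-≡modˡ : ∀ x {y z} → y ≡ z [modℤ m ] → x + y ≡ x + z [modℤ m ]
  +-≡modˡ x = +-≡mod (≡⇒≡mod {x} refl)

  +-≡modʳ : ∀ x {y z} → y ≡ z [modℤ m ] → y + x ≡ z + x [modℤ m ]
  +-≡modʳ x eq = +-≡mod eq (≡⇒≡mod {x} refl)

  *-≡modˡ : ∀ x {y z} → y ≡ z [modℤ m ] → x * y ≡ x * z [modℤ m ]
  *-≡modˡ x = *-≡mod (≡⇒≡mod {x} refl)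

  *-≡modʳ : ∀ x {y z} → y ≡ z [modℤ m ] → y * x ≡ z * x [modℤ m ]
  *-≡modʳ x eq = *-≡mod eq (≡⇒≡mod {x} refl)

  neg-≡mod : ∀ {x y} → x ≡ y [modℤ m ] → - x ≡ - y [modℤ m ]
  neg-≡mod {_} {y} (congruent k refl) = congruent (- k) (lemma y k (+ m))
    where
    lemma : ∀ y k m → - (y + k * m) ≡ - y + - k * m
    lemma = solve-∀

ℤmod : ℕ → CommutativeRing 0ℓ 0ℓ
ℤmod m = record
  { Carrier = ℤ
  ; _≈_ = _≡_[modℤ m ]
  ; _+_ = ℤ._+_
  ; _*_ = ℤ._*_
  ; -_ = ℤ.-_
  ; 0# = + 0
  ; 1# = + 1
  ; isCommutativeRing = record
    { isRing = record
      { +-isAbelianGroup = record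
        { isGroup = record
          { isMonoid = record
            { isSemigroup = record
              { isMagma = record
                { isEquivalence = record { refl = ≡⇒≡mod refl ; sym = ≡mod-sym ; trans = ≡mod-trans }
                ; ∙-cong = +-≡mod
                }
              ; assoc = λ x y z → ≡⇒≡mod (ℤ.+-assoc x y z)
              }
            ; identity = (λ x → ≡⇒≡mod (ℤ.+-identityˡ x)) , (λ x → ≡⇒≡mod (ℤ.+-identityʳ x))
            }
          ; inverse = (λ x → ≡⇒≡mod (ℤ.+-inverseˡ x)) , (λ x → ≡⇒≡mod (ℤ.+-inverseʳ x))
          ; ⁻¹-cong = neg-≡mod
          }
        ; comm = λ x y → ≡⇒≡mod (ℤ.+-comm x y)
        }
      ; *-cong = *-≡mod
      ; *-assoc = λ x y z → ≡⇒≡mod (ℤ.*-assoc x y z)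
      ; *-identity = (λ x → ≡⇒≡mod (ℤ.*-identityˡ x)) , (λ x → ≡⇒≡mod (ℤ.*-identityʳ x))
      ; distrib = (λ x y z → ≡⇒≡mod (ℤ.*-distribˡ-+ x y z)) , (λ x y z → ≡⇒≡mod (ℤ.*-distribʳ-+ x y z))
      }
    ; *-comm = λ x y → ≡⇒≡mod (ℤ.*-comm x y)
    }
  }

module _ {m : ℕ} where

  ∣⇒≡0 : ∀ {x} → + m ∣ x → x ≡ + 0 [modℤ m ]
  ∣⇒≡0 {x} d with Signed.divides k eq ← Signed.∣ᵤ⇒∣ {+ m} {x} d = congruent k (trans eq (sym (ℤ.+-identityˡ _)))

  ≡0⇒∣ : ∀ {x} → x ≡ + 0 [modℤ m ] → + m ∣ x
  ≡0⇒∣ {x} (congruent k eq) = Signed.∣⇒∣ᵤ {+ m} {x} (Signed.divides k (trans eq (ℤ.+-identityˡ _)))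

  -≡0⇒≡mod : ∀ {x y} → x ℤ.- y ≡ + 0 [modℤ m ] → x ≡ y [modℤ m ]
  -≡0⇒≡mod {x} {y} (congruent k eq) = congruent k (trans (lemma x y) (trans (cong (λ z → y ℤ.+ z) eq) (cong (λ z → y ℤ.+ z) (ℤ.+-identityˡ _))))
    where
    lemma : ∀ x y → x ≡ y ℤ.+ (x ℤ.- y)
    lemma = solve-∀

  ≡mod⇒-≡0 : ∀ {x y} → x ≡ y [modℤ m ] → x ℤ.- y ≡ + 0 [modℤ m ]
  ≡mod⇒-≡0 {_} {y} (congruent k refl) = congruent k (lemma y k (+ m))
    where
    lemma : ∀ y k m → y ℤ.+ k ℤ.* m ℤ.- y ≡ + 0 ℤ.+ k ℤ.* m
    lemma = solve-∀

  m≡0 : + m ≡ + 0 [modℤ m ]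
  m≡0 = congruent (+ 1) (lemma (+ m))
    where
    lemma : ∀ m → m ≡ + 0 ℤ.+ + 1 ℤ.* m
    lemma = solve-∀

  ^-≡mod : ∀ {x y} n → x ≡ y [modℤ m ] → x ℤ.^ n ≡ y ℤ.^ n [modℤ m ]
  ^-≡mod zero    eq = ≡⇒≡mod refl
  ^-≡mod (suc n) eq = *-≡mod eq (^-≡mod n eq)

ℤ^-distrib-* : ∀ x y n → (x ℤ.* y) ℤ.^ n ≡ x ℤ.^ n ℤ.* y ℤ.^ n
ℤ^-distrib-* x y zero    = refl
ℤ^-distrib-* x y (suc n) = trans (cong (λ z → x ℤ.* y ℤ.* z) (ℤ^-distrib-* x y n)) (lemma x y (x ℤ.^ n) (y ℤ.^ n))
  where
  lemma : ∀ x y A B → x ℤ.* y ℤ.* (A ℤ.* B) ≡ x ℤ.* A ℤ.* (y ℤ.* B)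
  lemma = solve-∀

≡0? : ∀ m x → Dec (x ≡ + 0 [modℤ m ])
≡0? m x with m ℕ.∣? ℤ.∣ x ∣
... | yes d = yes (∣⇒≡0 d)
... | no ¬d = no (λ eq → ¬d (≡0⇒∣ eq))

-- Lets one construction with a parameter m supply both congruences and, at m = 0, identities in ℤ.
mod0⇒≡ : ∀ {x y} → x ≡ y [modℤ 0 ] → x ≡ y
mod0⇒≡ {_} {y} (congruent k refl) = trans (cong (λ z → y ℤ.+ z) (ℤ.*-zeroʳ k)) (ℤ.+-identityʳ y)

-- Stands in for division: it holds for integers prime to a prime modulus and, for m = 0, for all
-- nonzero integers.
Regular : ℕ → ℤ → Set
Regular m c = ∀ x → c ℤ.* x ≡ + 0 [modℤ m ] → x ≡ + 0 [modℤ m ]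

prime>1 : ∀ {p} → Prime p → 1 ℕ.< p
prime>1 {p} pr = ℕ.nonTrivial⇒n>1 p {{prime⇒nonTrivial pr}}

module PrimeModulus {p : ℕ} (pr : Prime p) where

  *≡0⇒≡0⊎≡0 : ∀ x y → x ℤ.* y ≡ + 0 [modℤ p ] → x ≡ + 0 [modℤ p ] ⊎ y ≡ + 0 [modℤ p ]
  *≡0⇒≡0⊎≡0 x y eq with euclidsLemma ℤ.∣ x ∣ ℤ.∣ y ∣ pr (subst (p ℕ.∣_) (ℤ.abs-* x y) (≡0⇒∣ eq))
  ... | inj₁ d = inj₁ (∣⇒≡0 d)
  ... | inj₂ d = inj₂ (∣⇒≡0 d)

  regular : ∀ {x} → ¬ x ≡ + 0 [modℤ p ] → Regular p x
  regular {x} x≢0 y eq with *≡0⇒≡0⊎≡0 x y eq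
  ... | inj₁ x≡0 = ⊥-elim (x≢0 x≡0)
  ... | inj₂ y≡0 = y≡0

  *-≢0 : ∀ {x y} → ¬ x ≡ + 0 [modℤ p ] → ¬ y ≡ + 0 [modℤ p ] → ¬ x ℤ.* y ≡ + 0 [modℤ p ]
  *-≢0 x≢0 y≢0 eq = y≢0 (regular x≢0 _ eq)

  *-cancelˡ : ∀ x {y z} → ¬ x ≡ + 0 [modℤ p ] → x ℤ.* y ≡ x ℤ.* z [modℤ p ] → y ≡ z [modℤ p ]
  *-cancelˡ x {y} {z} x≢0 eq = -≡0⇒≡mod (regular x≢0 _ (≡mod-trans (≡⇒≡mod (lemma x y z)) (≡mod⇒-≡0 eq)))
    where
    lemma : ∀ x y z → x ℤ.* (y ℤ.- z) ≡ x ℤ.* y ℤ.- x ℤ.* z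
    lemma = solve-∀

  small≢0 : ∀ {n} → 0 ℕ.< n → n ℕ.< p → ¬ + n ≡ + 0 [modℤ p ]
  small≢0 0<n n<p eq = ℕ.<⇒≱ n<p (ℕ.∣⇒≤ {{ℕ.>-nonZero 0<n}} (≡0⇒∣ eq))

  1≢0 : ¬ + 1 ≡ + 0 [modℤ p ]
  1≢0 = small≢0 ℕ.z<s (prime>1 pr)

  ^-≢0 : ∀ {x} n → ¬ x ≡ + 0 [modℤ p ] → ¬ x ℤ.^ n ≡ + 0 [modℤ p ]
  ^-≢0 zero    x≢0 = 1≢0
  ^-≢0 (suc n) x≢0 = *-≢0 x≢0 (^-≢0 n x≢0)

  prime≢⇒≢0 : ∀ {r} → Prime r → p ≢ r → ¬ + r ≡ + 0 [modℤ p ]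
  prime≢⇒≢0 {r} prr p≢r eq with prime⇒irreducible prr (≡0⇒∣ eq)
  ... | inj₁ refl = 1≢0 m≡0
  ... | inj₂ p≡r = p≢r p≡r

-- Binomial coefficients divisible by p, and the Frobenius map

[k+1]*C[n+1,k+1] : ∀ n k → suc k ℕ.* (suc n C suc k) ≡ suc n ℕ.* (n C k)
[k+1]*C[n+1,k+1] zero zero = refl
[k+1]*C[n+1,k+1] zero (suc k) = trans (cong (λ c → suc (suc k) ℕ.* c) (k>n⇒nCk≡0 {1} {suc (suc k)} (ℕ.s≤s ℕ.z<s))) (ℕ.*-zeroʳ k)
[k+1]*C[n+1,k+1] (suc n) zero =
  trans (cong (1 ℕ.*_) (sym (nCk+nC[k+1]≡[n+1]C[k+1] (suc n) 0)))
    (cong suc (trans (cong (ℕ._+ 0) (trans (sym (ℕ.*-identityˡ _)) ([k+1]*C[n+1,k+1] n 0))) (ℕ.+-identityʳ _)))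
[k+1]*C[n+1,k+1] (suc n) (suc k) = begin
  suc (suc k) ℕ.* (suc (suc n) C suc (suc k))
    ≡⟨ cong (suc (suc k) ℕ.*_) (sym (nCk+nC[k+1]≡[n+1]C[k+1] (suc n) (suc k))) ⟩
  suc (suc k) ℕ.* (A ℕ.+ B) ≡⟨ lemma₁ k A B ⟩
  suc k ℕ.* A ℕ.+ A ℕ.+ suc (suc k) ℕ.* B
    ≡⟨ cong₂ (λ u v → u ℕ.+ A ℕ.+ v) ([k+1]*C[n+1,k+1] n k) ([k+1]*C[n+1,k+1] n (suc k)) ⟩
  suc n ℕ.* (n C k) ℕ.+ A ℕ.+ suc n ℕ.* (n C suc k) ≡⟨ lemma₂ n (n C k) (n C suc k) A ⟩
  suc n ℕ.* (n C k ℕ.+ n C suc k) ℕ.+ A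
    ≡⟨ cong (λ u → suc n ℕ.* u ℕ.+ A) (nCk+nC[k+1]≡[n+1]C[k+1] n k) ⟩
  suc n ℕ.* A ℕ.+ A ≡⟨ ℕ.+-comm _ A ⟩
  suc (suc n) ℕ.* (suc n C suc k)  ∎
  where
  open ≡-Reasoning
  A = suc n C suc k
  B = suc n C suc (suc k)
  lemma₁ : ∀ k A B → suc (suc k) ℕ.* (A ℕ.+ B) ≡ suc k ℕ.* A ℕ.+ A ℕ.+ suc (suc k) ℕ.* B
  lemma₁ = ℕSolver.solve-∀
  lemma₂ : ∀ n x y A → suc n ℕ.* x ℕ.+ A ℕ.+ suc n ℕ.* y ≡ suc n ℕ.* (x ℕ.+ y) ℕ.+ A
  lemma₂ = ℕSolver.solve-∀

-- By absorption p divides k times the binomial coefficient, and it is prime to k.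
prime∣C : ∀ {p} → Prime p → ∀ k → 0 ℕ.< k → k ℕ.< p → p ℕ.∣ p C k
prime∣C {suc n} pr (suc k) _ k<p
  with euclidsLemma (suc k) (suc n C suc k) pr (subst (suc n ℕ.∣_) (sym ([k+1]*C[n+1,k+1] n k)) (ℕ.m∣m*n (n C k)))
... | inj₁ d = ⊥-elim (ℕ.<⇒≱ k<p (ℕ.∣⇒≤ d))
... | inj₂ d = d

module Frobenius (R : CommutativeRing 0ℓ 0ℓ) {p : ℕ} (pr : Prime p) where
  open CommutativeRing R renaming (refl to ≈-refl; sym to ≈-sym; trans to ≈-trans)
  open Algebra.Properties.Semiring.Sum semiring using (sum; sum-cong-≋; sum-replicate-zero; sum-init-last)
  open Algebra.Properties.Semiring.Mult semiring using (×-congʳ; ×-congˡ; ×-assoc-*; ×-homo-1; ×-assocˡ) renaming (_×_ to _·_)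
  open Algebra.Properties.Semiring.Exp semiring using () renaming (_^_ to _^ᴿ_)
  open Algebra.Properties.CommutativeSemiring.Binomial commutativeSemiring using (binomialTerm; theorem)
  open SetoidReasoning setoid

  module _ (p·1≈0 : p · 1# ≈ 0#) where

    p·x≈0 : ∀ x → p · x ≈ 0#
    p·x≈0 x = begin
      p · x ≈⟨ ×-congʳ p (*-identityˡ x) ⟨
      p · (1# * x) ≈⟨ ×-assoc-* p 1# x ⟨
      (p · 1#) * x ≈⟨ *-congʳ p·1≈0 ⟩
      0# * x ≈⟨ zeroˡ x ⟩
      0#  ∎

    p∣n⇒n·x≈0 : ∀ {n} → p ℕ.∣ n → ∀ x → n · x ≈ 0#
    p∣n⇒n·x≈0 (ℕ.divides-refl k) x = begin
      (k ℕ.* p) · x ≈⟨ ×-congˡ {x} (ℕ.*-comm k p) ⟩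
      (p ℕ.* k) · x ≈⟨ ×-assocˡ x p k ⟨
      p · (k · x) ≈⟨ p·x≈0 (k · x) ⟩
      0#  ∎

    ^p-+ : ∀ x y → (x + y) ^ᴿ p ≈ x ^ᴿ p + y ^ᴿ p
    ^p-+ x y = go p refl
      where
      -- The equation `n ≡ p` allows a match on the exponent, which exposes the first and last
      -- binomial terms, while the primality of p stays usable.
      go : ∀ n → n ≡ p → (x + y) ^ᴿ n ≈ x ^ᴿ n + y ^ᴿ n
      go zero    refl = ⊥-elim (ℕ.≢-nonZero⁻¹ 0 {{prime⇒nonZero pr}} refl)
      go (suc n) refl = begin
        (x + y) ^ᴿ suc n ≈⟨ theorem (suc n) x y ⟩
        t Fin.zero + sum (t ∘ Fin.suc) ≈⟨ +-cong first (sum-init-last (t ∘ Fin.suc)) ⟩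
        y ^ᴿ suc n + (sum (λ i → t (Fin.suc (inject₁ i))) + t (Fin.suc (fromℕ n)))
          ≈⟨ +-congˡ (+-cong (≈-trans (sum-cong-≋ middle) (sum-replicate-zero n)) last) ⟩
        y ^ᴿ suc n + (0# + x ^ᴿ suc n) ≈⟨ +-congˡ (+-identityˡ _) ⟩
        y ^ᴿ suc n + x ^ᴿ suc n ≈⟨ +-comm _ _ ⟩
        x ^ᴿ suc n + y ^ᴿ suc n  ∎
        where
        t : Fin (suc (suc n)) → Carrier
        t = binomialTerm x y (suc n)
        first : t Fin.zero ≈ y ^ᴿ suc n
        first = ≈-trans (×-homo-1 _) (*-identityˡ _)
        middle : ∀ i → t (Fin.suc (inject₁ i)) ≈ 0#
        middle i = p∣n⇒n·x≈0 (prime∣C pr (suc (toℕ (inject₁ i))) ℕ.z<s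
            (ℕ.s≤s (subst (ℕ._< n) (sym (Fin.toℕ-inject₁ i)) (Fin.toℕ<n i)))) _
        last : t (Fin.suc (fromℕ n)) ≈ x ^ᴿ suc n
        last rewrite Fin.toℕ-fromℕ n | nCn≡1 (suc n) | ℕ.n∸n≡0 n = ≈-trans (×-homo-1 _) (*-identityʳ _)

    ^p-0 : 0# ^ᴿ p ≈ 0#
    ^p-0 = go p refl
      where
      go : ∀ n → n ≡ p → 0# ^ᴿ n ≈ 0#
      go zero    refl = ⊥-elim (ℕ.≢-nonZero⁻¹ 0 {{prime⇒nonZero pr}} refl)
      go (suc n) refl = zeroˡ _

    ^p-sum : ∀ {n} (f : Fin n → Carrier) → sum f ^ᴿ p ≈ sum (λ i → f i ^ᴿ p)
    ^p-sum {zero}  f = ^p-0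
    ^p-sum {suc n} f = ≈-trans (^p-+ _ _) (+-congˡ (^p-sum (f ∘ Fin.suc)))

-- Fermat's little theorem and inverses modulo a prime

module Fermat {p : ℕ} (pr : Prime p) where
  open import Data.Integer using (_+_; _*_; _-_; -_)
  open PrimeModulus pr
  private
    module Z = CommutativeRing (ℤmod p)
  open Algebra.Properties.Semiring.Mult Z.semiring using () renaming (_×_ to _·_)
  open Algebra.Properties.Semiring.Exp Z.semiring using () renaming (_^_ to _^ᶻ_)
  open Frobenius (ℤmod p) pr using (^p-+; ^p-0)

  ·1≡ : ∀ n → n · (+ 1) ≡ + n
  ·1≡ zero    = refl
  ·1≡ (suc n) = cong (λ z → + 1 + z) (·1≡ n)

  ^≡^ : ∀ x n → x ^ᶻ n ≡ x ℤ.^ n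
  ^≡^ x zero    = refl
  ^≡^ x (suc n) = cong (λ z → x * z) (^≡^ x n)

  private
    p·1≈0 : p · (+ 1) ≡ + 0 [modℤ p ]
    p·1≈0 = subst (_≡ + 0 [modℤ p ]) (sym (·1≡ p)) m≡0

    1^ : ∀ n → (+ 1) ℤ.^ n ≡ + 1
    1^ = ℤ.^-zeroˡ

    fermatℕ : ∀ n → (+ n) ^ᶻ p ≡ + n [modℤ p ]
    fermatℕ zero    = ^p-0 p·1≈0
    fermatℕ (suc n) = Z.trans (^p-+ p·1≈0 (+ 1) (+ n))
      (+-≡mod (≡⇒≡mod (trans (^≡^ (+ 1) p) (1^ p))) (fermatℕ n))

  instance
    private
      p≢0 : ℕ.NonZero p
      p≢0 = prime⇒nonZero pr

  residue : ∀ x → x ≡ + (x ℤ.%ℕ p) [modℤ p ]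
  residue x = congruent (x ℤ./ℕ p) (ℤ.a≡a%ℕn+[a/ℕn]*n x p)

  x^p≡x : ∀ x → x ℤ.^ p ≡ x [modℤ p ]
  x^p≡x x = Z.trans (^-≡mod p (residue x)) (Z.trans
    (subst (_≡ + r [modℤ p ]) (^≡^ (+ r) p) (fermatℕ r)) (Z.sym (residue x)))
    where r = x ℤ.%ℕ p

  x^[p∸1]≡1 : ∀ {x} → ¬ x ≡ + 0 [modℤ p ] → x ℤ.^ (p ∸ 1) ≡ + 1 [modℤ p ]
  x^[p∸1]≡1 {x} x≢0 = *-cancelˡ x x≢0 (Z.trans (≡⇒≡mod (cong (x ℤ.^_) (ℕ.suc-pred p)))
    (Z.trans (x^p≡x x) (Z.sym (Z.*-identityʳ x))))

  inverse : ∀ x → ¬ x ≡ + 0 [modℤ p ] → ∃ λ y → x * y ≡ + 1 [modℤ p ]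
  inverse x x≢0 = x ℤ.^ (p ∸ 2) , Z.trans (≡⇒≡mod (cong (x ℤ.^_) eq)) (x^[p∸1]≡1 x≢0)
    where
    eq : suc (p ∸ 2) ≡ p ∸ 1
    eq = sym (ℕ.+-∸-assoc 1 {p} {2} (prime>1 pr))

-- Power sums over the residues modulo q

module PowerSums {q : ℕ} (pr : Prime q) where
  open import Data.Integer using (_+_; _*_; _-_; -_)
  open PrimeModulus pr
  private
    module Z = CommutativeRing (ℤmod q)
  open Algebra.Properties.Semiring.Sum Z.semiring
  open SetoidReasoning Z.setoid

  S : (ℤ → ℤ) → ℤ
  S f = sum {q} (λ i → f (+ toℕ i))

  S-cong : ∀ {f g} → (∀ x → f x ≡ g x [modℤ q ]) → S f ≡ S g [modℤ q ]
  S-cong f≈g = sum-cong-≋ {q} (λ i → f≈g (+ toℕ i))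

  S-+ : ∀ f g → S (λ x → f x + g x) ≡ S f + S g [modℤ q ]
  S-+ f g = ∑-distrib-+ {q} (λ i → f (+ toℕ i)) (λ i → g (+ toℕ i))

  telescope : ∀ n (f : ℕ → ℤ) → sum {n} (λ i → f (suc (toℕ i)) - f (toℕ i)) ≡ f n - f 0
  telescope zero    f = lemma (f 0)
    where
    lemma : ∀ a → + 0 ≡ a - a
    lemma = solve-∀
  telescope (suc n) f = trans (cong (λ z → f 1 - f 0 + z) (telescope n (f ∘ suc))) (lemma (f 0) (f 1) (f (suc n)))
    where
    lemma : ∀ a b c → b - a + (c - b) ≡ c - a
    lemma = solve-∀

  private
    T : ℕ → ℕ → ℤ
    T a b = S (λ x → x ℤ.^ a * (x + + 1) ℤ.^ b)

    T-step : ∀ a b → T a (suc b) ≡ T (suc a) b + T a b [modℤ q ]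
    T-step a b = Z.trans (S-cong (λ x → ≡⇒≡mod (lemma x (x ℤ.^ a) ((x + + 1) ℤ.^ b))))
      (S-+ (λ x → x ℤ.^ suc a * (x + + 1) ℤ.^ b) (λ x → x ℤ.^ a * (x + + 1) ℤ.^ b))
      where
      lemma : ∀ x A B → A * ((x + + 1) * B) ≡ x * A * B + A * B
      lemma = solve-∀

    -- The sum of x^i (x+1)^j over i + j = d, a geometric sum whose ratio has denominator (x+1) - x
    -- = 1; hence the closed form below.
    geo : ℕ → ℤ → ℤ
    geo zero    x = + 1
    geo (suc d) x = x * geo d x + (x + + 1) ℤ.^ suc d

    geo-closed : ∀ d x → geo d x ≡ (x + + 1) ℤ.^ suc d - x ℤ.^ suc d
    geo-closed zero x = lemma x
      where
      lemma : ∀ x → + 1 ≡ (x + + 1) * + 1 - x * + 1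
      lemma = solve-∀
    geo-closed (suc d) x = trans (cong (λ g → x * g + (x + + 1) ℤ.^ suc d) (geo-closed d x))
        (lemma x ((x + + 1) ℤ.^ suc d) (x ℤ.^ suc d))
      where
      lemma : ∀ x A B → x * (A - B) + A ≡ (x + + 1) * A - x * B
      lemma = solve-∀

    S-geo≡0 : ∀ d → S (geo d) ≡ + 0 [modℤ q ]
    S-geo≡0 d = begin
      S (geo d) ≡⟨ sum-cong-≗ {q} (λ i → pointwise (toℕ i)) ⟩
      sum {q} (λ i → f (suc (toℕ i)) - f (toℕ i)) ≡⟨ telescope q f ⟩
      + q * (+ q) ℤ.^ d - + 0 ≈⟨ +-≡mod (*-≡modʳ ((+ q) ℤ.^ d) m≡0) Z.refl ⟩
      + 0  ∎
      where
      f : ℕ → ℤ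
      f n = (+ n) ℤ.^ suc d
      pointwise : ∀ n → geo d (+ n) ≡ f (suc n) - f n
      pointwise n = trans (geo-closed d (+ n)) (cong (λ m → m ℤ.^ suc d - f n) (ℤ.+-comm (+ n) (+ 1)))

    -- The sums with a + b = d all agree once those of degree d - 1 vanish,
    -- and the d + 1 of them add up to a telescoping sum.
    Vanishing Constant : ℕ → Set
    Vanishing d = ∀ a b → suc (a ℕ.+ b) ≡ d → T a b ≡ + 0 [modℤ q ]
    Constant d = ∀ a b → a ℕ.+ b ≡ d → T a b ≡ T d 0 [modℤ q ]

    T≡P : ∀ d → Vanishing d → Constant d
    T≡P d van a zero    eq = ≡⇒≡mod (cong (λ n → T n 0) (trans (sym (ℕ.+-identityʳ a)) eq))
    T≡P d van a (suc b) eq = begin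
      T a (suc b) ≈⟨ T-step a b ⟩
      T (suc a) b + T a b ≈⟨ +-≡mod (T≡P d van (suc a) b eq′) (van a b eq′) ⟩
      T d 0 + + 0 ≈⟨ Z.+-identityʳ _ ⟩
      T d 0  ∎
      where
      eq′ : suc (a ℕ.+ b) ≡ d
      eq′ = trans (sym (ℕ.+-suc a b)) eq

    -- Splitting off the last term of `geo` lowers k and moves a factor x into x^c, so each of the k
    -- + 1 terms keeps total degree d, where all sums `T a b` agree.
    weighted : ∀ d → Constant d → ∀ k c → k ℕ.+ c ≡ d →
        S (λ x → x ℤ.^ c * geo k x) ≡ + suc k * T d 0 [modℤ q ]
    weighted d con zero    c refl = Z.sym (Z.*-identityˡ (T d 0))
    weighted d con (suc k) c refl = begin
      S (λ x → x ℤ.^ c * geo (suc k) x)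
        ≈⟨ S-cong (λ x → ≡⇒≡mod (lemma x (x ℤ.^ c) (geo k x) ((x + + 1) ℤ.^ suc k))) ⟩
      S (λ x → x ℤ.^ suc c * geo k x + x ℤ.^ c * (x + + 1) ℤ.^ suc k)
        ≈⟨ S-+ (λ x → x ℤ.^ suc c * geo k x) (λ x → x ℤ.^ c * (x + + 1) ℤ.^ suc k) ⟩
      S (λ x → x ℤ.^ suc c * geo k x) + T c (suc k)
        ≈⟨ +-≡mod (weighted d con k (suc c) (ℕ.+-suc k c)) (con c (suc k) (ℕ.+-comm c (suc k))) ⟩
      + suc k * T d 0 + T d 0
        ≈⟨ ≡⇒≡mod (lemma′ (+ suc k) (T d 0)) ⟩
      + suc (suc k) * T d 0  ∎
      where
      lemma : ∀ x A g B → A * (x * g + B) ≡ x * A * g + A * B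
      lemma = solve-∀
      lemma′ : ∀ k t → k * t + t ≡ (+ 1 + k) * t
      lemma′ = solve-∀

    -- The case k = d, c = 0 of `weighted` is a telescoping sum, so d + 1 times the common value
    -- vanishes; and d + 1 < q can be cancelled.
    T≡0-step : ∀ d → Vanishing d → suc d ℕ.< q → ∀ a b → a ℕ.+ b ≡ d → T a b ≡ + 0 [modℤ q ]
    T≡0-step d van d<q a b eq = Z.trans (T≡P d van a b eq) (regular (small≢0 {suc d} ℕ.z<s d<q) _ (begin
      + suc d * T d 0 ≈⟨ weighted d (T≡P d van) d 0 (ℕ.+-identityʳ d) ⟨
      S (λ x → x ℤ.^ 0 * geo d x) ≈⟨ S-cong (λ x → Z.*-identityˡ (geo d x)) ⟩
      S (geo d) ≈⟨ S-geo≡0 d ⟩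
      + 0                                  ∎))

    T≡0 : ∀ d → suc d ℕ.< q → ∀ a b → a ℕ.+ b ≡ d → T a b ≡ + 0 [modℤ q ]
    T≡0 zero    d<q = T≡0-step zero (λ _ _ ()) d<q
    T≡0 (suc d) d<q = T≡0-step (suc d) (λ a b eq → T≡0 d (ℕ.<-trans (ℕ.n<1+n _) d<q) a b (ℕ.suc-injective eq)) d<q

  -- The usual proof multiplies by an element whose k-th power is not 1. Here the existence of such
  -- an element is a consequence, drawn in `nontrivial`, so the sums are evaluated by telescoping.
  S-power≡0 : ∀ k → suc k ℕ.< q → S (ℤ._^ k) ≡ + 0 [modℤ q ]
  S-power≡0 k k<q = Z.trans (S-cong (λ x → Z.sym (Z.*-identityʳ (x ℤ.^ k)))) (T≡0 k k<q k 0 (ℕ.+-identityʳ k))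

  -- Induction on b through (1-x)^(b+1) + x (1-x)^b = (1-x)^b; neither side of this exceeds the
  -- permitted degree.
  S-beta≡0 : ∀ b a → suc (a ℕ.+ b) ℕ.< q → S (λ x → x ℤ.^ a * (+ 1 - x) ℤ.^ b) ≡ + 0 [modℤ q ]
  S-beta≡0 zero    a lt = Z.trans (S-cong (λ x → Z.*-identityʳ (x ℤ.^ a)))
      (S-power≡0 a (subst (λ n → suc n ℕ.< q) (ℕ.+-identityʳ a) lt))
  S-beta≡0 (suc b) a lt = begin
    B a (suc b) ≈⟨ Z.+-identityʳ _ ⟨
    B a (suc b) + + 0 ≈⟨ +-≡modˡ (B a (suc b)) (S-beta≡0 b (suc a) (subst (λ n → suc n ℕ.< q) (ℕ.+-suc a b) lt)) ⟨
    B a (suc b) + B (suc a) b ≈⟨ S-+ (λ x → x ℤ.^ a * (+ 1 - x) ℤ.^ suc b) (λ x → x ℤ.^ suc a * (+ 1 - x) ℤ.^ b) ⟨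
    S (λ x → x ℤ.^ a * (+ 1 - x) ℤ.^ suc b + x ℤ.^ suc a * (+ 1 - x) ℤ.^ b)
      ≈⟨ S-cong (λ x → ≡⇒≡mod (lemma x (x ℤ.^ a) ((+ 1 - x) ℤ.^ b))) ⟩
    B a b ≈⟨ S-beta≡0 b a (ℕ.≤-trans (ℕ.s≤s (ℕ.s≤s (ℕ.+-monoʳ-≤ a (ℕ.n≤1+n b)))) lt) ⟩
    + 0  ∎
    where
    B : ℕ → ℕ → ℤ
    B a b = S (λ x → x ℤ.^ a * (+ 1 - x) ℤ.^ b)
    lemma : ∀ x A C → A * ((+ 1 - x) * C) + x * A * C ≡ A * C
    lemma = solve-∀

-- Rings with integer constants and a cube root of unity

IntegersIn : CommutativeRing 0ℓ 0ℓ → Set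
IntegersIn R = ℤ.+-*-rawRing -Raw-AlmostCommutative⟶ fromCommutativeRing R

module IntegerSolver (R : CommutativeRing 0ℓ 0ℓ) (integers : IntegersIn R) where
  open CommutativeRing R using (_≈_; reflexive)
  open _-Raw-AlmostCommutative⟶_ integers

  coefficient≟ : ∀ a b → Maybe (⟦ a ⟧ ≈ ⟦ b ⟧)
  coefficient≟ a b with a ℤ.≟ b
  ... | yes a≡b = just (reflexive (cong ⟦_⟧ a≡b))
  ... | no _    = nothing

  open Algebra.Solver.Ring ℤ.+-*-rawRing (fromCommutativeRing R) integers coefficient≟ public
    using (solve; _:=_; _:+_; _:*_; _:-_; :-_; con)

-- The values of a cubic character: 0 and the powers of ω.
data Value : Set where
  𝟘 𝟙 𝕨 𝕨² : Value

infixl 7 _∙_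

_∙_ : Value → Value → Value
𝟘  ∙ v  = 𝟘
𝟙  ∙ v  = v
𝕨  ∙ 𝟘  = 𝟘
𝕨  ∙ 𝟙  = 𝕨
𝕨  ∙ 𝕨  = 𝕨²
𝕨  ∙ 𝕨² = 𝟙
𝕨² ∙ 𝟘  = 𝟘
𝕨² ∙ 𝟙  = 𝕨²
𝕨² ∙ 𝕨  = 𝟙
𝕨² ∙ 𝕨² = 𝕨

-- v = re v + im v * ω.
re im : Value → ℤ
re 𝟘  = + 0
re 𝟙  = + 1
re 𝕨  = + 0
re 𝕨² = -[1+ 0 ]
im 𝟘  = + 0
im 𝟙  = + 0
im 𝕨  = + 1
im 𝕨² = -[1+ 0 ]

module CubeRoot (R : CommutativeRing 0ℓ 0ℓ) (integers : IntegersIn R) where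
  open CommutativeRing R renaming (refl to ≈-refl; sym to ≈-sym; trans to ≈-trans)
  open _-Raw-AlmostCommutative⟶_ integers renaming (⟦_⟧ to ι)
  open IntegerSolver R integers
  open SetoidReasoning setoid

  module _ (ω : Carrier) (ω-root : ω * ω + ω + ι (+ 1) ≈ ι (+ 0)) where

    -- The ring solver does not know the relation of ω. Each use supplies the quotient c of x - y by
    -- ω² + ω + 1, which leaves a polynomial identity.
    modΦ : ∀ {x y} c → x ≈ y + (ω * ω + ω + ι (+ 1)) * c → x ≈ y
    modΦ {x} {y} c eq = ≈-trans eq (≈-trans (+-congˡ (*-congʳ ω-root)) (solve 2 (λ y c → y :+ con (+ 0) :* c := y) ≈-refl y c))

    ω³≈1 : ω * (ω * ω) ≈ ι (+ 1)
    ω³≈1 = modΦ (ω - ι (+ 1)) (solve 1 (λ ω → ω :* (ω :* ω) := con (+ 1) :+ (ω :* ω :+ ω :+ con (+ 1)) :* (ω :- con (+ 1))) ≈-refl ω)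

    eval : Value → Carrier
    eval 𝟘  = ι (+ 0)
    eval 𝟙  = ι (+ 1)
    eval 𝕨  = ω
    eval 𝕨² = ω * ω

    0ˡ : ∀ x → ι (+ 0) ≈ ι (+ 0) * x
    0ˡ = solve 1 (λ x → con (+ 0) := con (+ 0) :* x) ≈-refl
    0ʳ : ∀ x → ι (+ 0) ≈ x * ι (+ 0)
    0ʳ = solve 1 (λ x → con (+ 0) := x :* con (+ 0)) ≈-refl
    1ˡ : ∀ x → x ≈ ι (+ 1) * x
    1ˡ = solve 1 (λ x → x := con (+ 1) :* x) ≈-refl
    1ʳ : ∀ x → x ≈ x * ι (+ 1)
    1ʳ = solve 1 (λ x → x := x :* con (+ 1)) ≈-refl

    eval-∙ : ∀ u v → eval (u ∙ v) ≈ eval u * eval v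
    eval-∙ 𝟘  v  = 0ˡ (eval v)
    eval-∙ 𝟙  v  = 1ˡ (eval v)
    eval-∙ 𝕨  𝟘  = 0ʳ ω
    eval-∙ 𝕨  𝟙  = 1ʳ ω
    eval-∙ 𝕨  𝕨  = ≈-refl
    eval-∙ 𝕨  𝕨² = ≈-sym ω³≈1
    eval-∙ 𝕨² 𝟘  = 0ʳ (ω * ω)
    eval-∙ 𝕨² 𝟙  = 1ʳ (ω * ω)
    eval-∙ 𝕨² 𝕨  = ≈-sym (≈-trans (*-assoc ω ω ω) ω³≈1)
    eval-∙ 𝕨² 𝕨² = begin
      ω ≈⟨ 1ʳ ω ⟩
      ω * ι (+ 1) ≈⟨ *-congˡ ω³≈1 ⟨
      ω * (ω * (ω * ω)) ≈⟨ *-assoc ω ω (ω * ω) ⟨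
      ω * ω * (ω * ω)  ∎

    eval≈re+im*ω : ∀ v → eval v ≈ ι (re v) + ι (im v) * ω
    eval≈re+im*ω 𝟘  = solve 1 (λ ω → con (+ 0) := con (+ 0) :+ con (+ 0) :* ω) ≈-refl ω
    eval≈re+im*ω 𝟙  = solve 1 (λ ω → con (+ 1) := con (+ 1) :+ con (+ 0) :* ω) ≈-refl ω
    eval≈re+im*ω 𝕨  = solve 1 (λ ω → ω := con (+ 0) :+ con (+ 1) :* ω) ≈-refl ω
    eval≈re+im*ω 𝕨² = modΦ (ι (+ 1)) (solve 1 (λ ω → ω :* ω :=
      con (-[1+ 0 ]) :+ con (-[1+ 0 ]) :* ω :+ (ω :* ω :+ ω :+ con (+ 1)) :* con (+ 1)) ≈-refl ω)

    1+v+v²≈0 : ∀ v → v ≢ 𝟘 → v ≢ 𝟙 → eval 𝟙 + eval v + eval (v ∙ v) ≈ ι (+ 0)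
    1+v+v²≈0 𝟘  v≢0 v≢1 = ⊥-elim (v≢0 refl)
    1+v+v²≈0 𝟙  v≢0 v≢1 = ⊥-elim (v≢1 refl)
    1+v+v²≈0 𝕨  v≢0 v≢1 = ≈-trans (solve 1 (λ ω → con (+ 1) :+ ω :+ ω :* ω := ω :* ω :+ ω :+ con (+ 1)) ≈-refl ω) ω-root
    1+v+v²≈0 𝕨² v≢0 v≢1 = ≈-trans (solve 1 (λ ω → con (+ 1) :+ ω :* ω :+ ω := ω :* ω :+ ω :+ con (+ 1)) ≈-refl ω) ω-root

ℤ-in-ℤmod : ∀ m → IntegersIn (ℤmod m)
ℤ-in-ℤmod m = record
  { ⟦_⟧ = λ x → x
  ; +-homo = λ _ _ → ≡⇒≡mod refl
  ; *-homo = λ _ _ → ≡⇒≡mod refl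
  ; -‿homo = λ _ → ≡⇒≡mod refl
  ; 0-homo = ≡⇒≡mod refl
  ; 1-homo = ≡⇒≡mod refl
  }

-- The cubic residue symbol modulo q

module CubicSymbol {q e : ℕ} (pr : Prime q) (q≡1+3e : q ≡ suc (3 ℕ.* e))
    (w : ℤ) (w-root : w ℤ.* w ℤ.+ w ℤ.+ + 1 ≡ + 0 [modℤ q ]) where
  open import Data.Integer using (_+_; _*_; _-_; -_)
  open PrimeModulus pr
  open Fermat pr
  private
    module Z = CommutativeRing (ℤmod q)
  open CubeRoot (ℤmod q) (ℤ-in-ℤmod q)
  open Algebra.Properties.Semiring.Mult Z.semiring using () renaming (_×_ to _·_)
  open PowerSums pr using (S; S-beta≡0)
  open SetoidReasoning Z.setoid

  evalw : Value → ℤ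
  evalw = eval w w-root

  3≢0 : ¬ + 3 ≡ + 0 [modℤ q ]
  3≢0 3≡0 = 1≢0 (Z.trans (≡⇒≡mod (lemma (+ e))) (Z.trans (+-≡mod qq (*-≡modʳ (- (+ e)) 3≡0)) (≡⇒≡mod refl)))
    where
    lemma : ∀ e → + 1 ≡ (+ 1 + + 3 * e) + + 3 * (- e)
    lemma = solve-∀
    qq : + 1 + + 3 * + e ≡ + 0 [modℤ q ]
    qq = Z.trans (≡⇒≡mod (trans (cong (λ z → + 1 + z) (sym (ℤ.pos-* 3 e))) (cong +_ (sym q≡1+3e)))) m≡0

  0<e : 0 ℕ.< e
  0<e = go e q≡1+3e
    where
    go : ∀ k → q ≡ suc (3 ℕ.* k) → 0 ℕ.< k
    go zero    eq = ⊥-elim (1≢0 (subst (λ m → + m ≡ + 0 [modℤ q ]) eq m≡0))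
    go (suc _) _  = ℕ.s≤s ℕ.z≤n

  private
    unit≢0 : ∀ {x y} → x * y ≡ + 1 [modℤ q ] → ¬ x ≡ + 0 [modℤ q ]
    unit≢0 {x} {y} xy≡1 x≡0 = 1≢0 (Z.trans (Z.sym xy≡1) (*-≡modʳ y x≡0))

    w≢0 : ¬ w ≡ + 0 [modℤ q ]
    w≢0 = unit≢0 (ω³≈1 w w-root)

    w²≢0 : ¬ w * w ≡ + 0 [modℤ q ]
    w²≢0 = *-≢0 w≢0 w≢0

    w≢1 : ¬ w ≡ + 1 [modℤ q ]
    w≢1 w≡1 = 3≢0 (Z.trans (Z.sym (+-≡modʳ (+ 1) (+-≡mod (*-≡mod w≡1 w≡1) w≡1))) w-root)

    w²≢1 : ¬ w * w ≡ + 1 [modℤ q ]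
    w²≢1 w²≡1 = w≢1 (Z.trans (Z.sym (Z.*-identityʳ w)) (Z.trans (*-≡modˡ w (Z.sym w²≡1)) (ω³≈1 w w-root)))

    w²≢w : ¬ w * w ≡ w [modℤ q ]
    w²≢w w²≡w = w≢1 (*-cancelˡ w w≢0 (Z.trans w²≡w (Z.sym (Z.*-identityʳ w))))

  -- If two of 1, w, w² agreed, then w would be 1 and w² + w + 1 = 3 would vanish modulo q.
  evalw-injective : ∀ u v → evalw u ≡ evalw v [modℤ q ] → u ≡ v
  evalw-injective 𝟘  𝟘  eq = refl
  evalw-injective 𝟘  𝟙  eq = ⊥-elim (1≢0 (Z.sym eq))
  evalw-injective 𝟘  𝕨  eq = ⊥-elim (w≢0 (Z.sym eq))
  evalw-injective 𝟘  𝕨² eq = ⊥-elim (w²≢0 (Z.sym eq))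
  evalw-injective 𝟙  𝟘  eq = ⊥-elim (1≢0 eq)
  evalw-injective 𝟙  𝟙  eq = refl
  evalw-injective 𝟙  𝕨  eq = ⊥-elim (w≢1 (Z.sym eq))
  evalw-injective 𝟙  𝕨² eq = ⊥-elim (w²≢1 (Z.sym eq))
  evalw-injective 𝕨  𝟘  eq = ⊥-elim (w≢0 eq)
  evalw-injective 𝕨  𝟙  eq = ⊥-elim (w≢1 eq)
  evalw-injective 𝕨  𝕨  eq = refl
  evalw-injective 𝕨  𝕨² eq = ⊥-elim (w²≢w (Z.sym eq))
  evalw-injective 𝕨² 𝟘  eq = ⊥-elim (w²≢0 eq)
  evalw-injective 𝕨² 𝟙  eq = ⊥-elim (w²≢1 eq)
  evalw-injective 𝕨² 𝕨  eq = ⊥-elim (w²≢w eq)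
  evalw-injective 𝕨² 𝕨² eq = refl

  root-of-x³≡1 : ∀ x → x * (x * x) ≡ + 1 [modℤ q ] → ∃ λ v → evalw v ≡ x [modℤ q ]
  root-of-x³≡1 x x³≡1 = [ (λ eq → 𝟙 , Z.sym (-≡0⇒≡mod eq)) , (λ eq →
      [ (λ eq → 𝕨 , Z.sym (-≡0⇒≡mod eq)) , (λ eq → 𝕨² , Z.sym (-≡0⇒≡mod eq)) ]′
        (*≡0⇒≡0⊎≡0 (x - w) (x - w * w) eq)) ]′
    (*≡0⇒≡0⊎≡0 (x - + 1) ((x - w) * (x - w * w)) factored)
    where
    -- The quotient of (x-1)(x-w)(x-w²) - (x³-1) by w² + w + 1.
    c : ℤ
    c = x * w - x * x - w + + 1
    identity : ∀ x w → (x - + 1) * ((x - w) * (x - w * w)) ≡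
      (x * (x * x) - + 1) + (w * w + w + + 1) * (x * w - x * x - w + + 1)
    identity = solve-∀
    factored : (x - + 1) * ((x - w) * (x - w * w)) ≡ + 0 [modℤ q ]
    factored = Z.trans {j = (x * (x * x) - + 1) + (w * w + w + + 1) * c} (≡⇒≡mod (identity x w))
      (Z.trans (+-≡mod {x = x * (x * x) - + 1} {y = + 0} (≡mod⇒-≡0 x³≡1)
        (Z.trans (*-≡modʳ c w-root) (Z.zeroˡ c))) (Z.refl {+ 0}))

  private
    0^e≡0 : ∀ {x} → x ≡ + 0 [modℤ q ] → x ℤ.^ e ≡ + 0 [modℤ q ]
    0^e≡0 {x} x≡0 = go e 0<e
      where
      go : ∀ n → 0 ℕ.< n → x ℤ.^ n ≡ + 0 [modℤ q ]
      go (suc n) _ = *-≡modʳ (x ℤ.^ n) x≡0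

  abstract
    -- For n prime to q the cube of n^e is n^(q-1) ≡ 1. The value is sealed, and everything later
    -- follows from its congruence with n^e.
    symbol : ∀ n → ∃ λ v → evalw v ≡ (+ n) ℤ.^ e [modℤ q ]
    symbol n with ≡0? q (+ n)
    ... | yes n≡0 = 𝟘 , Z.sym (0^e≡0 n≡0)
    ... | no  n≢0 = root-of-x³≡1 ((+ n) ℤ.^ e) (begin
        x * (x * x) ≡⟨ cong (λ z → x * (x * z)) (sym (ℤ.*-identityʳ x)) ⟩
        x ℤ.^ 3 ≡⟨ trans (ℤ.^-*-assoc (+ n) e 3) (cong ((+ n) ℤ.^_) (ℕ.*-comm e 3)) ⟩
        (+ n) ℤ.^ (3 ℕ.* e) ≡⟨ cong (λ k → (+ n) ℤ.^ (k ∸ 1)) q≡1+3e ⟨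
        (+ n) ℤ.^ (q ∸ 1) ≈⟨ x^[p∸1]≡1 n≢0 ⟩
        + 1  ∎)
      where
      x : ℤ
      x = (+ n) ℤ.^ e

  χ : ℕ → Value
  χ n = proj₁ (symbol n)

  evalw-χ : ∀ n → evalw (χ n) ≡ (+ n) ℤ.^ e [modℤ q ]
  evalw-χ n = proj₂ (symbol n)

  χ-unique : ∀ n v → evalw v ≡ (+ n) ℤ.^ e [modℤ q ] → χ n ≡ v
  χ-unique n v eq = evalw-injective (χ n) v (Z.trans (evalw-χ n) (Z.sym eq))

  χ-cong : ∀ {m n} → + m ≡ + n [modℤ q ] → χ m ≡ χ n
  χ-cong {m} {n} eq = χ-unique m (χ n) (Z.trans (evalw-χ n) (^-≡mod e (Z.sym eq)))

  χ-* : ∀ m n → χ (m ℕ.* n) ≡ χ m ∙ χ n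
  χ-* m n = χ-unique (m ℕ.* n) (χ m ∙ χ n) (begin
    evalw (χ m ∙ χ n) ≈⟨ eval-∙ w w-root (χ m) (χ n) ⟩
    evalw (χ m) * evalw (χ n) ≈⟨ *-≡mod (evalw-χ m) (evalw-χ n) ⟩
    (+ m) ℤ.^ e * (+ n) ℤ.^ e ≡⟨ ℤ^-distrib-* (+ m) (+ n) e ⟨
    (+ m * + n) ℤ.^ e ≡⟨ cong (ℤ._^ e) (ℤ.pos-* m n) ⟨
    (+ (m ℕ.* n)) ℤ.^ e  ∎)

  χ1≡𝟙 : χ 1 ≡ 𝟙
  χ1≡𝟙 = χ-unique 1 𝟙 (≡⇒≡mod (sym (ℤ.^-zeroˡ e)))

  n≡0⇒χ≡𝟘 : ∀ {n} → + n ≡ + 0 [modℤ q ] → χ n ≡ 𝟘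
  n≡0⇒χ≡𝟘 {n} n≡0 = χ-unique n 𝟘 (Z.sym (0^e≡0 n≡0))

  χ≡𝟘⇒n≡0 : ∀ {n} → χ n ≡ 𝟘 → + n ≡ + 0 [modℤ q ]
  χ≡𝟘⇒n≡0 {n} χn≡𝟘 with ≡0? q (+ n)
  ... | yes n≡0 = n≡0
  ... | no  n≢0 = ⊥-elim (^-≢0 e n≢0 (Z.trans (Z.sym (evalw-χ n)) (≡⇒≡mod (cong evalw χn≡𝟘))))

  private
    _≟ⱽ𝟙 : ∀ v → Dec (v ≡ 𝟙)
    𝟘  ≟ⱽ𝟙 = no λ ()
    𝟙  ≟ⱽ𝟙 = yes refl
    𝕨  ≟ⱽ𝟙 = no λ ()
    𝕨² ≟ⱽ𝟙 = no λ ()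

    suc[2e]<q : suc (e ℕ.+ e) ℕ.< q
    suc[2e]<q = subst (suc (e ℕ.+ e) ℕ.<_) (sym q≡1+3e)
      (ℕ.s≤s (subst (suc (e ℕ.+ e) ℕ.≤_) (lemma e) (ℕ.+-monoˡ-≤ (e ℕ.+ e) 0<e)))
      where
      lemma : ∀ e → e ℕ.+ (e ℕ.+ e) ≡ 3 ℕ.* e
      lemma = ℕSolver.solve-∀

  -- Otherwise the power sum of exponent e would be q - 1.
  nontrivial : ∃ λ g → χ g ≢ 𝟘 × χ g ≢ 𝟙
  nontrivial with Fin.any? {3 ℕ.* e} (λ i → ¬? (χ (suc (toℕ i)) ≟ⱽ𝟙))
  ... | yes (i , χ≢1) = suc (toℕ i) , (λ eq → small≢0 ℕ.z<s (subst (suc (toℕ i) ℕ.<_) (sym q≡1+3e) (ℕ.s≤s (Fin.toℕ<n i))) (χ≡𝟘⇒n≡0 eq)) , χ≢1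
  ... | no  ¬any = ⊥-elim (1≢0 (begin
      + 1 ≈⟨ Z.+-identityʳ (+ 1) ⟨
      + 1 + + 0 ≈⟨ +-≡modˡ (+ 1) (Z.sym n≡0) ⟩
      + 1 + + n ≡⟨ cong +_ q≡1+3e ⟨
      + q ≈⟨ m≡0 ⟩
      + 0                            ∎))
      where
      open PowerSums pr using (S-power≡0)
      open Algebra.Properties.Semiring.Sum Z.semiring
      n = 3 ℕ.* e
      all-one : ∀ i → (+ suc (toℕ i)) ℤ.^ e ≡ + 1 [modℤ q ]
      all-one i = Z.trans (Z.sym (evalw-χ (suc (toℕ i)))) (≡⇒≡mod (cong evalw
        (decidable-stable (χ (suc (toℕ i)) ≟ⱽ𝟙) (λ χ≢1 → ¬any (i , χ≢1)))))
      n≡0 : + n ≡ + 0 [modℤ q ]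
      n≡0 = begin
        + n ≡⟨ ·1≡ n ⟨
        n · (+ 1) ≈⟨ sum-replicate n ⟨
        sum {n} (λ i → + 1) ≈⟨ sum-cong-≋ {n} all-one ⟨
        sum {n} (λ i → (+ suc (toℕ i)) ℤ.^ e) ≈⟨ Z.+-identityˡ _ ⟨
        + 0 + sum {n} (λ i → (+ suc (toℕ i)) ℤ.^ e) ≈⟨ +-≡mod (0^e≡0 {+ 0} Z.refl) Z.refl ⟨
        sum {suc n} (λ i → (+ toℕ i) ℤ.^ e) ≡⟨ cong (λ m → sum {m} (λ i → (+ toℕ i) ℤ.^ e)) q≡1+3e ⟨
        S (ℤ._^ e) ≈⟨ S-power≡0 e (ℕ.≤-<-trans (ℕ.s≤s (ℕ.m≤m+n e e)) suc[2e]<q) ⟩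
        + 0  ∎

  Σevalw-beta : S (λ x → x ℤ.^ e * (+ 1 - x) ℤ.^ e) ≡ + 0 [modℤ q ]
  Σevalw-beta = S-beta≡0 e e suc[2e]<q

-- The ring ℤ[ω, ζ] modulo m

record Cyclotomic (m q : ℕ) : Set₁ where
  field
    commRing : CommutativeRing 0ℓ 0ℓ
    integers : IntegersIn commRing
  open CommutativeRing commRing public renaming (refl to ≈-refl; sym to ≈-sym; trans to ≈-trans)
  open _-Raw-AlmostCommutative⟶_ integers public renaming (⟦_⟧ to ι)
  open Algebra.Properties.Semiring.Sum semiring public
  open Algebra.Properties.Semiring.Exp semiring public renaming (_^_ to _^ᴿ_)
  field
    ω ζ         : Carrier
    ω-root      : ω * ω + ω + ι (+ 1) ≈ ι (+ 0)
    ζ^q≈1       : ζ ^ᴿ q ≈ ι (+ 1)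
    -- Does not follow from ζ^q = 1; it rules out ζ = 1 and gives the orthogonality in `G*G′≈q`.
    Σζ≈0        : sum {q} (λ i → ζ ^ᴿ toℕ i) ≈ ι (+ 0)
    ι-cong      : ∀ {x y} → x ≡ y [modℤ m ] → ι x ≈ ι y
    ι-injective : ∀ x y → ι x + ι y * ω ≈ ι (+ 0) → x ≡ + 0 [modℤ m ] × y ≡ + 0 [modℤ m ]
    ι-regular   : ∀ {c} → Regular m c → ∀ x → ι c * x ≈ ι (+ 0) → x ≈ ι (+ 0)

-- ℤ[ω, ζ] modulo m is realised by formal sums of terms c ωⁱ ζʲ; two of them are
-- equal when every linear functional that respects the relations of ω and ζ
-- takes congruent values on them.
module FormalSums (m q : ℕ) (1<q : 1 ℕ.< q) where
  open import Data.Integer using (_+_; _*_; _-_; -_)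

  Functional : Set
  Functional = ℕ → ℕ → ℤ

  FormalSum : Set
  FormalSum = List (ℤ × ℕ × ℕ)

  ev : Functional → FormalSum → ℤ
  ev f [] = + 0
  ev f ((c , i , j) ∷ a) = c * f i j + ev f a

  shift : Functional → ℕ → ℕ → Functional
  shift f k l i j = f (i ℕ.+ k) (j ℕ.+ l)

  module Σℤ = Algebra.Properties.Semiring.Sum (CommutativeRing.semiring ℤ.+-*-commutativeRing)

  record Admissible (f : Functional) : Set where
    field
      ω-relation : ∀ i j → f (2 ℕ.+ i) j + f (1 ℕ.+ i) j + f i j ≡ + 0
      ζ-period   : ∀ i j → f i (q ℕ.+ j) ≡ f i j
      ζ-relation : ∀ i k → Σℤ.sum {q} (λ j → f i (toℕ j ℕ.+ k)) ≡ + 0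
  open Admissible

  -- Shifting a functional is dual to multiplication by ω^k ζ^l. Stability under shifts is what
  -- makes ⊗ respect ≋.
  shift-admissible : ∀ {f} k l → Admissible f → Admissible (shift f k l)
  shift-admissible {f} k l adm = record
    { ω-relation = λ i j → ω-relation adm (i ℕ.+ k) (j ℕ.+ l)
    ; ζ-period = λ i j → trans (cong (f (i ℕ.+ k)) (ℕ.+-assoc q j l)) (ζ-period adm (i ℕ.+ k) (j ℕ.+ l))
    ; ζ-relation = λ i n → trans (Σℤ.sum-cong-≗ {q} (λ j → cong (f (i ℕ.+ k)) (ℕ.+-assoc (toℕ j) n l)))
        (ζ-relation adm (i ℕ.+ k) (n ℕ.+ l))
    }

  scale : ℤ → ℕ → ℕ → FormalSum → FormalSum
  scale c k l []                = []
  scale c k l ((d , i , j) ∷ a) = (c * d , i ℕ.+ k , j ℕ.+ l) ∷ scale c k l a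

  infixl 7 _⊗_

  _⊗_ : FormalSum → FormalSum → FormalSum
  []                ⊗ b = []
  ((c , i , j) ∷ a) ⊗ b = scale c i j b ++ a ⊗ b

  ⊖_ : FormalSum → FormalSum
  ⊖ []                = []
  ⊖ ((c , i , j) ∷ a) = (- c , i , j) ∷ ⊖ a

  ev-cong : ∀ {f g} → (∀ i j → f i j ≡ g i j) → ∀ a → ev f a ≡ ev g a
  ev-cong f≗g []                = refl
  ev-cong f≗g ((c , i , j) ∷ a) = cong₂ (λ x y → c * x + y) (f≗g i j) (ev-cong f≗g a)

  ev-≡mod : ∀ {f g} → (∀ i j → f i j ≡ g i j [modℤ m ]) → ∀ a → ev f a ≡ ev g a [modℤ m ]
  ev-≡mod f≗g []                = ≡⇒≡mod refl
  ev-≡mod f≗g ((c , i , j) ∷ a) = +-≡mod (*-≡mod {x = c} (≡⇒≡mod refl) (f≗g i j)) (ev-≡mod f≗g a)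

  ev-++ : ∀ f a b → ev f (a ++ b) ≡ ev f a + ev f b
  ev-++ f []                b = sym (ℤ.+-identityˡ _)
  ev-++ f ((c , i , j) ∷ a) b = trans (cong (λ x → c * f i j + x) (ev-++ f a b)) (sym (ℤ.+-assoc (c * f i j) _ _))

  ev-⊖ : ∀ f a → ev f (⊖ a) ≡ - ev f a
  ev-⊖ f []                = refl
  ev-⊖ f ((c , i , j) ∷ a) = trans (cong (λ x → - c * f i j + x) (ev-⊖ f a)) (lemma c (f i j) (ev f a))
    where
    lemma : ∀ c x y → - c * x + - y ≡ - (c * x + y)
    lemma = solve-∀

  ev-scale : ∀ f c k l a → ev f (scale c k l a) ≡ c * ev (shift f k l) a
  ev-scale f c k l []                = sym (ℤ.*-zeroʳ c)
  ev-scale f c k l ((d , i , j) ∷ a) =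
    trans (cong (λ x → c * d * f (i ℕ.+ k) (j ℕ.+ l) + x) (ev-scale f c k l a))
          (lemma c d (f (i ℕ.+ k) (j ℕ.+ l)) (ev (shift f k l) a))
    where
    lemma : ∀ c d x y → c * d * x + c * y ≡ c * (d * x + y)
    lemma = solve-∀

  ev-⊗ : ∀ f a b → ev f (a ⊗ b) ≡ ev (λ i j → ev (shift f i j) b) a
  ev-⊗ f []                b = refl
  ev-⊗ f ((c , i , j) ∷ a) b = trans (ev-++ f (scale c i j b) (a ⊗ b)) (cong₂ ℤ._+_ (ev-scale f c i j b) (ev-⊗ f a b))

  ev-zero : ∀ a → ev (λ i j → + 0) a ≡ + 0
  ev-zero []                = refl
  ev-zero ((c , i , j) ∷ a) = cong₂ ℤ._+_ (ℤ.*-zeroʳ c) (ev-zero a)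

  ev-linear : ∀ c f g a → ev (λ i j → c * f i j + g i j) a ≡ c * ev f a + ev g a
  ev-linear c f g []                = sym (cong (λ x → x + + 0) (ℤ.*-zeroʳ c))
  ev-linear c f g ((d , i , j) ∷ a) =
    trans (cong (λ x → d * (c * f i j + g i j) + x) (ev-linear c f g a)) (lemma c d (f i j) (g i j) (ev f a) (ev g a))
    where
    lemma : ∀ c d x y u v → d * (c * x + y) + (c * u + v) ≡ c * (d * x + u) + (d * y + v)
    lemma = solve-∀

  -- Interchange of two finite sums, the source of the commutativity of ⊗.
  ev-swap : ∀ (F : ℕ → ℕ → Functional) a b →
      ev (λ i j → ev (F i j) b) a ≡ ev (λ k l → ev (λ i j → F i j k l) a) b
  ev-swap F []                b = sym (ev-zero b)
  ev-swap F ((c , i , j) ∷ a) b = trans (cong (λ x → c * ev (F i j) b + x) (ev-swap F a b))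
    (sym (ev-linear c (F i j) (λ k l → ev (λ i j → F i j k l) a) b))

  infix 4 _≋_

  record _≋_ (a b : FormalSum) : Set where
    constructor tested
    field
      test : ∀ f → Admissible f → ev f a ≡ ev f b [modℤ m ]
  open _≋_

  ev≡⇒≋ : ∀ {a b} → (∀ f → ev f a ≡ ev f b) → a ≋ b
  ev≡⇒≋ eq = tested λ f _ → ≡⇒≡mod (eq f)

  ≋-trans : ∀ {a b c} → a ≋ b → b ≋ c → a ≋ c
  ≋-trans a≋b b≋c = tested λ f adm → ≡mod-trans (test a≋b f adm) (test b≋c f adm)

  const : ℤ → FormalSum
  const c = (c , 0 , 0) ∷ []

  ⊗-comm : ∀ a b → a ⊗ b ≋ b ⊗ a
  ⊗-comm a b = ev≡⇒≋ λ f → trans (ev-⊗ f a b) (trans (ev-swap (shift f) a b)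
    (trans (ev-cong (λ k l → ev-cong (λ i j → cong₂ f (ℕ.+-comm k i) (ℕ.+-comm l j)) a) b) (sym (ev-⊗ f b a))))

  ⊗-congˡ : ∀ a {b c} → b ≋ c → a ⊗ b ≋ a ⊗ c
  ⊗-congˡ a {b} {c} b≋c = tested λ f adm → ≡mod-trans (≡⇒≡mod (ev-⊗ f a b))
    (≡mod-trans (ev-≡mod (λ i j → test b≋c (shift f i j) (shift-admissible i j adm)) a) (≡⇒≡mod (sym (ev-⊗ f a c))))

  ⊗-cong : ∀ {a b c d} → a ≋ b → c ≋ d → a ⊗ c ≋ b ⊗ d
  ⊗-cong {a} {b} {c} {d} a≋b c≋d = ≋-trans (⊗-congˡ a c≋d) (≋-trans (⊗-comm a d) (≋-trans (⊗-congˡ d a≋b) (⊗-comm d b)))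

  ⊗-assoc : ∀ a b c → (a ⊗ b) ⊗ c ≋ a ⊗ (b ⊗ c)
  ⊗-assoc a b c = ev≡⇒≋ λ f → begin
    ev f ((a ⊗ b) ⊗ c) ≡⟨ ev-⊗ f (a ⊗ b) c ⟩
    ev (λ i j → ev (shift f i j) c) (a ⊗ b) ≡⟨ ev-⊗ _ a b ⟩
    ev (λ i j → ev (λ k l → ev (shift f (k ℕ.+ i) (l ℕ.+ j)) c) b) a
      ≡⟨ ev-cong (λ i j → ev-cong (λ k l → ev-cong (λ x y → cong₂ f (sym (ℕ.+-assoc x k i)) (sym (ℕ.+-assoc y l j))) c) b) a ⟩
    ev (λ i j → ev (λ k l → ev (shift (shift f i j) k l) c) b) a ≡⟨ ev-cong (λ i j → sym (ev-⊗ (shift f i j) b c)) a ⟩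
    ev (λ i j → ev (shift f i j) (b ⊗ c)) a ≡⟨ sym (ev-⊗ f a (b ⊗ c)) ⟩
    ev f (a ⊗ (b ⊗ c))  ∎
    where open ≡-Reasoning

  shift-0-0 : ∀ f i j → shift f 0 0 i j ≡ f i j
  shift-0-0 f i j = cong₂ f (ℕ.+-identityʳ i) (ℕ.+-identityʳ j)

  ev-const-⊗ : ∀ f c a → ev f (const c ⊗ a) ≡ c * ev f a
  ev-const-⊗ f c a = trans (ev-⊗ f (const c) a) (trans (ℤ.+-identityʳ _) (cong (λ x → c * x) (ev-cong (shift-0-0 f) a)))

  ⊗-identityˡ : ∀ a → const (+ 1) ⊗ a ≋ a
  ⊗-identityˡ a = ev≡⇒≋ λ f → trans (ev-const-⊗ f (+ 1) a) (ℤ.*-identityˡ _)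

  ⊗-distribʳ : ∀ a b c → (b ++ c) ⊗ a ≋ b ⊗ a ++ c ⊗ a
  ⊗-distribʳ a b c = ev≡⇒≋ λ f → trans (ev-⊗ f (b ++ c) a) (trans (ev-++ _ b c)
    (trans (cong₂ ℤ._+_ (sym (ev-⊗ f b a)) (sym (ev-⊗ f c a))) (sym (ev-++ f (b ⊗ a) (c ⊗ a)))))

  ++-≋-cong : ∀ {a b c d} → a ≋ b → c ≋ d → a ++ c ≋ b ++ d
  ++-≋-cong {a} {b} {c} {d} a≋b c≋d = tested λ f adm → ≡mod-trans (≡⇒≡mod (ev-++ f a c))
    (≡mod-trans (+-≡mod (test a≋b f adm) (test c≋d f adm)) (≡⇒≡mod (sym (ev-++ f b d))))

  ++-≋-comm : ∀ a b → a ++ b ≋ b ++ a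
  ++-≋-comm a b = ev≡⇒≋ λ f → trans (ev-++ f a b) (trans (ℤ.+-comm (ev f a) (ev f b)) (sym (ev-++ f b a)))

  ++-≋-assoc : ∀ a b c → (a ++ b) ++ c ≋ a ++ (b ++ c)
  ++-≋-assoc a b c = ev≡⇒≋ λ f → trans (ev-++ f (a ++ b) c) (trans (cong (λ x → x + ev f c) (ev-++ f a b))
    (trans (ℤ.+-assoc (ev f a) (ev f b) (ev f c))
      (sym (trans (ev-++ f a (b ++ c)) (cong (λ x → ev f a + x) (ev-++ f b c))))))

  ⊖-inverseˡ : ∀ a → ⊖ a ++ a ≋ []
  ⊖-inverseˡ a = ev≡⇒≋ λ f → trans (ev-++ f (⊖ a) a) (trans (cong (λ x → x + ev f a) (ev-⊖ f a)) (ℤ.+-inverseˡ (ev f a)))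

  ⊖-cong : ∀ {a b} → a ≋ b → ⊖ a ≋ ⊖ b
  ⊖-cong {a} {b} a≋b = tested λ f adm → ≡mod-trans (≡⇒≡mod (ev-⊖ f a))
    (≡mod-trans (neg-≡mod (test a≋b f adm)) (≡⇒≡mod (sym (ev-⊖ f b))))

  formalRing : CommutativeRing 0ℓ 0ℓ
  formalRing = record
    { Carrier = FormalSum
    ; _≈_ = _≋_
    ; _+_ = _++_
    ; _*_ = _⊗_
    ; -_ = ⊖_
    ; 0# = []
    ; 1# = const (+ 1)
    ; isCommutativeRing = record
      { isRing = record
        { +-isAbelianGroup = record
          { isGroup = record
            { isMonoid = record
              { isSemigroup = record
                { isMagma = record
                  { isEquivalence = record
                    { refl = ev≡⇒≋ λ _ → refl
                    ; sym = λ a≋b → tested λ f adm → ≡mod-sym (test a≋b f adm)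
                    ; trans = ≋-trans
                    }
                  ; ∙-cong = ++-≋-cong
                  }
                ; assoc = ++-≋-assoc
                }
              ; identity = (λ a → ev≡⇒≋ λ _ → refl)
                  , (λ a → ev≡⇒≋ λ f → trans (ev-++ f a []) (ℤ.+-identityʳ _))
              }
            ; inverse = ⊖-inverseˡ , (λ a → ≋-trans (++-≋-comm a (⊖ a)) (⊖-inverseˡ a))
            ; ⁻¹-cong = ⊖-cong
            }
          ; comm = ++-≋-comm
          }
        ; *-cong = ⊗-cong
        ; *-assoc = ⊗-assoc
        ; *-identity = ⊗-identityˡ , (λ a → ≋-trans (⊗-comm a (const (+ 1))) (⊗-identityˡ a))
        ; distrib = (λ a b c → ≋-trans (⊗-comm a (b ++ c)) (≋-trans (⊗-distribʳ a b c) (++-≋-cong (⊗-comm b a) (⊗-comm c a))))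
            , ⊗-distribʳ
        }
      ; *-comm = ⊗-comm
      }
    }

  constants : IntegersIn formalRing
  constants = record
    { ⟦_⟧ = const
    ; +-homo = λ x y → ev≡⇒≋ λ f → lemma x y (f 0 0)
    ; *-homo = λ x y → ev≡⇒≋ λ f → refl
    ; -‿homo = λ x → ev≡⇒≋ λ f → refl
    ; 0-homo = ev≡⇒≋ λ f → refl
    ; 1-homo = ev≡⇒≋ λ f → refl
    }
    where
    lemma : ∀ x y z → (x + y) * z + + 0 ≡ x * z + (y * z + + 0)
    lemma = solve-∀

  ωᶠ ζᶠ : FormalSum
  ωᶠ = (+ 1 , 1 , 0) ∷ []
  ζᶠ = (+ 1 , 0 , 1) ∷ []

  open Algebra.Properties.Semiring.Exp (CommutativeRing.semiring formalRing) using () renaming (_^_ to _^ᶠ_)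
  open Algebra.Properties.Semiring.Sum (CommutativeRing.semiring formalRing) using () renaming (sum to sumᶠ)

  ev-ζ^ : ∀ n f → ev f (ζᶠ ^ᶠ n) ≡ f 0 n
  ev-ζ^ zero    f = trans (ℤ.+-identityʳ _) (ℤ.*-identityˡ _)
  ev-ζ^ (suc n) f = trans (ev-⊗ f ζᶠ (ζᶠ ^ᶠ n)) (trans (ℤ.+-identityʳ _) (trans (ℤ.*-identityˡ _)
    (trans (ev-ζ^ n (shift f 0 1)) (cong (f 0) (ℕ.+-comm n 1)))))

  ev-sum : ∀ f {n} (v : Fin n → FormalSum) → ev f (sumᶠ v) ≡ Σℤ.sum (λ i → ev f (v i))
  ev-sum f {zero}  v = refl
  ev-sum f {suc n} v = trans (ev-++ f (v Fin.zero) _) (cong (λ x → ev f (v Fin.zero) + x) (ev-sum f (v ∘ Fin.suc)))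

  -- A functional on powers of ω that respects ω² + ω + 1 = 0 is determined by its values at 1 and
  -- ω, and these are arbitrary.
  period3 : ℤ → ℤ → ℕ → ℤ
  period3 x y 0             = x
  period3 x y 1             = y
  period3 x y (suc (suc i)) = - period3 x y (suc i) - period3 x y i

  private instance
    q≢0 : ℕ.NonZero q
    q≢0 = ℕ.>-nonZero (ℕ.<-trans ℕ.z<s 1<q)

  at0 : ℕ → ℤ
  at0 zero    = + 1
  at0 (suc _) = + 0

  -- A functional on powers of ζ has to sum to 0 over a period. The indicator of q ∣ j does not, but
  -- its difference with its translate does, and it still takes the value 1 at j = 0 because 1 < q.
  indicator difference : ℕ → ℤ
  indicator j = at0 (j ℕ.% q)
  difference j = indicator j - indicator (suc j)

  difference0≡1 : difference 0 ≡ + 1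
  difference0≡1 = cong₂ (λ x y → at0 x - at0 y) (ℕ.m<n⇒m%n≡m {n = q} (ℕ.<-trans ℕ.z<s 1<q)) (ℕ.m<n⇒m%n≡m 1<q)

  indicator-period : ∀ j → indicator (q ℕ.+ j) ≡ indicator j
  indicator-period j = cong at0 (trans (cong (ℕ._% q) (ℕ.+-comm q j)) (ℕ.[m+n]%n≡m%n j q))

  functional : ℤ → ℤ → Functional
  functional x y i j = period3 x y i * difference j

  functional-admissible : ∀ x y → Admissible (functional x y)
  functional-admissible x y = record
    { ω-relation = λ i j → lemma (period3 x y (suc i)) (period3 x y i) (difference j)
    ; ζ-period = λ i j → cong (λ z → period3 x y i * z) (difference-period j)
    ; ζ-relation = λ i k → trans (sym (Σℤ.*-distribˡ-sum {q} (period3 x y i) (λ j → difference (toℕ j ℕ.+ k))))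
        (trans (cong (λ z → period3 x y i * z) (telescoped q (λ j → indicator (j ℕ.+ k))))
          (trans (cong (λ z → period3 x y i * (indicator k - z)) (indicator-period k)) (lemma′ (period3 x y i) (indicator k))))
    }
    where
    difference-period : ∀ j → difference (q ℕ.+ j) ≡ difference j
    difference-period j = cong₂ (λ a b → a - b) (indicator-period j)
      (trans (cong indicator (sym (ℕ.+-suc q j))) (indicator-period (suc j)))
    lemma : ∀ a b d → (- a - b) * d + a * d + b * d ≡ + 0
    lemma = solve-∀
    lemma′ : ∀ a b → a * (b - b) ≡ + 0
    lemma′ = solve-∀
    telescoped : ∀ n (g : ℕ → ℤ) → Σℤ.sum {n} (λ j → g (toℕ j) - g (suc (toℕ j))) ≡ g 0 - g n
    telescoped zero    g = sym (ℤ.+-inverseʳ (g 0))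
    telescoped (suc n) g = trans (cong (λ z → g 0 - g 1 + z) (telescoped n (g ∘ suc))) (lemma″ (g 0) (g 1) (g (suc n)))
      where
      lemma″ : ∀ a b c → a - b + (b - c) ≡ a - c
      lemma″ = solve-∀

  -- The functionals dual to 1 and ω read off the two coordinates.
  const-injective : ∀ x y → const x ++ const y ⊗ ωᶠ ≋ const (+ 0) → x ≡ + 0 [modℤ m ] × y ≡ + 0 [modℤ m ]
  const-injective x y eq = use (+ 1) (+ 0) x (lemma₁ x y) , use (+ 0) (+ 1) y (lemma₂ x y)
    where
    ev-at : ∀ a b → ev (functional a b) (const x ++ const y ⊗ ωᶠ) ≡ x * a + y * b
    ev-at a b = trans (cong (λ d → x * (a * d) + (y * + 1 * (b * d) + + 0)) difference0≡1) (lemma x y a b)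
      where
      lemma : ∀ x y a b → x * (a * + 1) + (y * + 1 * (b * + 1) + + 0) ≡ x * a + y * b
      lemma = solve-∀
    use : ∀ a b z → x * a + y * b ≡ z → z ≡ + 0 [modℤ m ]
    use a b z eq′ = ≡mod-trans (≡⇒≡mod (sym (trans (ev-at a b) eq′)))
      (test eq (functional a b) (functional-admissible a b))
    lemma₁ : ∀ x y → x * + 1 + y * + 0 ≡ x
    lemma₁ = solve-∀
    lemma₂ : ∀ x y → x * + 0 + y * + 1 ≡ y
    lemma₂ = solve-∀

  cyclotomic : Cyclotomic m q
  cyclotomic = record
    { commRing = formalRing
    ; integers = constants
    ; ω = ωᶠ
    ; ζ = ζᶠ
    ; ω-root = tested λ f adm → ≡⇒≡mod (trans (lemma (f 2 0) (f 1 0) (f 0 0)) (ω-relation adm 0 0))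
    ; ζ^q≈1 = tested λ f adm → ≡⇒≡mod (trans (ev-ζ^ q f) (trans (trans (cong (f 0) (sym (ℕ.+-identityʳ q))) (ζ-period adm 0 0)) (lemma′ (f 0 0))))
    ; Σζ≈0 = tested λ f adm → ≡⇒≡mod (trans (ev-sum f {q} _) (trans
        (Σℤ.sum-cong-≗ {q} (λ j → trans (ev-ζ^ (toℕ j) f) (cong (f 0) (sym (ℕ.+-identityʳ (toℕ j)))))) (ζ-relation adm 0 0)))
    ; ι-cong = λ x≡y → tested λ f _ → +-≡mod (*-≡mod x≡y (≡⇒≡mod {x = f 0 0} refl)) (≡⇒≡mod {x = + 0} refl)
    ; ι-injective = const-injective
    -- Every test turns multiplication by the constant c into multiplication of an integer by c,
    -- where c cancels.
    ; ι-regular = λ {c} reg a eq → tested λ f adm → reg (ev f a) (≡mod-trans (≡⇒≡mod (sym (ev-const-⊗ f c a))) (test eq f adm))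
    }
    where
    lemma : ∀ a b c → + 1 * + 1 * a + (+ 1 * b + (+ 1 * c + + 0)) ≡ a + b + c
    lemma = solve-∀
    lemma′ : ∀ a → a ≡ + 1 * a + + 0
    lemma′ = solve-∀

square-∙ : ∀ u v → (u ∙ v) ∙ (u ∙ v) ≡ (u ∙ u) ∙ (v ∙ v)
square-∙ 𝟘  v  = refl
square-∙ 𝟙  v  = refl
square-∙ 𝕨  𝟘  = refl
square-∙ 𝕨  𝟙  = refl
square-∙ 𝕨  𝕨  = refl
square-∙ 𝕨  𝕨² = refl
square-∙ 𝕨² 𝟘  = refl
square-∙ 𝕨² 𝟙  = refl
square-∙ 𝕨² 𝕨  = refl
square-∙ 𝕨² 𝕨² = refl

square-square : ∀ v → (v ∙ v) ∙ (v ∙ v) ≡ v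
square-square 𝟘  = refl
square-square 𝟙  = refl
square-square 𝕨  = refl
square-square 𝕨² = refl

square≡𝟙 : ∀ v → v ∙ v ≡ 𝟙 → v ≡ 𝟙
square≡𝟙 v eq = trans (sym (square-square v)) (cong₂ _∙_ eq eq)

cube≡𝟙 : ∀ v → v ≢ 𝟘 → (v ∙ v) ∙ v ≡ 𝟙
cube≡𝟙 𝟘  v≢𝟘 = ⊥-elim (v≢𝟘 refl)
cube≡𝟙 𝟙  v≢𝟘 = refl
cube≡𝟙 𝕨  v≢𝟘 = refl
cube≡𝟙 𝕨² v≢𝟘 = refl

-- Sums over residues modulo q and substitutions in them

module Residues {q : ℕ} (pr : Prime q) where
  open PrimeModulus pr
  open Fermat pr
  private
    module Z = CommutativeRing (ℤmod q)
    instance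
      q≢0 : ℕ.NonZero q
      q≢0 = prime⇒nonZero pr

  ≡mod⇒≡-≤ : ∀ {a b} → a ℕ.≤ b → b ℕ.< q → + a ≡ + b [modℤ q ] → a ≡ b
  ≡mod⇒≡-≤ {a} {b} a≤b b<q eq = helper (b ∸ a) (ℕ.m+[n∸m]≡n a≤b)
    where
    lemma : ∀ a n → n ≡ a ℤ.+ n ℤ.- a
    lemma = solve-∀
    helper : ∀ n → a ℕ.+ n ≡ b → a ≡ b
    helper zero    a+n≡b = trans (sym (ℕ.+-identityʳ a)) a+n≡b
    helper (suc n) a+n≡b = ⊥-elim (small≢0 (ℕ.s≤s (ℕ.z≤n {n})) (ℕ.≤-<-trans (subst (suc n ℕ.≤_) a+n≡b (ℕ.m≤n+m (suc n) a)) b<q)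
      (Z.trans (≡⇒≡mod (trans (lemma (+ a) (+ suc n)) (cong (λ k → k ℤ.- + a) (trans (sym (ℤ.pos-+ a (suc n))) (cong +_ a+n≡b)))))
        (≡mod⇒-≡0 (Z.sym eq))))

  ≡mod⇒≡ : ∀ {a b} → a ℕ.< q → b ℕ.< q → + a ≡ + b [modℤ q ] → a ≡ b
  ≡mod⇒≡ {a} {b} a<q b<q eq with ℕ.≤-total a b
  ... | inj₁ a≤b = ≡mod⇒≡-≤ a≤b b<q eq
  ... | inj₂ b≤a = sym (≡mod⇒≡-≤ b≤a a<q (Z.sym eq))

  n≡n%q : ∀ n → + n ≡ + (n ℕ.% q) [modℤ q ]
  n≡n%q n = residue (+ n)

  ≡mod⇒%≡% : ∀ {m n} → + m ≡ + n [modℤ q ] → m ℕ.% q ≡ n ℕ.% q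
  ≡mod⇒%≡% {m} {n} eq = ≡mod⇒≡ (ℕ.m%n<n m q) (ℕ.m%n<n n q) (Z.trans (Z.sym (n≡n%q m)) (Z.trans eq (n≡n%q n)))

  reduce : ℕ → Fin q
  reduce n = Fin.fromℕ< (ℕ.m%n<n n q)

  toℕ-reduce : ∀ n → + toℕ (reduce n) ≡ + n [modℤ q ]
  toℕ-reduce n = Z.trans (≡⇒≡mod (cong +_ (Fin.toℕ-fromℕ< (ℕ.m%n<n n q)))) (Z.sym (n≡n%q n))

  toℕ-≡mod-injective : ∀ {i j : Fin q} → + toℕ i ≡ + toℕ j [modℤ q ] → i ≡ j
  toℕ-≡mod-injective {i} {j} eq = Fin.toℕ-injective (≡mod⇒≡ (Fin.toℕ<n i) (Fin.toℕ<n j) eq)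

  +-*-homo : ∀ u x c → + (u ℕ.* x ℕ.+ c) ≡ + u ℤ.* + x ℤ.+ + c
  +-*-homo u x c = trans (ℤ.pos-+ (u ℕ.* x) c) (cong (λ z → z ℤ.+ + c) (ℤ.pos-* u x))

  affine-≡mod : ∀ u c {x y} → + x ≡ + y [modℤ q ] → + (u ℕ.* x ℕ.+ c) ≡ + (u ℕ.* y ℕ.+ c) [modℤ q ]
  affine-≡mod u c {x} {y} eq = Z.trans (≡⇒≡mod (+-*-homo u x c))
    (Z.trans (+-≡modʳ (+ c) (*-≡modˡ (+ u) eq)) (≡⇒≡mod (sym (+-*-homo u y c))))

  -- Natural numbers congruent to 1 - n and -n, because characters and exponents of ζ take natural
  -- arguments.
  1−_ −_ : ℕ → ℕ
  1− n = (q ∸ 1) ℕ.* n ℕ.+ 1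
  − n = (q ∸ 1) ℕ.* n

  [q∸1]≡-1 : + (q ∸ 1) ≡ ℤ.- (+ 1) [modℤ q ]
  [q∸1]≡-1 = Z.trans (≡⇒≡mod (trans (lemma (+ (q ∸ 1))) (cong (λ k → k ℤ.+ ℤ.- + 1) (trans (sym (ℤ.pos-+ (q ∸ 1) 1)) (cong +_ [q∸1]+1≡q)))))
      (+-≡modʳ (ℤ.- + 1) (m≡0 {q}))
    where
    lemma : ∀ k → k ≡ (k ℤ.+ + 1) ℤ.+ ℤ.- + 1
    lemma = solve-∀
    [q∸1]+1≡q : q ∸ 1 ℕ.+ 1 ≡ q
    [q∸1]+1≡q = ℕ.m∸n+n≡m (ℕ.<⇒≤ (prime>1 pr))

  −≡ : ∀ n → + (− n) ≡ ℤ.- + n [modℤ q ]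
  −≡ n = Z.trans (≡⇒≡mod (ℤ.pos-* (q ∸ 1) n)) (Z.trans (*-≡modʳ (+ n) [q∸1]≡-1) (≡⇒≡mod (ℤ.-1*i≡-i (+ n))))

  1−≡ : ∀ n → + (1− n) ≡ + 1 ℤ.- + n [modℤ q ]
  1−≡ n = Z.trans (≡⇒≡mod (ℤ.pos-+ (− n) 1)) (Z.trans (+-≡modʳ (+ 1) (−≡ n)) (≡⇒≡mod (ℤ.+-comm (ℤ.- + n) (+ 1))))

  -- With u v ≡ 1, the inverse of n ↦ u n + c is n ↦ v n + d for d ≡ -v c.
  affine-permutation : ∀ u → ¬ + u ≡ + 0 [modℤ q ] → ℕ → Permutation q q
  affine-permutation u u≢0 c = permutation to from to-from from-to
    where
    v : ℕ
    v = proj₁ (inverse (+ u) u≢0) ℤ.%ℕ q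
    d : ℕ
    d = (ℤ.- (+ v ℤ.* + c)) ℤ.%ℕ q
    uv≡1 : + u ℤ.* + v ≡ + 1 [modℤ q ]
    uv≡1 = Z.trans (*-≡modˡ (+ u) (Z.sym (residue (proj₁ (inverse (+ u) u≢0))))) (proj₂ (inverse (+ u) u≢0))
    to from : Fin q → Fin q
    to i = reduce (u ℕ.* toℕ i ℕ.+ c)
    from i = reduce (v ℕ.* toℕ i ℕ.+ d)
    d≡ : + d ≡ ℤ.- (+ v ℤ.* + c) [modℤ q ]
    d≡ = Z.sym (residue (ℤ.- (+ v ℤ.* + c)))
    open SetoidReasoning Z.setoid
    to-from : ∀ i → to (from i) ≡ i
    to-from i = toℕ-≡mod-injective (begin
      + toℕ (to (from i)) ≈⟨ toℕ-reduce _ ⟩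
      + (u ℕ.* toℕ (from i) ℕ.+ c) ≈⟨ affine-≡mod u c (toℕ-reduce (v ℕ.* toℕ i ℕ.+ d)) ⟩
      + (u ℕ.* (v ℕ.* toℕ i ℕ.+ d) ℕ.+ c) ≡⟨ +-*-homo u (v ℕ.* toℕ i ℕ.+ d) c ⟩
      + u ℤ.* + (v ℕ.* toℕ i ℕ.+ d) ℤ.+ + c ≡⟨ cong (λ z → + u ℤ.* z ℤ.+ + c) (+-*-homo v (toℕ i) d) ⟩
      + u ℤ.* (+ v ℤ.* + toℕ i ℤ.+ + d) ℤ.+ + c ≈⟨ +-≡modʳ (+ c) (*-≡modˡ (+ u) (+-≡modˡ (+ v ℤ.* + toℕ i) d≡)) ⟩
      + u ℤ.* (+ v ℤ.* + toℕ i ℤ.+ ℤ.- (+ v ℤ.* + c)) ℤ.+ + c ≡⟨ lemma (+ u) (+ v) (+ toℕ i) (+ c) ⟩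
      (+ u ℤ.* + v) ℤ.* (+ toℕ i ℤ.- + c) ℤ.+ + c ≈⟨ +-≡modʳ (+ c) (*-≡modʳ (+ toℕ i ℤ.- + c) uv≡1) ⟩
      + 1 ℤ.* (+ toℕ i ℤ.- + c) ℤ.+ + c ≡⟨ lemma′ (+ toℕ i) (+ c) ⟩
      + toℕ i  ∎)
      where
      lemma : ∀ u v x c → u ℤ.* (v ℤ.* x ℤ.+ ℤ.- (v ℤ.* c)) ℤ.+ c ≡ (u ℤ.* v) ℤ.* (x ℤ.- c) ℤ.+ c
      lemma = solve-∀
      lemma′ : ∀ x c → + 1 ℤ.* (x ℤ.- c) ℤ.+ c ≡ x
      lemma′ = solve-∀
    from-to : ∀ i → from (to i) ≡ i
    from-to i = toℕ-≡mod-injective (begin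
      + toℕ (from (to i)) ≈⟨ toℕ-reduce _ ⟩
      + (v ℕ.* toℕ (to i) ℕ.+ d) ≈⟨ affine-≡mod v d (toℕ-reduce (u ℕ.* toℕ i ℕ.+ c)) ⟩
      + (v ℕ.* (u ℕ.* toℕ i ℕ.+ c) ℕ.+ d) ≡⟨ +-*-homo v (u ℕ.* toℕ i ℕ.+ c) d ⟩
      + v ℤ.* + (u ℕ.* toℕ i ℕ.+ c) ℤ.+ + d ≡⟨ cong (λ z → + v ℤ.* z ℤ.+ + d) (+-*-homo u (toℕ i) c) ⟩
      + v ℤ.* (+ u ℤ.* + toℕ i ℤ.+ + c) ℤ.+ + d ≈⟨ +-≡modˡ (+ v ℤ.* (+ u ℤ.* + toℕ i ℤ.+ + c)) d≡ ⟩
      + v ℤ.* (+ u ℤ.* + toℕ i ℤ.+ + c) ℤ.+ ℤ.- (+ v ℤ.* + c) ≡⟨ lemma (+ u) (+ v) (+ toℕ i) (+ c) ⟩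
      (+ u ℤ.* + v) ℤ.* + toℕ i ≈⟨ *-≡modʳ (+ toℕ i) uv≡1 ⟩
      + 1 ℤ.* + toℕ i ≡⟨ ℤ.*-identityˡ (+ toℕ i) ⟩
      + toℕ i  ∎)
      where
      lemma : ∀ u v x c → v ℤ.* (u ℤ.* x ℤ.+ c) ℤ.+ ℤ.- (v ℤ.* c) ≡ (u ℤ.* v) ℤ.* x
      lemma = solve-∀

  module PeriodicSums (R : CommutativeRing 0ℓ 0ℓ) where
    open CommutativeRing R renaming (refl to ≈-refl; sym to ≈-sym; trans to ≈-trans)
    open Algebra.Properties.Semiring.Sum semiring

    ∑ : (ℕ → Carrier) → Carrier
    ∑ F = sum {q} (λ i → F (toℕ i))

    Periodic : (ℕ → Carrier) → Set
    Periodic F = ∀ {m n} → + m ≡ + n [modℤ q ] → F m ≈ F n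

    ∑-cong : ∀ {F G} → (∀ n → F n ≈ G n) → ∑ F ≈ ∑ G
    ∑-cong F≈G = sum-cong-≋ {q} (λ i → F≈G (toℕ i))

    ∑-reindex : ∀ {F} → Periodic F → ∀ u → ¬ + u ≡ + 0 [modℤ q ] → ∀ c → ∑ (λ n → F (u ℕ.* n ℕ.+ c)) ≈ ∑ F
    ∑-reindex {F} per u u≢0 c = ≈-sym (≈-trans (sum-permute {q} {q} (λ i → F (toℕ i)) (affine-permutation u u≢0 c))
      (sum-cong-≋ {q} (λ i → per (toℕ-reduce (u ℕ.* toℕ i ℕ.+ c)))))

    ∑-* : ∀ x F → x * ∑ F ≈ ∑ (λ n → x * F n)
    ∑-* x F = *-distribˡ-sum {q} x (λ i → F (toℕ i))

    ∑-*ʳ : ∀ x F → ∑ F * x ≈ ∑ (λ n → F n * x)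
    ∑-*ʳ x F = *-distribʳ-sum {q} x (λ i → F (toℕ i))

    ∑-+ : ∀ F G → ∑ (λ n → F n + G n) ≈ ∑ F + ∑ G
    ∑-+ F G = ∑-distrib-+ {q} (λ i → F (toℕ i)) (λ i → G (toℕ i))

    ∑-swap : ∀ (F : ℕ → ℕ → Carrier) → ∑ (λ a → ∑ (F a)) ≈ ∑ (λ b → ∑ (λ a → F a b))
    ∑-swap F = ∑-comm {q} {q} (λ i j → F (toℕ i) (toℕ j))

    ∑-product : ∀ F G → ∑ F * ∑ G ≈ ∑ (λ a → ∑ (λ b → F a * G b))
    ∑-product F G = ≈-trans (∑-*ʳ (∑ G) F) (∑-cong (λ a → ∑-* (F a) G))

    ∑-zero : ∀ {F} → (∀ n → F n ≈ 0#) → ∑ F ≈ 0#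
    ∑-zero F≈0 = ≈-trans (∑-cong F≈0) (sum-replicate-zero q)

    ∑-single : ∀ {F} → (∀ n → ¬ + n ≡ + 0 [modℤ q ] → F n ≈ 0#) → ∑ F ≈ F 0
    ∑-single {F} F≈0 = go q refl
      where
      go : ∀ k → k ≡ q → sum {k} (λ i → F (toℕ i)) ≈ F 0
      go zero    refl = ⊥-elim (ℕ.≢-nonZero⁻¹ 0 {{prime⇒nonZero pr}} refl)
      go (suc k) refl = ≈-trans (+-congˡ (≈-trans (sum-cong-≋ {k} (λ i → F≈0 (suc (toℕ i)) (small≢0 ℕ.z<s (ℕ.s≤s (Fin.toℕ<n i)))))
        (sum-replicate-zero k))) (+-identityʳ (F 0))

-- Gauss sums of cubic characters

module GaussSums {q e : ℕ} (pr : Prime q) (q≡1+3e : q ≡ suc (3 ℕ.* e))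
                 (w : ℤ) (w-root : w ℤ.* w ℤ.+ w ℤ.+ + 1 ≡ + 0 [modℤ q ])
                 {m : ℕ} (ℂ : Cyclotomic m q) (reg3 : Regular m (+ 3)) where
  open PrimeModulus pr using (1≢0)
  open CubicSymbol {e = e} pr q≡1+3e w w-root
  open Residues pr
  open Cyclotomic ℂ
  open CubeRoot commRing integers
  open IntegerSolver commRing integers
  open PeriodicSums commRing
  open SetoidReasoning setoid
  private
    module Z = CommutativeRing (ℤmod q)

  ⟦_⟧ : Value → Carrier
  ⟦_⟧ = eval ω ω-root

  ⟦⟧-∙ : ∀ u v → ⟦ u ∙ v ⟧ ≈ ⟦ u ⟧ * ⟦ v ⟧
  ⟦⟧-∙ = eval-∙ ω ω-root

  ζ^-periodic : Periodic (ζ ^ᴿ_)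
  ζ^-periodic {k} {l} eq = ≈-trans (reduced k) (≈-trans (^-congʳ ζ (≡mod⇒%≡% eq)) (≈-sym (reduced l)))
    where
    instance
      q≢0 : ℕ.NonZero q
      q≢0 = prime⇒nonZero pr
    1^ : ∀ n → ι (+ 1) ^ᴿ n ≈ ι (+ 1)
    1^ zero    = ≈-sym 1-homo
    1^ (suc n) = ≈-trans (*-congˡ (1^ n)) (solve 0 (con (+ 1) :* con (+ 1) := con (+ 1)) ≈-refl)
    reduced : ∀ n → ζ ^ᴿ n ≈ ζ ^ᴿ (n ℕ.% q)
    reduced n = begin
      ζ ^ᴿ n ≡⟨ cong (ζ ^ᴿ_) (ℕ.m≡m%n+[m/n]*n n q) ⟩
      ζ ^ᴿ (n ℕ.% q ℕ.+ (n ℕ./ q) ℕ.* q) ≈⟨ ^-homo-* ζ (n ℕ.% q) _ ⟩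
      ζ ^ᴿ (n ℕ.% q) * ζ ^ᴿ ((n ℕ./ q) ℕ.* q) ≡⟨ cong (λ k → ζ ^ᴿ (n ℕ.% q) * ζ ^ᴿ k) (ℕ.*-comm (n ℕ./ q) q) ⟩
      ζ ^ᴿ (n ℕ.% q) * ζ ^ᴿ (q ℕ.* (n ℕ./ q)) ≈⟨ *-congˡ (^-assocʳ ζ q (n ℕ./ q)) ⟨
      ζ ^ᴿ (n ℕ.% q) * (ζ ^ᴿ q) ^ᴿ (n ℕ./ q) ≈⟨ *-congˡ (≈-trans (^-congˡ (n ℕ./ q) ζ^q≈1) (1^ (n ℕ./ q))) ⟩
      ζ ^ᴿ (n ℕ.% q) * ι (+ 1) ≈⟨ solve 1 (λ x → x :* con (+ 1) := x) ≈-refl _ ⟩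
      ζ ^ᴿ (n ℕ.% q)  ∎

  record Character (ψ : ℕ → Value) : Set where
    field
      ψ-cong     : ∀ {m n} → + m ≡ + n [modℤ q ] → ψ m ≡ ψ n
      ψ-*        : ∀ m n → ψ (m ℕ.* n) ≡ ψ m ∙ ψ n
      ψ-zero     : ∀ {n} → + n ≡ + 0 [modℤ q ] → ψ n ≡ 𝟘
      g          : ℕ
      ψg≢𝟘       : ψ g ≢ 𝟘
      ψg≢𝟙       : ψ g ≢ 𝟙

    g≢0 : ¬ + g ≡ + 0 [modℤ q ]
    g≢0 g≡0 = ψg≢𝟘 (ψ-zero g≡0)

    ψ-periodic : Periodic (λ n → ⟦ ψ n ⟧)
    ψ-periodic eq = reflexive (cong ⟦_⟧ (ψ-cong eq))

    ∑ψ∘u* : ∀ u → ¬ + u ≡ + 0 [modℤ q ] → ⟦ ψ u ⟧ * ∑ (λ n → ⟦ ψ n ⟧) ≈ ∑ (λ n → ⟦ ψ n ⟧)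
    ∑ψ∘u* u u≢0 = begin
      ⟦ ψ u ⟧ * ∑ (λ n → ⟦ ψ n ⟧) ≈⟨ ∑-* ⟦ ψ u ⟧ (λ n → ⟦ ψ n ⟧) ⟩
      ∑ (λ n → ⟦ ψ u ⟧ * ⟦ ψ n ⟧) ≈⟨ ∑-cong (λ n → ≈-trans (≈-sym (⟦⟧-∙ (ψ u) (ψ n)))
          (reflexive (cong ⟦_⟧ (trans (sym (ψ-* u n)) (cong ψ (sym (ℕ.+-identityʳ (u ℕ.* n)))))))) ⟩
      ∑ (λ n → ⟦ ψ (u ℕ.* n ℕ.+ 0) ⟧) ≈⟨ ∑-reindex ψ-periodic u u≢0 0 ⟩
      ∑ (λ n → ⟦ ψ n ⟧)  ∎

    -- The sum s satisfies ψ(g) s = s, but ψ(g) - 1 is not known to be cancellable. Adding s, ψ(g) s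
    -- and ψ(g)² s gives 3 s = 0 instead, and 3 is regular.
    ∑ψ≈0 : ∑ (λ n → ⟦ ψ n ⟧) ≈ ι (+ 0)
    ∑ψ≈0 = ι-regular reg3 s (begin
      ι (+ 3) * s ≈⟨ solve 1 (λ s → con (+ 3) :* s := con (+ 1) :* s :+ s :+ s) ≈-refl s ⟩
      ι (+ 1) * s + s + s ≈⟨ +-cong (+-congˡ (≈-sym gs)) (≈-sym ggs) ⟩
      ι (+ 1) * s + ⟦ ψ g ⟧ * s + ⟦ ψ g ∙ ψ g ⟧ * s ≈⟨ ≈-trans (+-congʳ (≈-sym (distribʳ s _ _))) (≈-sym (distribʳ s _ _)) ⟩
      (⟦ 𝟙 ⟧ + ⟦ ψ g ⟧ + ⟦ ψ g ∙ ψ g ⟧) * s ≈⟨ *-congʳ (1+v+v²≈0 ω ω-root (ψ g) ψg≢𝟘 ψg≢𝟙) ⟩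
      ι (+ 0) * s ≈⟨ solve 1 (λ s → con (+ 0) :* s := con (+ 0)) ≈-refl s ⟩
      ι (+ 0)  ∎)
      where
      s : Carrier
      s = ∑ (λ n → ⟦ ψ n ⟧)
      gs : ⟦ ψ g ⟧ * s ≈ s
      gs = ∑ψ∘u* g g≢0
      ggs : ⟦ ψ g ∙ ψ g ⟧ * s ≈ s
      ggs = ≈-trans (*-congʳ (⟦⟧-∙ (ψ g) (ψ g))) (≈-trans (*-assoc _ _ s) (≈-trans (*-congˡ gs) gs))

  open Character

  χ-character : Character χ
  χ-character = record
    { ψ-cong = χ-cong ; ψ-* = χ-* ; ψ-zero = n≡0⇒χ≡𝟘
    ; g = proj₁ nontrivial ; ψg≢𝟘 = proj₁ (proj₂ nontrivial) ; ψg≢𝟙 = proj₂ (proj₂ nontrivial) }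

  χ² : ℕ → Value
  χ² n = χ n ∙ χ n

  χ²-character : Character χ²
  χ²-character = record
    { ψ-cong = λ eq → cong (λ v → v ∙ v) (χ-cong eq)
    ; ψ-* = λ m n → trans (cong (λ v → v ∙ v) (χ-* m n)) (square-∙ (χ m) (χ n))
    ; ψ-zero = λ eq → cong (λ v → v ∙ v) (n≡0⇒χ≡𝟘 eq)
    ; g = proj₁ nontrivial
    ; ψg≢𝟘 = λ eq → proj₁ (proj₂ nontrivial) (trans (sym (square-square _)) (cong (λ v → v ∙ v) eq))
    ; ψg≢𝟙 = λ eq → proj₂ (proj₂ nontrivial) (square≡𝟙 _ eq)
    }

  term : (ℕ → Value) → ℕ → Carrier
  term ψ n = ⟦ ψ n ⟧ * ζ ^ᴿ n

  Gauss : (ℕ → Value) → Carrier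
  Gauss ψ = ∑ (term ψ)

  Jacobi : (ℕ → Value) → Carrier
  Jacobi ψ = ∑ (λ n → ⟦ ψ n ∙ ψ (1− n) ⟧)

  square : (ℕ → Value) → ℕ → Value
  square ψ n = ψ n ∙ ψ n

  module _ {ψ : ℕ → Value} (Ψ : Character ψ) (Ψ² : Character (square ψ)) where

    private
      convolution : ℕ → Carrier
      convolution c = ∑ (λ a → ⟦ ψ a ⟧ * ⟦ ψ (c ℕ.+ − a) ⟧)

    -- The substitution c = a + b, which collects the product of two Gauss sums by powers of ζ.
    shifted : ∀ a → ∑ (λ b → ⟦ ψ a ⟧ * ζ ^ᴿ a * (⟦ ψ b ⟧ * ζ ^ᴿ b)) ≈ ∑ (λ c → ⟦ ψ a ⟧ * ⟦ ψ (c ℕ.+ − a) ⟧ * ζ ^ᴿ c)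
    shifted a = ≈-trans (∑-cong pointwise) (∑-reindex {F} F-periodic 1 1≢0 a)
      where
      F : ℕ → Carrier
      F c = ⟦ ψ a ⟧ * ⟦ ψ (c ℕ.+ − a) ⟧ * ζ ^ᴿ c
      F-periodic : Periodic F
      F-periodic {k} {l} eq = *-cong (*-congˡ (ψ-periodic Ψ (Z.trans (≡⇒≡mod (ℤ.pos-+ k (− a)))
        (Z.trans (+-≡modʳ (+ (− a)) eq) (≡⇒≡mod (sym (ℤ.pos-+ l (− a)))))))) (ζ^-periodic eq)
      arg : ∀ b → + b ≡ + (1 ℕ.* b ℕ.+ a ℕ.+ − a) [modℤ q ]
      arg b = Z.sym (Z.trans (≡⇒≡mod (trans (ℤ.pos-+ (1 ℕ.* b ℕ.+ a) (− a)) (cong (λ z → z ℤ.+ + (− a)) (trans (cong (λ n → + (n ℕ.+ a)) (ℕ.*-identityˡ b)) (ℤ.pos-+ b a)))))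
        (Z.trans (+-≡modˡ (+ b ℤ.+ + a) (−≡ a)) (≡⇒≡mod (lemma (+ b) (+ a)))))
        where
        lemma : ∀ b a → b ℤ.+ a ℤ.+ ℤ.- a ≡ b
        lemma = solve-∀
      pointwise : ∀ b → ⟦ ψ a ⟧ * ζ ^ᴿ a * (⟦ ψ b ⟧ * ζ ^ᴿ b) ≈ F (1 ℕ.* b ℕ.+ a)
      pointwise b = begin
        ⟦ ψ a ⟧ * ζ ^ᴿ a * (⟦ ψ b ⟧ * ζ ^ᴿ b)
          ≈⟨ solve 4 (λ x y z t → x :* y :* (z :* t) := x :* z :* (t :* y)) ≈-refl ⟦ ψ a ⟧ (ζ ^ᴿ a) ⟦ ψ b ⟧ (ζ ^ᴿ b) ⟩
        ⟦ ψ a ⟧ * ⟦ ψ b ⟧ * (ζ ^ᴿ b * ζ ^ᴿ a)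
          ≈⟨ *-cong (*-congˡ (ψ-periodic Ψ (arg b))) (≈-trans (≈-sym (^-homo-* ζ b a)) (reflexive (cong (λ n → ζ ^ᴿ (n ℕ.+ a)) (sym (ℕ.*-identityˡ b))))) ⟩
        F (1 ℕ.* b ℕ.+ a) ∎

    -- For c ≢ 0 substitute a = c t and extract ψ(c)². For c ≡ 0 the left side is ψ(-1) times the
    -- sum of the nontrivial character ψ², so both sides vanish.
    convolution≈ : ∀ c → convolution c ≈ ⟦ square ψ c ⟧ * Jacobi ψ
    convolution≈ c with ≡0? q (+ c)
    ... | no c≢0 = begin
      convolution c ≈⟨ ∑-reindex {F} F-periodic c c≢0 0 ⟨
      ∑ (λ t → F (c ℕ.* t ℕ.+ 0)) ≈⟨ ∑-cong pointwise ⟩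
      ∑ (λ t → ⟦ square ψ c ⟧ * ⟦ ψ t ∙ ψ (1− t) ⟧) ≈⟨ ∑-* ⟦ square ψ c ⟧ (λ t → ⟦ ψ t ∙ ψ (1− t) ⟧) ⟨
      ⟦ square ψ c ⟧ * Jacobi ψ  ∎
      where
      F : ℕ → Carrier
      F a = ⟦ ψ a ⟧ * ⟦ ψ (c ℕ.+ − a) ⟧
      F-periodic : Periodic F
      F-periodic {k} {l} eq = *-cong (ψ-periodic Ψ eq) (ψ-periodic Ψ (Z.trans (≡⇒≡mod (trans (ℤ.pos-+ c (− k)) (ℤ.+-comm (+ c) (+ (− k)))))
        (Z.trans (+-≡modʳ (+ c) (Z.trans (−≡ k) (Z.trans (neg-≡mod eq) (Z.sym (−≡ l))))) (≡⇒≡mod (trans (ℤ.+-comm (+ (− l)) (+ c)) (sym (ℤ.pos-+ c (− l))))))))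
      arg : ∀ t → c ℕ.+ − (c ℕ.* t ℕ.+ 0) ≡ c ℕ.* 1− t
      arg t = lemma c (q ∸ 1) t
        where
        lemma : ∀ c k t → c ℕ.+ k ℕ.* (c ℕ.* t ℕ.+ 0) ≡ c ℕ.* (k ℕ.* t ℕ.+ 1)
        lemma = ℕSolver.solve-∀
      pointwise : ∀ t → F (c ℕ.* t ℕ.+ 0) ≈ ⟦ square ψ c ⟧ * ⟦ ψ t ∙ ψ (1− t) ⟧
      pointwise t = begin
        ⟦ ψ (c ℕ.* t ℕ.+ 0) ⟧ * ⟦ ψ (c ℕ.+ − (c ℕ.* t ℕ.+ 0)) ⟧
          ≡⟨ cong₂ (λ x y → ⟦ x ⟧ * ⟦ y ⟧) (trans (cong ψ (ℕ.+-identityʳ (c ℕ.* t))) (ψ-* Ψ c t)) (trans (cong ψ (arg t)) (ψ-* Ψ c (1− t))) ⟩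
        ⟦ ψ c ∙ ψ t ⟧ * ⟦ ψ c ∙ ψ (1− t) ⟧ ≈⟨ *-cong (⟦⟧-∙ (ψ c) (ψ t)) (⟦⟧-∙ (ψ c) (ψ (1− t))) ⟩
        ⟦ ψ c ⟧ * ⟦ ψ t ⟧ * (⟦ ψ c ⟧ * ⟦ ψ (1− t) ⟧)
          ≈⟨ solve 3 (λ x y z → x :* y :* (x :* z) := x :* x :* (y :* z)) ≈-refl ⟦ ψ c ⟧ ⟦ ψ t ⟧ ⟦ ψ (1− t) ⟧ ⟩
        ⟦ ψ c ⟧ * ⟦ ψ c ⟧ * (⟦ ψ t ⟧ * ⟦ ψ (1− t) ⟧) ≈⟨ *-cong (⟦⟧-∙ (ψ c) (ψ c)) (⟦⟧-∙ (ψ t) (ψ (1− t))) ⟨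
        ⟦ square ψ c ⟧ * ⟦ ψ t ∙ ψ (1− t) ⟧  ∎
    ... | yes c≡0 = begin
      convolution c ≈⟨ ∑-cong pointwise ⟩
      ∑ (λ a → ⟦ ψ (q ∸ 1) ⟧ * ⟦ square ψ a ⟧) ≈⟨ ∑-* ⟦ ψ (q ∸ 1) ⟧ (λ a → ⟦ square ψ a ⟧) ⟨
      ⟦ ψ (q ∸ 1) ⟧ * ∑ (λ a → ⟦ square ψ a ⟧) ≈⟨ *-congˡ (∑ψ≈0 Ψ²) ⟩
      ⟦ ψ (q ∸ 1) ⟧ * ι (+ 0) ≈⟨ solve 2 (λ x y → x :* con (+ 0) := con (+ 0) :* y) ≈-refl ⟦ ψ (q ∸ 1) ⟧ (Jacobi ψ) ⟩
      ι (+ 0) * Jacobi ψ ≡⟨ cong (λ v → ⟦ v ⟧ * Jacobi ψ) (ψ-zero Ψ² c≡0) ⟨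
      ⟦ square ψ c ⟧ * Jacobi ψ  ∎
      where
      pointwise : ∀ a → ⟦ ψ a ⟧ * ⟦ ψ (c ℕ.+ − a) ⟧ ≈ ⟦ ψ (q ∸ 1) ⟧ * ⟦ square ψ a ⟧
      pointwise a = begin
        ⟦ ψ a ⟧ * ⟦ ψ (c ℕ.+ − a) ⟧
          ≡⟨ cong (λ v → ⟦ ψ a ⟧ * ⟦ v ⟧) (trans (ψ-cong Ψ (Z.trans (≡⇒≡mod (ℤ.pos-+ c (− a))) (Z.trans (+-≡modʳ (+ (− a)) c≡0) (Z.+-identityˡ _)))) (ψ-* Ψ (q ∸ 1) a)) ⟩
        ⟦ ψ a ⟧ * ⟦ ψ (q ∸ 1) ∙ ψ a ⟧ ≈⟨ *-congˡ (⟦⟧-∙ (ψ (q ∸ 1)) (ψ a)) ⟩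
        ⟦ ψ a ⟧ * (⟦ ψ (q ∸ 1) ⟧ * ⟦ ψ a ⟧) ≈⟨ solve 2 (λ x y → x :* (y :* x) := y :* (x :* x)) ≈-refl ⟦ ψ a ⟧ ⟦ ψ (q ∸ 1) ⟧ ⟩
        ⟦ ψ (q ∸ 1) ⟧ * (⟦ ψ a ⟧ * ⟦ ψ a ⟧) ≈⟨ *-congˡ (⟦⟧-∙ (ψ a) (ψ a)) ⟨
        ⟦ ψ (q ∸ 1) ⟧ * ⟦ square ψ a ⟧  ∎

    Gauss² : Gauss ψ * Gauss ψ ≈ Jacobi ψ * Gauss (square ψ)
    Gauss² = begin
      Gauss ψ * Gauss ψ ≈⟨ ∑-product (term ψ) (term ψ) ⟩
      ∑ (λ a → ∑ (λ b → ⟦ ψ a ⟧ * ζ ^ᴿ a * (⟦ ψ b ⟧ * ζ ^ᴿ b))) ≈⟨ ∑-cong shifted ⟩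
      ∑ (λ a → ∑ (λ c → ⟦ ψ a ⟧ * ⟦ ψ (c ℕ.+ − a) ⟧ * ζ ^ᴿ c)) ≈⟨ ∑-swap (λ a c → ⟦ ψ a ⟧ * ⟦ ψ (c ℕ.+ − a) ⟧ * ζ ^ᴿ c) ⟩
      ∑ (λ c → ∑ (λ a → ⟦ ψ a ⟧ * ⟦ ψ (c ℕ.+ − a) ⟧ * ζ ^ᴿ c)) ≈⟨ ∑-cong (λ c → ∑-*ʳ (ζ ^ᴿ c) (λ a → ⟦ ψ a ⟧ * ⟦ ψ (c ℕ.+ − a) ⟧)) ⟨
      ∑ (λ c → convolution c * ζ ^ᴿ c) ≈⟨ ∑-cong (λ c → *-congʳ {ζ ^ᴿ c} (convolution≈ c)) ⟩
      ∑ (λ c → ⟦ square ψ c ⟧ * Jacobi ψ * ζ ^ᴿ c)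
        ≈⟨ ∑-cong (λ c → solve 3 (λ x y z → x :* y :* z := y :* (x :* z)) ≈-refl ⟦ square ψ c ⟧ (Jacobi ψ) (ζ ^ᴿ c)) ⟩
      ∑ (λ c → Jacobi ψ * (⟦ square ψ c ⟧ * ζ ^ᴿ c)) ≈⟨ ∑-* (Jacobi ψ) (term (square ψ)) ⟨
      Jacobi ψ * Gauss (square ψ)  ∎

  ι≈·1 : ∀ n → ι (+ n) ≈ sum {n} (λ _ → ι (+ 1))
  ι≈·1 zero    = 0-homo
  ι≈·1 (suc n) = ≈-trans (+-homo (+ 1) (+ n)) (+-congˡ (ι≈·1 n))

  -- χ(-1)² = χ(1) = 1, and a cube root of unity whose square is 1 is 1.
  χ[q∸1]≡𝟙 : χ (q ∸ 1) ≡ 𝟙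
  χ[q∸1]≡𝟙 = square≡𝟙 _ (trans (sym (χ-* (q ∸ 1) (q ∸ 1))) (trans (χ-cong {n = 1} (Z.trans (≡⇒≡mod (ℤ.pos-* (q ∸ 1) (q ∸ 1))) (*-≡mod [q∸1]≡-1 [q∸1]≡-1))) χ1≡𝟙))

  G G′ : Carrier
  G  = Gauss χ
  G′ = Gauss χ²

  -- Substituting a = b t turns the product into the sum over t of χ(t) Σ ζ^((1+t) b). The inner sum
  -- vanishes unless t = -1, where it is q, and χ(-1) = 1.
  G*G′≈q : G * G′ ≈ ι (+ q)
  G*G′≈q = begin
    G * G′ ≈⟨ *-comm G G′ ⟩
    G′ * G ≈⟨ ∑-product (term χ²) (term χ) ⟩
    ∑ (λ b → ∑ (λ a → ⟦ χ² b ⟧ * ζ ^ᴿ b * (⟦ χ a ⟧ * ζ ^ᴿ a))) ≈⟨ ∑-cong inner ⟩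
    ∑ (λ b → ∑ (λ t → H t b)) ≈⟨ ∑-swap (λ b t → H t b) ⟩
    -- The shift t = s - 1 moves the only surviving term t = -1 to s = 0, the form `∑-single`
    -- expects.
    ∑ (λ t → ∑ (H t)) ≈⟨ ∑-reindex {λ t → ∑ (H t)} outer-periodic 1 1≢0 (q ∸ 1) ⟨
    ∑ (λ s → ∑ (H (1 ℕ.* s ℕ.+ (q ∸ 1)))) ≈⟨ ∑-single off-diagonal ⟩
    ∑ (H (q ∸ 1)) ≈⟨ ∑-cong diagonal ⟩
    ∑ (λ b → ι (+ 1)) ≈⟨ ι≈·1 q ⟨
    ι (+ q)  ∎
    where
    H : ℕ → ℕ → Carrier
    H t b = ⟦ χ t ⟧ * ζ ^ᴿ (suc t ℕ.* b)

    product-≡mod : ∀ {k l} b → + k ≡ + l [modℤ q ] → + (suc k ℕ.* b) ≡ + (suc l ℕ.* b) [modℤ q ]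
    product-≡mod {k} {l} b eq = Z.trans (≡⇒≡mod (ℤ.pos-* (suc k) b))
      (Z.trans (*-≡modʳ (+ b) (+-≡modˡ (+ 1) eq)) (≡⇒≡mod (sym (ℤ.pos-* (suc l) b))))

    outer-periodic : Periodic (λ t → ∑ (H t))
    outer-periodic eq = ∑-cong (λ b → *-cong (ψ-periodic χ-character eq) (ζ^-periodic (product-≡mod b eq)))

    inner : ∀ b → ∑ (λ a → ⟦ χ² b ⟧ * ζ ^ᴿ b * (⟦ χ a ⟧ * ζ ^ᴿ a)) ≈ ∑ (λ t → H t b)
    inner b with ≡0? q (+ b)
    ... | no b≢0 = ≈-trans (≈-sym (∑-reindex {F} F-periodic b b≢0 0)) (∑-cong pointwise)
      where
      F : ℕ → Carrier
      F a = ⟦ χ² b ⟧ * ζ ^ᴿ b * (⟦ χ a ⟧ * ζ ^ᴿ a)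
      F-periodic : Periodic F
      F-periodic eq = *-congˡ (*-cong (ψ-periodic χ-character eq) (ζ^-periodic eq))
      pointwise : ∀ t → F (b ℕ.* t ℕ.+ 0) ≈ H t b
      pointwise t = begin
        ⟦ χ² b ⟧ * ζ ^ᴿ b * (⟦ χ (b ℕ.* t ℕ.+ 0) ⟧ * ζ ^ᴿ (b ℕ.* t ℕ.+ 0))
          ≡⟨ cong₂ (λ v n → ⟦ χ² b ⟧ * ζ ^ᴿ b * (⟦ v ⟧ * ζ ^ᴿ n)) (trans (cong χ (ℕ.+-identityʳ (b ℕ.* t))) (χ-* b t)) (ℕ.+-identityʳ (b ℕ.* t)) ⟩
        ⟦ χ² b ⟧ * ζ ^ᴿ b * (⟦ χ b ∙ χ t ⟧ * ζ ^ᴿ (b ℕ.* t)) ≈⟨ *-congˡ (*-congʳ (⟦⟧-∙ (χ b) (χ t))) ⟩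
        ⟦ χ² b ⟧ * ζ ^ᴿ b * (⟦ χ b ⟧ * ⟦ χ t ⟧ * ζ ^ᴿ (b ℕ.* t))
          ≈⟨ solve 5 (λ x y z u v → x :* y :* (z :* u :* v) := x :* z :* (u :* (y :* v))) ≈-refl ⟦ χ² b ⟧ (ζ ^ᴿ b) ⟦ χ b ⟧ ⟦ χ t ⟧ (ζ ^ᴿ (b ℕ.* t)) ⟩
        ⟦ χ² b ⟧ * ⟦ χ b ⟧ * (⟦ χ t ⟧ * (ζ ^ᴿ b * ζ ^ᴿ (b ℕ.* t)))
          ≈⟨ *-cong (≈-sym (⟦⟧-∙ (χ² b) (χ b))) (*-congˡ (≈-sym (^-homo-* ζ b (b ℕ.* t)))) ⟩
        ⟦ χ² b ∙ χ b ⟧ * (⟦ χ t ⟧ * ζ ^ᴿ (b ℕ.+ b ℕ.* t))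
          ≡⟨ cong₂ (λ v n → ⟦ v ⟧ * (⟦ χ t ⟧ * ζ ^ᴿ n)) (cube≡𝟙 (χ b) (λ eq → b≢0 (χ≡𝟘⇒n≡0 eq))) (cong (b ℕ.+_) (ℕ.*-comm b t)) ⟩
        ι (+ 1) * H t b ≈⟨ solve 1 (λ x → con (+ 1) :* x := x) ≈-refl (H t b) ⟩
        H t b  ∎
    -- The substitution a = b t fails here, but both sides are 0: the left because χ²(0) = 0, the
    -- right because it is the sum of all χ(t).
    ... | yes b≡0 = begin
      ∑ (λ a → ⟦ χ² b ⟧ * ζ ^ᴿ b * (⟦ χ a ⟧ * ζ ^ᴿ a)) ≈⟨ ∑-zero left≈0 ⟩
      0# ≈⟨ 0-homo ⟨
      ι (+ 0) ≈⟨ ∑ψ≈0 χ-character ⟨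
      ∑ (λ t → ⟦ χ t ⟧) ≈⟨ ∑-cong (λ t → ≈-trans (≈-sym (*-identityʳ ⟦ χ t ⟧)) (*-congˡ (ζ^-periodic {0} (right t)))) ⟩
      ∑ (λ t → H t b)  ∎
      where
      left≈0 : ∀ a → ⟦ χ² b ⟧ * ζ ^ᴿ b * (⟦ χ a ⟧ * ζ ^ᴿ a) ≈ 0#
      left≈0 a = ≈-trans (reflexive (cong (λ v → ⟦ v ⟧ * ζ ^ᴿ b * (⟦ χ a ⟧ * ζ ^ᴿ a)) (ψ-zero χ²-character b≡0)))
        (≈-trans (solve 2 (λ x y → con (+ 0) :* x :* y := con (+ 0)) ≈-refl (ζ ^ᴿ b) (⟦ χ a ⟧ * ζ ^ᴿ a)) 0-homo)
      right : ∀ t → + 0 ≡ + (suc t ℕ.* b) [modℤ q ]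
      right t = Z.sym (Z.trans (≡⇒≡mod (ℤ.pos-* (suc t) b)) (Z.trans (*-≡modˡ (+ suc t) b≡0) (≡⇒≡mod (ℤ.*-zeroʳ (+ suc t)))))

    off-diagonal : ∀ s → ¬ + s ≡ + 0 [modℤ q ] → ∑ (H (1 ℕ.* s ℕ.+ (q ∸ 1))) ≈ 0#
    off-diagonal s s≢0 = begin
      ∑ (H t) ≈⟨ ∑-* ⟦ χ t ⟧ (λ b → ζ ^ᴿ (suc t ℕ.* b)) ⟨
      ⟦ χ t ⟧ * ∑ (λ b → ζ ^ᴿ (suc t ℕ.* b)) ≈⟨ *-congˡ (∑-cong (λ b → reflexive (cong (ζ ^ᴿ_) (sym (ℕ.+-identityʳ (suc t ℕ.* b)))))) ⟩
      ⟦ χ t ⟧ * ∑ (λ b → ζ ^ᴿ (suc t ℕ.* b ℕ.+ 0)) ≈⟨ *-congˡ (∑-reindex ζ^-periodic (suc t) suct≢0 0) ⟩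
      ⟦ χ t ⟧ * ∑ (ζ ^ᴿ_) ≈⟨ *-congˡ (≈-trans Σζ≈0 0-homo) ⟩
      ⟦ χ t ⟧ * 0# ≈⟨ zeroʳ _ ⟩
      0#  ∎
      where
      t : ℕ
      t = 1 ℕ.* s ℕ.+ (q ∸ 1)
      suct≢0 : ¬ + suc t ≡ + 0 [modℤ q ]
      suct≢0 eq = s≢0 (Z.trans (≡⇒≡mod (lemma (+ s))) (Z.trans (Z.sym (+-≡modˡ (+ 1) (+-≡modˡ (+ s) [q∸1]≡-1)))
        (Z.trans (≡⇒≡mod (cong (λ n → + suc (n ℕ.+ (q ∸ 1))) (sym (ℕ.*-identityˡ s)))) eq)))
        where
        lemma : ∀ s → s ≡ + 1 ℤ.+ (s ℤ.+ ℤ.- + 1)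
        lemma = solve-∀

    diagonal : ∀ b → H (q ∸ 1) b ≈ ι (+ 1)
    diagonal b = begin
      ⟦ χ (q ∸ 1) ⟧ * ζ ^ᴿ (suc (q ∸ 1) ℕ.* b) ≡⟨ cong (λ v → ⟦ v ⟧ * ζ ^ᴿ (suc (q ∸ 1) ℕ.* b)) χ[q∸1]≡𝟙 ⟩
      ι (+ 1) * ζ ^ᴿ (suc (q ∸ 1) ℕ.* b) ≈⟨ *-congˡ (ζ^-periodic {n = 0} (Z.trans (≡⇒≡mod (ℤ.pos-* (suc (q ∸ 1)) b))
          (Z.trans (*-≡modʳ (+ b) (+-≡modˡ (+ 1) [q∸1]≡-1)) (≡⇒≡mod refl)))) ⟩
      ι (+ 1) * 1# ≈⟨ *-identityʳ _ ⟩
      ι (+ 1)  ∎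

-- On the powers of ω, `im` takes the values 0, 1, -1: it is the exponent of ω modulo 3.
im-∙ : ∀ u v → u ≢ 𝟘 → v ≢ 𝟘 → im (u ∙ v) ≡ im u ℤ.+ im v [modℤ 3 ]
im-∙ 𝟘  v  u≢𝟘 v≢𝟘 = ⊥-elim (u≢𝟘 refl)
im-∙ 𝟙  v  u≢𝟘 v≢𝟘 = ≡⇒≡mod (sym (ℤ.+-identityˡ (im v)))
im-∙ 𝕨  𝟘  u≢𝟘 v≢𝟘 = ⊥-elim (v≢𝟘 refl)
im-∙ 𝕨  𝟙  u≢𝟘 v≢𝟘 = congruent (+ 0) refl
im-∙ 𝕨  𝕨  u≢𝟘 v≢𝟘 = congruent (ℤ.- + 1) refl
im-∙ 𝕨  𝕨² u≢𝟘 v≢𝟘 = congruent (+ 0) refl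
im-∙ 𝕨² 𝟘  u≢𝟘 v≢𝟘 = ⊥-elim (v≢𝟘 refl)
im-∙ 𝕨² 𝟙  u≢𝟘 v≢𝟘 = congruent (+ 0) refl
im-∙ 𝕨² 𝕨  u≢𝟘 v≢𝟘 = congruent (+ 0) refl
im-∙ 𝕨² 𝕨² u≢𝟘 v≢𝟘 = congruent (+ 1) refl

_≟𝟘 : ∀ v → Dec (v ≡ 𝟘)
𝟘  ≟𝟘 = yes refl
𝟙  ≟𝟘 = no λ ()
𝕨  ≟𝟘 = no λ ()
𝕨² ≟𝟘 = no λ ()

regular0 : ∀ {c} → c ≢ + 0 → Regular 0 c
regular0 {c} c≢0 x eq with ℤ.i*j≡0⇒i≡0∨j≡0 c (mod0⇒≡ eq)
... | inj₁ c≡0 = ⊥-elim (c≢0 c≡0)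
... | inj₂ x≡0 = ≡⇒≡mod x≡0

-- The Jacobi sum and its integer coordinates

module JacobiSum {q e : ℕ} (pr : Prime q) (q≡1+3e : q ≡ suc (3 ℕ.* e))
    (w : ℤ) (w-root : w ℤ.* w ℤ.+ w ℤ.+ + 1 ≡ + 0 [modℤ q ]) where
  open CubicSymbol {e = e} pr q≡1+3e w w-root
  open Residues pr
  private
    module Σℤ = PeriodicSums ℤ.+-*-commutativeRing
    module Z = CommutativeRing (ℤmod q)
    module Z3 = CommutativeRing (ℤmod 3)

  jacobi : ℕ → Value
  jacobi n = χ n ∙ χ (1− n)

  -- Defined in ℤ, independently of any ring containing ω, so that facts proved for the moduli q, 3,
  -- p and 0 concern the same two integers.
  A B : ℤ
  A = Σℤ.∑ (λ n → re (jacobi n))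
  B = Σℤ.∑ (λ n → im (jacobi n))

  -- With w in place of ω, the value χ(n) becomes n^e. The Jacobi sum is then the sum of x^e
  -- (1-x)^e, of degree 2e < q - 1, which vanishes modulo q.
  A+Bw≡0 : A ℤ.+ B ℤ.* w ≡ + 0 [modℤ q ]
  A+Bw≡0 = begin
    A ℤ.+ B ℤ.* w ≡⟨ cong (λ z → A ℤ.+ z) (Σℤ.∑-*ʳ w (λ n → im (jacobi n))) ⟩
    A ℤ.+ Σℤ.∑ (λ n → im (jacobi n) ℤ.* w) ≡⟨ Σℤ.∑-+ (λ n → re (jacobi n)) (λ n → im (jacobi n) ℤ.* w) ⟨
    Σq.∑ (λ n → re (jacobi n) ℤ.+ im (jacobi n) ℤ.* w) ≈⟨ Σq.∑-cong pointwise ⟩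
    S (λ x → x ℤ.^ e ℤ.* (+ 1 ℤ.- x) ℤ.^ e) ≈⟨ Σevalw-beta ⟩
    + 0  ∎
    where
    module Σq = PeriodicSums (ℤmod q)
    open PowerSums pr using (S)
    open CubeRoot (ℤmod q) (ℤ-in-ℤmod q) using (eval-∙; eval≈re+im*ω)
    open SetoidReasoning Z.setoid
    pointwise : ∀ n → re (jacobi n) ℤ.+ im (jacobi n) ℤ.* w ≡ (+ n) ℤ.^ e ℤ.* (+ 1 ℤ.- + n) ℤ.^ e [modℤ q ]
    pointwise n = begin
      re (jacobi n) ℤ.+ im (jacobi n) ℤ.* w ≈⟨ eval≈re+im*ω w w-root (jacobi n) ⟨
      evalw (χ n ∙ χ (1− n)) ≈⟨ eval-∙ w w-root (χ n) (χ (1− n)) ⟩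
      evalw (χ n) ℤ.* evalw (χ (1− n)) ≈⟨ *-≡mod (evalw-χ n) (evalw-χ (1− n)) ⟩
      (+ n) ℤ.^ e ℤ.* (+ (1− n)) ℤ.^ e ≈⟨ *-≡modˡ ((+ n) ℤ.^ e) (^-≡mod e (1−≡ n)) ⟩
      (+ n) ℤ.^ e ℤ.* (+ 1 ℤ.- + n) ℤ.^ e  ∎

  module InRing {m : ℕ} (ℂ : Cyclotomic m q) (reg3 : Regular m (+ 3)) where
    open Cyclotomic ℂ
    open CubeRoot commRing integers
    open IntegerSolver commRing integers
    open PeriodicSums commRing
    open SetoidReasoning setoid
    open GaussSums {e = e} pr q≡1+3e w w-root ℂ reg3 public

    ι-∑ : ∀ f → ι (Σℤ.∑ f) ≈ ∑ (λ n → ι (f n))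
    ι-∑ f = go q (λ i → f (toℕ i))
      where
      go : ∀ k (g : Fin k → ℤ) → ι (foldr ℤ._+_ (+ 0) g) ≈ sum (λ i → ι (g i))
      go zero    g = 0-homo
      go (suc k) g = ≈-trans (+-homo (g Fin.zero) _) (+-congˡ (go k (g ∘ Fin.suc)))

    ∑-value : ∀ (ψ : ℕ → Value) x → ∑ (λ n → ι (re (ψ n)) + ι (im (ψ n)) * x) ≈
        ι (Σℤ.∑ (λ n → re (ψ n))) + ι (Σℤ.∑ (λ n → im (ψ n))) * x
    ∑-value ψ x = begin
      ∑ (λ n → ι (re (ψ n)) + ι (im (ψ n)) * x) ≈⟨ ∑-+ (λ n → ι (re (ψ n))) (λ n → ι (im (ψ n)) * x) ⟩
      ∑ (λ n → ι (re (ψ n))) + ∑ (λ n → ι (im (ψ n)) * x) ≈⟨ +-congˡ (∑-*ʳ x (λ n → ι (im (ψ n)))) ⟨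
      ∑ (λ n → ι (re (ψ n))) + ∑ (λ n → ι (im (ψ n))) * x ≈⟨ +-cong (ι-∑ (λ n → re (ψ n))) (*-congʳ (ι-∑ (λ n → im (ψ n)))) ⟨
      ι (Σℤ.∑ (λ n → re (ψ n))) + ι (Σℤ.∑ (λ n → im (ψ n))) * x  ∎

    J J′ : Carrier
    J  = ι A + ι B * ω
    J′ = ι A + ι B * (ω * ω)

    Jacobi-χ : Jacobi χ ≈ J
    Jacobi-χ = ≈-trans (∑-cong (λ n → eval≈re+im*ω ω ω-root (jacobi n))) (∑-value jacobi ω)

    -- Squaring a cube root of unity is conjugation, so the Jacobi sum of χ² is J with ω² in place
    -- of ω.
    square≈ : ∀ v → ⟦ v ∙ v ⟧ ≈ ι (re v) + ι (im v) * (ω * ω)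
    square≈ 𝟘  = solve 1 (λ ω → con (+ 0) := con (+ 0) :+ con (+ 0) :* (ω :* ω)) ≈-refl ω
    square≈ 𝟙  = solve 1 (λ ω → con (+ 1) := con (+ 1) :+ con (+ 0) :* (ω :* ω)) ≈-refl ω
    square≈ 𝕨  = solve 1 (λ ω → ω :* ω := con (+ 0) :+ con (+ 1) :* (ω :* ω)) ≈-refl ω
    square≈ 𝕨² = modΦ ω ω-root (ι (+ 1)) (solve 1 (λ ω → ω :=
      con (-[1+ 0 ]) :+ con (-[1+ 0 ]) :* (ω :* ω) :+ (ω :* ω :+ ω :+ con (+ 1)) :* con (+ 1)) ≈-refl ω)

    Jacobi-χ² : Jacobi χ² ≈ J′
    Jacobi-χ² = ≈-trans (∑-cong (λ n → ≈-trans (reflexive (cong ⟦_⟧ (sym (square-∙ (χ n) (χ (1− n)))))) (square≈ (jacobi n)))) (∑-value jacobi (ω * ω))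

    G²≈JG′ : G * G ≈ J * G′
    G²≈JG′ = ≈-trans (Gauss² χ-character χ²-character) (*-congʳ Jacobi-χ)

    square-χ² : ∀ n → square χ² n ≡ χ n
    square-χ² n = square-square (χ n)

    square-χ²-character : Character (square χ²)
    square-χ²-character = record
      { ψ-cong = λ eq → cong (λ v → v ∙ v) (ψ-cong χ²-character eq)
      ; ψ-* = λ m n → trans (square-χ² (m ℕ.* n)) (trans (χ-* m n) (sym (cong₂ _∙_ (square-χ² m) (square-χ² n))))
      ; ψ-zero = λ {n} eq → trans (square-χ² n) (n≡0⇒χ≡𝟘 eq)
      ; g = proj₁ nontrivial
      ; ψg≢𝟘 = λ eq → proj₁ (proj₂ nontrivial) (trans (sym (square-χ² _)) eq)
      ; ψg≢𝟙 = λ eq → proj₂ (proj₂ nontrivial) (trans (sym (square-χ² _)) eq)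
      }
      where open Character

    G′²≈J′G : G′ * G′ ≈ J′ * G
    G′²≈J′G = ≈-trans (Gauss² χ²-character square-χ²-character)
      (*-cong Jacobi-χ² (∑-cong (λ n → *-congʳ {ζ ^ᴿ n} (reflexive (cong ⟦_⟧ (square-χ² n))))))

    -- Multiplied by q = G G′, the left side is (J G′)(J′ G) = G² G′² = q²; then q cancels.
    JJ′≈q : Regular m (+ q) → J * J′ ≈ ι (+ q)
    JJ′≈q regq = begin
      J * J′ ≈⟨ solve 2 (λ x y → x := (x :- y) :+ y) ≈-refl (J * J′) (ι (+ q)) ⟩
      (J * J′ - ι (+ q)) + ι (+ q) ≈⟨ +-congʳ (ι-regular regq (J * J′ - ι (+ q)) vanish) ⟩
      ι (+ 0) + ι (+ q) ≈⟨ solve 1 (λ x → con (+ 0) :+ x := x) ≈-refl (ι (+ q)) ⟩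
      ι (+ q)  ∎
      where
      vanish : ι (+ q) * (J * J′ - ι (+ q)) ≈ ι (+ 0)
      vanish = begin
        ι (+ q) * (J * J′ - ι (+ q)) ≈⟨ solve 3 (λ q j j′ → q :* (j :* j′ :- q) := j :* j′ :* q :- q :* q) ≈-refl (ι (+ q)) J J′ ⟩
        J * J′ * ι (+ q) - ι (+ q) * ι (+ q) ≈⟨ +-cong (*-congˡ (≈-sym G*G′≈q)) (-‿cong (*-cong (≈-sym G*G′≈q) (≈-sym G*G′≈q))) ⟩
        J * J′ * (G * G′) - G * G′ * (G * G′) ≈⟨ solve 4 (λ j j′ g g′ → j :* j′ :* (g :* g′) :- g :* g′ :* (g :* g′) :=
            (j :* g′) :* (j′ :* g) :- (g :* g) :* (g′ :* g′)) ≈-refl J J′ G G′ ⟩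
        (J * G′) * (J′ * G) - (G * G) * (G′ * G′) ≈⟨ +-congʳ (*-cong (≈-sym G²≈JG′) (≈-sym G′²≈J′G)) ⟩
        (G * G) * (G′ * G′) - (G * G) * (G′ * G′) ≈⟨ solve 1 (λ x → x :- x := con (+ 0)) ≈-refl _ ⟩
        ι (+ 0)  ∎

    ∑imχ≡0 : Σℤ.∑ (λ n → im (χ n)) ≡ + 0 [modℤ m ]
    ∑imχ≡0 = proj₂ (ι-injective (Σℤ.∑ (λ n → re (χ n))) (Σℤ.∑ (λ n → im (χ n))) (≈-trans (≈-sym (∑-value χ ω))
      (≈-trans (∑-cong (λ n → ≈-sym (eval≈re+im*ω ω ω-root (χ n)))) (Character.∑ψ≈0 χ-character))))

    norm : Regular m (+ q) → A ℤ.* A ℤ.- A ℤ.* B ℤ.+ B ℤ.* B ≡ + q [modℤ m ]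
    norm regq = -≡0⇒≡mod (proj₁ (ι-injective (N ℤ.- + q) (+ 0) (begin
      ι (N ℤ.- + q) + ι (+ 0) * ω ≈⟨ +-congʳ (≈-trans (+-homo N (ℤ.- + q)) (+-cong ιN (-‿homo (+ q)))) ⟩
      ι A * ι A - ι A * ι B + ι B * ι B - ι (+ q) + ι (+ 0) * ω ≈⟨ modΦ ω ω-root c (solve 4 (λ a b q ω →
          a :* a :- a :* b :+ b :* b :- q :+ con (+ 0) :* ω :=
          (a :+ b :* ω) :* (a :+ b :* (ω :* ω)) :- q :+ (ω :* ω :+ ω :+ con (+ 1)) :*
            (:- (a :* b :+ b :* b :* (ω :- con (+ 1))))) ≈-refl (ι A) (ι B) (ι (+ q)) ω) ⟩
      J * J′ - ι (+ q) ≈⟨ +-congʳ (JJ′≈q regq) ⟩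
      ι (+ q) - ι (+ q) ≈⟨ solve 1 (λ x → x :- x := con (+ 0)) ≈-refl _ ⟩
      ι (+ 0)                                                      ∎)))
      where
      N : ℤ
      N = A ℤ.* A ℤ.- A ℤ.* B ℤ.+ B ℤ.* B
      c : Carrier
      c = - (ι A * ι B + ι B * ι B * (ω - ι (+ 1)))
      ιN : ι N ≈ ι A * ι A - ι A * ι B + ι B * ι B
      ιN = ≈-trans (+-homo (A ℤ.* A ℤ.- A ℤ.* B) (B ℤ.* B)) (+-cong (≈-trans (+-homo (A ℤ.* A) (ℤ.- (A ℤ.* B)))
        (+-cong (*-homo A A) (≈-trans (-‿homo (A ℤ.* B)) (-‿cong (*-homo A B))))) (*-homo B B))

  private
    1<q : 1 ℕ.< q
    1<q = prime>1 pr

    regular3 : Regular 0 (+ 3)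
    regular3 = regular0 {+ 3} (λ ())

    module R₀ = InRing (FormalSums.cyclotomic 0 q 1<q) regular3

  -- J J′ = q written in coordinates, in the ring with modulus 0, where congruence is equality.
  norm≡q : A ℤ.* A ℤ.- A ℤ.* B ℤ.+ B ℤ.* B ≡ + q
  norm≡q = mod0⇒≡ (R₀.norm (regular0 {+ q} (λ eq → ℕ.<⇒≢ (ℕ.<-trans ℕ.z<s 1<q) (sym (ℤ.+-injective eq)))))

  -- χ ≡ 1 + im χ (ω - 1) modulo 3, so im χ is additive modulo 3.
  B≡0mod3 : B ≡ + 0 [modℤ 3 ]
  B≡0mod3 = begin
    B ≈⟨ Σ3.∑-cong pointwise ⟩
    Σℤ.∑ (λ n → im (χ n) ℤ.+ im (χ (1− n))) ≡⟨ Σℤ.∑-+ (λ n → im (χ n)) (λ n → im (χ (1− n))) ⟩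
    Σℤ.∑ (λ n → im (χ n)) ℤ.+ Σℤ.∑ (λ n → im (χ (1− n))) ≡⟨ cong₂ ℤ._+_ ∑imχ (trans
        (Σℤ.∑-reindex {λ n → im (χ n)} (λ eq → cong im (χ-cong eq)) (q ∸ 1) q∸1≢0 1) ∑imχ) ⟩
    + 0  ∎
    where
    module Σ3 = PeriodicSums (ℤmod 3)
    open PrimeModulus pr using (1≢0)
    open SetoidReasoning Z3.setoid
    ∑imχ : Σℤ.∑ (λ n → im (χ n)) ≡ + 0
    ∑imχ = mod0⇒≡ R₀.∑imχ≡0
    q∸1≢0 : ¬ + (q ∸ 1) ≡ + 0 [modℤ q ]
    q∸1≢0 eq = 1≢0 (Z.trans (Z.sym (neg-≡mod [q∸1]≡-1)) (neg-≡mod eq))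
    pointwise : ∀ n → im (χ n ∙ χ (1− n)) ≡ im (χ n) ℤ.+ im (χ (1− n)) [modℤ 3 ]
    pointwise n with χ n ≟𝟘 | χ (1− n) ≟𝟘
    ... | no u≢𝟘 | no v≢𝟘 = im-∙ (χ n) (χ (1− n)) u≢𝟘 v≢𝟘
    ... | yes u≡𝟘 | _ = ≡⇒≡mod (subst (λ u → im (u ∙ χ (1− n)) ≡ im u ℤ.+ im (χ (1− n))) (sym u≡𝟘)
        (sym (cong (λ v → + 0 ℤ.+ im v) v≡𝟙)))
      where
      v≡𝟙 : χ (1− n) ≡ 𝟙
      v≡𝟙 = trans (χ-cong {n = 1} (Z.trans (1−≡ n) (+-≡modˡ (+ 1) (neg-≡mod (χ≡𝟘⇒n≡0 u≡𝟘))))) χ1≡𝟙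
    ... | no _ | yes v≡𝟘 = ≡⇒≡mod (subst (λ v → im (χ n ∙ v) ≡ im (χ n) ℤ.+ im v) (sym v≡𝟘)
        (subst (λ u → im (u ∙ 𝟘) ≡ im u ℤ.+ + 0) (sym u≡𝟙) refl))
      where
      lemma : ∀ n → n ≡ + 1 ℤ.- (+ 1 ℤ.- n)
      lemma = solve-∀
      u≡𝟙 : χ n ≡ 𝟙
      u≡𝟙 = trans (χ-cong {n = 1} (Z.trans (≡⇒≡mod (lemma (+ n))) (+-≡modˡ (+ 1) (neg-≡mod (Z.trans (Z.sym (1−≡ n)) (χ≡𝟘⇒n≡0 v≡𝟘)))))) χ1≡𝟙

∙-assoc : ∀ u v x → (u ∙ v) ∙ x ≡ u ∙ (v ∙ x)
∙-assoc 𝟘  v  x  = refl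
∙-assoc 𝟙  v  x  = refl
∙-assoc 𝕨  𝟘  x  = refl
∙-assoc 𝕨  𝟙  x  = refl
∙-assoc 𝕨  𝕨  𝟘  = refl
∙-assoc 𝕨  𝕨  𝟙  = refl
∙-assoc 𝕨  𝕨  𝕨  = refl
∙-assoc 𝕨  𝕨  𝕨² = refl
∙-assoc 𝕨  𝕨² 𝟘  = refl
∙-assoc 𝕨  𝕨² 𝟙  = refl
∙-assoc 𝕨  𝕨² 𝕨  = refl
∙-assoc 𝕨  𝕨² 𝕨² = refl
∙-assoc 𝕨² 𝟘  x  = refl
∙-assoc 𝕨² 𝟙  x  = refl
∙-assoc 𝕨² 𝕨  𝟘  = refl
∙-assoc 𝕨² 𝕨  𝟙  = refl
∙-assoc 𝕨² 𝕨  𝕨  = refl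
∙-assoc 𝕨² 𝕨  𝕨² = refl
∙-assoc 𝕨² 𝕨² 𝟘  = refl
∙-assoc 𝕨² 𝕨² 𝟙  = refl
∙-assoc 𝕨² 𝕨² 𝕨  = refl
∙-assoc 𝕨² 𝕨² 𝕨² = refl

-- The coefficient of y² in the reduction of yᵏ modulo y³ = a y + b.
leading : ℤ → ℤ → ℕ → ℤ
leading a b 0 = + 0
leading a b 1 = + 0
leading a b 2 = + 1
leading a b (suc (suc (suc k))) = a ℤ.* leading a b (suc k) ℤ.+ b ℤ.* leading a b k

-- The Frobenius map on the roots of the two cubics

module CubicPowers {q e : ℕ} (qPrime : Prime q) (q≡1+3e : q ≡ suc (3 ℕ.* e))
                   (w : ℤ) (w-root : w ℤ.* w ℤ.+ w ℤ.+ + 1 ≡ + 0 [modℤ q ])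
                   {p : ℕ} (pPrime : Prime p) (p≢q : p ≢ q) (p≢3 : p ≢ 3)
                   (ℂ : Cyclotomic p q) (reg3 : Regular p (+ 3)) where
  open CubicSymbol {e = e} qPrime q≡1+3e w w-root
  open Residues qPrime
  open JacobiSum {e = e} qPrime q≡1+3e w w-root
  open InRing ℂ reg3
  open Cyclotomic ℂ
  open CubeRoot commRing integers
  open IntegerSolver commRing integers
  open PeriodicSums commRing
  open SetoidReasoning setoid
  open Algebra.Properties.Semiring.Mult semiring using () renaming (_×_ to _·_)
  open Algebra.Properties.CommutativeSemiring.Exp commutativeSemiring using () renaming (^-distrib-* to ^ᴿ-distrib-*)
  private
    module Frob = Frobenius commRing pPrime

    p·1≈0 : p · 1# ≈ 0#
    p·1≈0 = ≈-trans (≈-sym (ι≈·1# p)) (≈-trans (ι-cong m≡0) 0-homo)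
      where
      ι≈·1# : ∀ n → ι (+ n) ≈ n · 1#
      ι≈·1# zero    = 0-homo
      ι≈·1# (suc n) = ≈-trans (+-homo (+ 1) (+ n)) (+-cong 1-homo (ι≈·1# n))

  ^p-+ : ∀ x y → (x + y) ^ᴿ p ≈ x ^ᴿ p + y ^ᴿ p
  ^p-+ = Frob.^p-+ p·1≈0

  ^p-cong : ∀ {x y} → x ≈ y → x ^ᴿ p ≈ y ^ᴿ p
  ^p-cong = ^-congˡ p

  -- A square root of -3. The p-th power sends it to -θ exactly when it exchanges ω and ω².
  θ : Carrier
  θ = ω - ω * ω

  ^p-ω : (ω ^ᴿ p ≈ ω × (ω * ω) ^ᴿ p ≈ ω * ω) ⊎ (ω ^ᴿ p ≈ ω * ω × (ω * ω) ^ᴿ p ≈ ω)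
  ^p-ω = go (p ℕ.% 3) (ℕ.m%n<n p 3) refl
    where
    ω^3k : ∀ k → ω ^ᴿ (k ℕ.* 3) ≈ ι (+ 1)
    ω^3k zero    = ≈-sym 1-homo
    ω^3k (suc k) = ≈-trans (*-congˡ (*-congˡ (*-congˡ (ω^3k k))))
      (≈-trans (solve 1 (λ ω → ω :* (ω :* (ω :* con (+ 1))) := ω :* (ω :* ω)) ≈-refl ω) (ω³≈1 ω ω-root))
    ω^p : ω ^ᴿ p ≈ ω ^ᴿ (p ℕ.% 3)
    ω^p = begin
      ω ^ᴿ p ≡⟨ cong (ω ^ᴿ_) (ℕ.m≡m%n+[m/n]*n p 3) ⟩
      ω ^ᴿ (p ℕ.% 3 ℕ.+ p ℕ./ 3 ℕ.* 3) ≈⟨ ^-homo-* ω (p ℕ.% 3) (p ℕ./ 3 ℕ.* 3) ⟩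
      ω ^ᴿ (p ℕ.% 3) * ω ^ᴿ (p ℕ./ 3 ℕ.* 3) ≈⟨ *-congˡ (ω^3k (p ℕ./ 3)) ⟩
      ω ^ᴿ (p ℕ.% 3) * ι (+ 1) ≈⟨ solve 1 (λ x → x :* con (+ 1) := x) ≈-refl _ ⟩
      ω ^ᴿ (p ℕ.% 3)  ∎
    go : ∀ r → r ℕ.< 3 → p ℕ.% 3 ≡ r → (ω ^ᴿ p ≈ ω × (ω * ω) ^ᴿ p ≈ ω * ω) ⊎ (ω ^ᴿ p ≈ ω * ω × (ω * ω) ^ᴿ p ≈ ω)
    go 0 _ r≡0 = [ (λ ()) , (λ 3≡p → ⊥-elim (p≢3 (sym 3≡p))) ]′ (prime⇒irreducible pPrime (ℕ.m%n≡0⇒n∣m p 3 r≡0))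
    go 1 _ r≡1 = inj₁ (ω^p≈ω , ≈-trans (^ᴿ-distrib-* ω ω p) (*-cong ω^p≈ω ω^p≈ω))
      where
      ω^p≈ω : ω ^ᴿ p ≈ ω
      ω^p≈ω = ≈-trans ω^p (≈-trans (reflexive (cong (ω ^ᴿ_) r≡1)) (*-identityʳ ω))
    go 2 _ r≡2 = inj₂ (ω^p≈ω² , ≈-trans (^ᴿ-distrib-* ω ω p) (≈-trans (*-cong ω^p≈ω² ω^p≈ω²) (≈-sym (⟦⟧-∙ 𝕨² 𝕨²))))
      where
      ω^p≈ω² : ω ^ᴿ p ≈ ω * ω
      ω^p≈ω² = ≈-trans ω^p (≈-trans (reflexive (cong (ω ^ᴿ_) r≡2)) (*-congˡ (*-identityʳ ω)))
    go (suc (suc (suc _))) (ℕ.s≤s (ℕ.s≤s (ℕ.s≤s ()))) _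

  ^p-ι0 : ι (+ 0) ^ᴿ p ≈ ι (+ 0)
  ^p-ι0 = ≈-trans (^p-cong 0-homo) (≈-trans (Frob.^p-0 p·1≈0) (≈-sym 0-homo))

  ^p-ι1 : ι (+ 1) ^ᴿ p ≈ ι (+ 1)
  ^p-ι1 = ≈-trans (^p-cong 1-homo) (≈-trans (1^ p) (≈-sym 1-homo))
    where
    1^ : ∀ n → 1# ^ᴿ n ≈ 1#
    1^ zero    = ≈-refl
    1^ (suc n) = ≈-trans (*-identityˡ _) (1^ n)

  ^p-value : (∀ v → ⟦ v ⟧ ^ᴿ p ≈ ⟦ v ⟧) ⊎ (∀ v → ⟦ v ⟧ ^ᴿ p ≈ ⟦ v ∙ v ⟧)
  ^p-value with ^p-ω
  ... | inj₁ (ω^p , ω²^p) = inj₁ λ { 𝟘 → ^p-ι0 ; 𝟙 → ^p-ι1 ; 𝕨 → ω^p ; 𝕨² → ω²^p }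
  ... | inj₂ (ω^p , ω²^p) = inj₂ λ { 𝟘 → ^p-ι0 ; 𝟙 → ^p-ι1 ; 𝕨 → ω^p ; 𝕨² → ω²^p }

  -- A discrete Fourier transform over the three roots: with weights 1, ω², ω only the terms in X
  -- and Y² survive, each three times, while c and the terms in Y, X² and X Y drop out.
  fourier : ∀ X Y t s a b c →
    t * X + s * Y ≈ a * ((X + Y) * (X + Y)) + b * (X + Y) + c →
    ω * t * X + ω * ω * s * Y ≈ a * ((ω * X + ω * ω * Y) * (ω * X + ω * ω * Y)) + b * (ω * X + ω * ω * Y) + c →
    ω * ω * t * X + ω * s * Y ≈ a * ((ω * ω * X + ω * Y) * (ω * ω * X + ω * Y)) + b * (ω * ω * X + ω * Y) + c →
    t * X - (a * (Y * Y) + b * X) ≈ ι (+ 0)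
  fourier X Y t s a b c e₀ e₁ e₂ = ι-regular reg3 _ (modΦ ω ω-root Q (≈-trans
      (solve 8 (λ X Y t s a b c ω →
        con (+ 3) :* (t :* X :- (a :* (Y :* Y) :+ b :* X)) :=
          ((t :* X :+ s :* Y) :- (a :* ((X :+ Y) :* (X :+ Y)) :+ b :* (X :+ Y) :+ c)) :+
          ω :* ω :* ((ω :* t :* X :+ ω :* ω :* s :* Y) :- (a :* ((ω :* X :+ ω :* ω :* Y) :* (ω :* X :+ ω :* ω :* Y)) :+ b :* (ω :* X :+ ω :* ω :* Y) :+ c)) :+
          ω :* ((ω :* ω :* t :* X :+ ω :* s :* Y) :- (a :* ((ω :* ω :* X :+ ω :* Y) :* (ω :* ω :* X :+ ω :* Y)) :+ b :* (ω :* ω :* X :+ ω :* Y) :+ c)) :+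
          (ω :* ω :+ ω :+ con (+ 1)) :*
            (con (+ 2) :* t :* X :* (con (+ 1) :- ω) :- s :* Y :* (con (+ 1) :- ω :+ ω :* ω)
             :+ a :* ((X :* X :+ con (+ 2) :* X :* Y) :* (ω :* ω :* ω :- ω :+ con (+ 1)))
             :- a :* Y :* Y :* (con (+ 1) :- ω) :* (con (+ 2) :+ ω :* ω :* ω)
             :- con (+ 2) :* b :* X :* (con (+ 1) :- ω) :+ b :* Y :* (con (+ 1) :- ω :+ ω :* ω) :+ c))
        ≈-refl X Y t s a b c ω)
      (+-congʳ (≈-trans (+-cong (+-cong (vanish e₀) (*-congˡ (vanish e₁))) (*-congˡ (vanish e₂)))
        (solve 1 (λ ω → con (+ 0) :+ ω :* ω :* con (+ 0) :+ ω :* con (+ 0) := con (+ 0)) ≈-refl ω)))))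
    where
    Q : Carrier
    Q = ι (+ 2) * t * X * (ι (+ 1) - ω) - s * Y * (ι (+ 1) - ω + ω * ω)
        + a * ((X * X + ι (+ 2) * X * Y) * (ω * ω * ω - ω + ι (+ 1)))
        - a * Y * Y * (ι (+ 1) - ω) * (ι (+ 2) + ω * ω * ω)
        - ι (+ 2) * b * X * (ι (+ 1) - ω) + b * Y * (ι (+ 1) - ω + ω * ω) + c
    vanish : ∀ {x y} → x ≈ y → x - y ≈ ι (+ 0)
    vanish {x} {y} eq = ≈-trans (+-congʳ eq) (solve 1 (λ y → y :- y := con (+ 0)) ≈-refl y)

  -- Multiplication by y moves the coefficient of y into that of y², and the constant plus a times
  -- the leading coefficient into that of y. So the leading coefficients of three successive powers
  -- determine the whole remainder.
  power-reduction : ∀ {y} a b → y * (y * y) ≈ ι a * y + ι b → ∀ k →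
    y ^ᴿ k ≈ ι (leading a b k) * (y * y) + ι (leading a b (suc k)) * y
        + (ι (leading a b (suc (suc k))) - ι a * ι (leading a b k))
  power-reduction {y} a b cubic zero = ≈-trans (≈-sym 1-homo) (solve 2 (λ y a → con (+ 1) :=
    con (+ 0) :* (y :* y) :+ con (+ 0) :* y :+ (con (+ 1) :- a :* con (+ 0))) ≈-refl y (ι a))
  power-reduction {y} a b cubic (suc k) = begin
    y * y ^ᴿ k ≈⟨ *-congˡ (power-reduction a b cubic k) ⟩
    y * (c₀ * (y * y) + c₁ * y + (c₂ - ι a * c₀)) ≈⟨ solve 5 (λ y c₀ c₁ c₂ a →
        y :* (c₀ :* (y :* y) :+ c₁ :* y :+ (c₂ :- a :* c₀)) :=
        c₀ :* (y :* (y :* y)) :+ c₁ :* (y :* y) :+ (c₂ :- a :* c₀) :* y) ≈-refl y c₀ c₁ c₂ (ι a) ⟩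
    c₀ * (y * (y * y)) + c₁ * (y * y) + (c₂ - ι a * c₀) * y ≈⟨ +-congʳ (+-congʳ (*-congˡ cubic)) ⟩
    c₀ * (ι a * y + ι b) + c₁ * (y * y) + (c₂ - ι a * c₀) * y ≈⟨ solve 6 (λ y c₀ c₁ c₂ a b →
        c₀ :* (a :* y :+ b) :+ c₁ :* (y :* y) :+ (c₂ :- a :* c₀) :* y :=
        c₁ :* (y :* y) :+ c₂ :* y :+ (a :* c₁ :+ b :* c₀ :- a :* c₁)) ≈-refl y c₀ c₁ c₂ (ι a) (ι b) ⟩
    c₁ * (y * y) + c₂ * y + (ι a * c₁ + ι b * c₀ - ι a * c₁) ≈⟨ +-congˡ (+-congʳ (≈-sym next)) ⟩
    c₁ * (y * y) + c₂ * y + (ι (leading a b (3 ℕ.+ k)) - ι a * c₁)  ∎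
    where
    c₀ c₁ c₂ : Carrier
    c₀ = ι (leading a b k)
    c₁ = ι (leading a b (suc k))
    c₂ = ι (leading a b (suc (suc k)))
    next : ι (leading a b (3 ℕ.+ k)) ≈ ι a * c₁ + ι b * c₀
    next = ≈-trans (+-homo _ _) (+-cong (*-homo a (leading a b (suc k))) (*-homo b (leading a b k)))

  -- `fixed` concerns the coefficients of the powers of ζ in the roots `y u`: when they are fixed,
  -- the p-th power acts on ζ alone.
  module _ (κ κ′ : Carrier)
      (fixed : ∀ v → (κ * ⟦ v ⟧ + κ′ * ⟦ v ∙ v ⟧) ^ᴿ p ≈ κ * ⟦ v ⟧ + κ′ * ⟦ v ∙ v ⟧) where

    X Y : Carrier
    X = κ * G
    Y = κ′ * G′

    y : Value → Carrier
    y u = ⟦ u ⟧ * X + ⟦ u ∙ u ⟧ * Y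

    private
      coefficient : Value → ℕ → Carrier
      coefficient u n = κ * ⟦ u ∙ χ n ⟧ + κ′ * ⟦ (u ∙ χ n) ∙ (u ∙ χ n) ⟧

      F : Value → ℕ → Carrier
      F u n = coefficient u n * ζ ^ᴿ n

      y≈∑F : ∀ u → y u ≈ ∑ (F u)
      y≈∑F u = begin
        ⟦ u ⟧ * (κ * G) + ⟦ u ∙ u ⟧ * (κ′ * G′) ≈⟨ solve 6 (λ a b c d g g′ → a :* (c :* g) :+ b :* (d :* g′) := a :* c :* g :+ b :* d :* g′) ≈-refl ⟦ u ⟧ ⟦ u ∙ u ⟧ κ κ′ G G′ ⟩
        ⟦ u ⟧ * κ * G + ⟦ u ∙ u ⟧ * κ′ * G′ ≈⟨ +-cong (∑-* (⟦ u ⟧ * κ) (term χ)) (∑-* (⟦ u ∙ u ⟧ * κ′) (term χ²)) ⟩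
        ∑ (λ n → ⟦ u ⟧ * κ * term χ n) + ∑ (λ n → ⟦ u ∙ u ⟧ * κ′ * term χ² n)
          ≈⟨ ∑-+ (λ n → ⟦ u ⟧ * κ * term χ n) (λ n → ⟦ u ∙ u ⟧ * κ′ * term χ² n) ⟨
        ∑ (λ n → ⟦ u ⟧ * κ * term χ n + ⟦ u ∙ u ⟧ * κ′ * term χ² n) ≈⟨ ∑-cong pointwise ⟩
        ∑ (F u)  ∎
        where
        pointwise : ∀ n → ⟦ u ⟧ * κ * term χ n + ⟦ u ∙ u ⟧ * κ′ * term χ² n ≈ F u n
        pointwise n = begin
          ⟦ u ⟧ * κ * (⟦ χ n ⟧ * ζ ^ᴿ n) + ⟦ u ∙ u ⟧ * κ′ * (⟦ χ² n ⟧ * ζ ^ᴿ n)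
            ≈⟨ solve 7 (λ a b c d x z y → a :* c :* (x :* z) :+ b :* d :* (y :* z) := (c :* (a :* x) :+ d :* (b :* y)) :* z)
                 ≈-refl ⟦ u ⟧ ⟦ u ∙ u ⟧ κ κ′ ⟦ χ n ⟧ (ζ ^ᴿ n) ⟦ χ² n ⟧ ⟩
          (κ * (⟦ u ⟧ * ⟦ χ n ⟧) + κ′ * (⟦ u ∙ u ⟧ * ⟦ χ² n ⟧)) * ζ ^ᴿ n
            ≈⟨ *-congʳ (+-cong (*-congˡ (⟦⟧-∙ u (χ n))) (*-congˡ (≈-trans (reflexive (cong ⟦_⟧ (square-∙ u (χ n)))) (⟦⟧-∙ (u ∙ u) (χ² n))))) ⟨
          F u n ∎

    -- The inverse of χ(p), since χ(p)³ = 1.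
    τ : Value
    τ = χ² p

    private
      p≢0 : ¬ + p ≡ + 0 [modℤ q ]
      p≢0 = PrimeModulus.prime≢⇒≢0 qPrime pPrime (λ q≡p → p≢q (sym q≡p))

      χ-p* : ∀ n → χ n ≡ τ ∙ χ (p ℕ.* n ℕ.+ 0)
      χ-p* n = trans (cong (_∙ χ n) (sym (cube≡𝟙 (χ p) (λ eq → p≢0 (χ≡𝟘⇒n≡0 eq)))))
        (trans (∙-assoc τ (χ p) (χ n)) (cong (τ ∙_) (trans (sym (χ-* p n)) (cong χ (sym (ℕ.+-identityʳ (p ℕ.* n)))))))

    -- The p-th power replaces ζ^n by ζ^(pn). As χ(n) = τ χ(pn), the substitution of n for pn leaves
    -- a factor τ in the character.
    y^p : ∀ u → y u ^ᴿ p ≈ y (u ∙ τ)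
    y^p u = begin
      y u ^ᴿ p ≈⟨ ^p-cong (y≈∑F u) ⟩
      ∑ (F u) ^ᴿ p ≈⟨ Frob.^p-sum p·1≈0 {q} (λ i → F u (toℕ i)) ⟩
      ∑ (λ n → F u n ^ᴿ p) ≈⟨ ∑-cong pointwise ⟩
      ∑ (λ n → F (u ∙ τ) (p ℕ.* n ℕ.+ 0)) ≈⟨ ∑-reindex {F (u ∙ τ)} F-periodic p p≢0 0 ⟩
      ∑ (F (u ∙ τ)) ≈⟨ y≈∑F (u ∙ τ) ⟨
      y (u ∙ τ)  ∎
      where
      F-periodic : Periodic (F (u ∙ τ))
      F-periodic eq = *-cong (reflexive (cong (λ v → κ * ⟦ (u ∙ τ) ∙ v ⟧ + κ′ * ⟦ ((u ∙ τ) ∙ v) ∙ ((u ∙ τ) ∙ v) ⟧) (χ-cong eq))) (ζ^-periodic eq)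
      pointwise : ∀ n → F u n ^ᴿ p ≈ F (u ∙ τ) (p ℕ.* n ℕ.+ 0)
      pointwise n = begin
        (coefficient u n * ζ ^ᴿ n) ^ᴿ p ≈⟨ ^ᴿ-distrib-* (coefficient u n) (ζ ^ᴿ n) p ⟩
        coefficient u n ^ᴿ p * (ζ ^ᴿ n) ^ᴿ p ≈⟨ *-cong (fixed (u ∙ χ n)) (≈-trans (^-assocʳ ζ n p)
            (reflexive (cong (ζ ^ᴿ_) (trans (ℕ.*-comm n p) (sym (ℕ.+-identityʳ (p ℕ.* n))))))) ⟩
        coefficient u n * ζ ^ᴿ (p ℕ.* n ℕ.+ 0)
          ≡⟨ cong (λ v → (κ * ⟦ v ⟧ + κ′ * ⟦ v ∙ v ⟧) * ζ ^ᴿ (p ℕ.* n ℕ.+ 0))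
               (trans (cong (u ∙_) (χ-p* n)) (sym (∙-assoc u τ (χ (p ℕ.* n ℕ.+ 0))))) ⟩
        F (u ∙ τ) (p ℕ.* n ℕ.+ 0)  ∎

    module _ (n ℓ d : ℤ) (J₁ J₂ : Carrier) (regn : Regular p n)
             (XY : X * Y ≈ ι n) (X² : X * X ≈ J₁ * Y) (Y² : Y * Y ≈ J₂ * X)
             (J₁+J₂ : J₁ + J₂ ≈ ι ℓ) (J₁-J₂ : J₁ - J₂ ≈ ι d * θ) where

      private
        a b : ℤ
        a = + 3 ℤ.* n
        b = n ℤ.* ℓ

      unit-cubed : ∀ u → u ≢ 𝟘 → ⟦ u ⟧ * ⟦ u ∙ u ⟧ ≈ ι (+ 1)
      unit-cubed u u≢𝟘 = ≈-trans (*-comm _ _) (≈-trans (≈-sym (⟦⟧-∙ (u ∙ u) u)) (reflexive (cong ⟦_⟧ (cube≡𝟙 u u≢𝟘))))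

      -- Cardano's identity (X+Y)³ = 3XY (X+Y) + X³ + Y³, with XY = n, X³ = J₁ XY and Y³ = J₂ XY.
      -- The factors u and u² have cube 1 and product 1.
      y-cubic : ∀ u → u ≢ 𝟘 → y u * (y u * y u) ≈ ι a * y u + ι b
      y-cubic u u≢𝟘 = begin
        y u * (y u * y u)
          ≈⟨ solve 4 (λ U V X Y → (U :* X :+ V :* Y) :* ((U :* X :+ V :* Y) :* (U :* X :+ V :* Y)) :=
               U :* (U :* U) :* (X :* (X :* X)) :+ con (+ 3) :* (U :* V) :* (X :* Y) :* (U :* X :+ V :* Y) :+ V :* (V :* V) :* (Y :* (Y :* Y)))
               ≈-refl U V X Y ⟩
        U * (U * U) * (X * (X * X)) + ι (+ 3) * (U * V) * (X * Y) * y u + V * (V * V) * (Y * (Y * Y))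
          ≈⟨ +-cong (+-cong (*-cong U³ (*-congˡ X²)) (*-congʳ (*-cong (*-congˡ (unit-cubed u u≢𝟘)) XY))) (*-cong V³ (*-congˡ Y²)) ⟩
        ι (+ 1) * (X * (J₁ * Y)) + ι (+ 3) * ι (+ 1) * ι n * y u + ι (+ 1) * (Y * (J₂ * X))
          ≈⟨ solve 6 (λ X Y j₁ j₂ n y → con (+ 1) :* (X :* (j₁ :* Y)) :+ con (+ 3) :* con (+ 1) :* n :* y :+ con (+ 1) :* (Y :* (j₂ :* X)) :=
               con (+ 3) :* n :* y :+ X :* Y :* (j₁ :+ j₂)) ≈-refl X Y J₁ J₂ (ι n) (y u) ⟩
        ι (+ 3) * ι n * y u + X * Y * (J₁ + J₂)
          ≈⟨ +-cong (*-congʳ (≈-sym (*-homo (+ 3) n))) (≈-trans (*-cong XY J₁+J₂) (≈-sym (*-homo n ℓ))) ⟩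
        ι a * y u + ι b ∎
        where
        U V : Carrier
        U = ⟦ u ⟧
        V = ⟦ u ∙ u ⟧
        U³ : U * (U * U) ≈ ι (+ 1)
        U³ = ≈-trans (*-congˡ (≈-sym (⟦⟧-∙ u u))) (unit-cubed u u≢𝟘)
        V³ : V * (V * V) ≈ ι (+ 1)
        V³ = ≈-trans (*-congˡ (≈-trans (≈-sym (⟦⟧-∙ (u ∙ u) (u ∙ u))) (reflexive (cong ⟦_⟧ (square-square u)))))
            (≈-trans (*-comm V U) (unit-cubed u u≢𝟘))

      -- Let A′, B′ be the coefficients of y² and y in y^p. The transform gives t X = (A′ J₂ + B′) X
      -- and s Y = (A′ J₁ + B′) Y. Subtracting, after multiplication by Y and X, removes B′ and
      -- leaves n times s - t = A′ (J₁ - J₂). Both sides of that equation are integer multiples of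
      -- θ.
      leading-p : leading a b p ℤ.* d ≡ im (χ p) [modℤ p ]
      -- θ = 1 + 2ω, so K θ has the coordinates K and 2K.
      leading-p = -≡0⇒≡mod (proj₁ (ι-injective K (K ℤ.* + 2) (begin
        ι K + ι (K ℤ.* + 2) * ω ≈⟨ +-congˡ (*-congʳ (*-homo K (+ 2))) ⟩
        ι K + ι K * ι (+ 2) * ω ≈⟨ modΦ ω ω-root (ι K) (solve 2 (λ k ω → k :+ k :* con (+ 2) :* ω :=
            k :* (ω :- ω :* ω) :+ (ω :* ω :+ ω :+ con (+ 1)) :* k) ≈-refl (ι K) ω) ⟩
        ι K * θ ≈⟨ *-congʳ (≈-trans (+-homo (leading a b p ℤ.* d) (ℤ.- im (χ p)))
            (+-cong (*-homo (leading a b p) d) (-‿homo (im (χ p))))) ⟩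
        (A′ * ι d - ι (im (χ p))) * θ ≈⟨ solve 4 (λ a d i θ → (a :* d :- i) :* θ := a :* (d :* θ) :- i :* θ) ≈-refl A′ (ι d) (ι (im (χ p))) θ ⟩
        A′ * (ι d * θ) - ι (im (χ p)) * θ ≈⟨ +-cong (*-congˡ (≈-sym J₁-J₂)) (-‿cong (≈-sym s-t)) ⟩
        A′ * (J₁ - J₂) - (s - t) ≈⟨ solve 2 (λ x y → x :- y := :- (y :- x)) ≈-refl (A′ * (J₁ - J₂)) (s - t) ⟩
        - ((s - t) - A′ * (J₁ - J₂)) ≈⟨ -‿cong (ι-regular regn _ vanish) ⟩
        - ι (+ 0) ≈⟨ solve 0 (:- con (+ 0) := con (+ 0)) ≈-refl ⟩
        ι (+ 0)                              ∎)))
        where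
        K : ℤ
        K = leading a b p ℤ.* d ℤ.- im (χ p)
        A′ B′ C′ t s : Carrier
        A′ = ι (leading a b p)
        B′ = ι (leading a b (suc p))
        C′ = ι (leading a b (suc (suc p))) - ι a * ι (leading a b p)
        t = ⟦ τ ⟧
        s = ⟦ τ ∙ τ ⟧
        quadratic : Carrier → Carrier
        quadratic z = A′ * (z * z) + B′ * z + C′
        quadratic-cong : ∀ {z z′} → z ≈ z′ → quadratic z ≈ quadratic z′
        quadratic-cong eq = +-congʳ (+-cong (*-congˡ (*-cong eq eq)) (*-congˡ eq))
        conjugate : ∀ u → u ≢ 𝟘 → y (u ∙ τ) ≈ quadratic (y u)
        conjugate u u≢𝟘 = ≈-trans (≈-sym (y^p u)) (power-reduction a b (y-cubic u u≢𝟘) p)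
        e₀ : t * X + s * Y ≈ quadratic (X + Y)
        e₀ = ≈-trans (conjugate 𝟙 (λ ())) (quadratic-cong (solve 2 (λ x y → con (+ 1) :* x :+ con (+ 1) :* y := x :+ y) ≈-refl X Y))
        e₁ : ω * t * X + ω * ω * s * Y ≈ quadratic (ω * X + ω * ω * Y)
        e₁ = ≈-trans (+-cong (*-congʳ (≈-sym (⟦⟧-∙ 𝕨 τ))) (*-congʳ (≈-sym (≈-trans (reflexive (cong ⟦_⟧ (square-∙ 𝕨 τ))) (⟦⟧-∙ 𝕨² (τ ∙ τ))))))
            (conjugate 𝕨 (λ ()))
        e₂ : ω * ω * t * X + ω * s * Y ≈ quadratic (ω * ω * X + ω * Y)
        e₂ = ≈-trans (+-cong (*-congʳ (≈-sym (⟦⟧-∙ 𝕨² τ))) (*-congʳ (≈-sym (≈-trans (reflexive (cong ⟦_⟧ (square-∙ 𝕨² τ))) (⟦⟧-∙ 𝕨 (τ ∙ τ))))))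
            (conjugate 𝕨² (λ ()))
        swap : ∀ {x y z z′} → x + y ≈ quadratic (z + z′) → y + x ≈ quadratic (z′ + z)
        swap {x} {y} {z} {z′} eq = ≈-trans (+-comm y x) (≈-trans eq (quadratic-cong (+-comm z z′)))
        f₁ : t * X - (A′ * (Y * Y) + B′ * X) ≈ ι (+ 0)
        f₁ = fourier X Y t s A′ B′ C′ e₀ e₁ e₂
        f₂ : s * Y - (A′ * (X * X) + B′ * Y) ≈ ι (+ 0)
        -- Exchanging X and Y interchanges the roots belonging to ω and ω².
        f₂ = fourier Y X s t A′ B′ C′ (swap e₀) (swap e₂) (swap e₁)
        vanish : ι n * ((s - t) - A′ * (J₁ - J₂)) ≈ ι (+ 0)
        vanish = begin
          ι n * ((s - t) - A′ * (J₁ - J₂)) ≈⟨ *-congʳ (≈-sym XY) ⟩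
          X * Y * ((s - t) - A′ * (J₁ - J₂)) ≈⟨ solve 8 (λ X Y s t a b j₁ j₂ →
              X :* Y :* ((s :- t) :- a :* (j₁ :- j₂)) :=
              X :* (s :* Y :- (a :* (j₁ :* Y) :+ b :* Y)) :- Y :* (t :* X :- (a :* (j₂ :* X) :+ b :* X))) ≈-refl X Y s t A′ B′ J₁ J₂ ⟩
          X * (s * Y - (A′ * (J₁ * Y) + B′ * Y)) - Y * (t * X - (A′ * (J₂ * X) + B′ * X))
            ≈⟨ +-cong (*-congˡ (+-congˡ (-‿cong (+-congʳ (*-congˡ (≈-sym X²))))))
                (-‿cong (*-congˡ (+-congˡ (-‿cong (+-congʳ (*-congˡ (≈-sym Y²))))))) ⟩
          X * (s * Y - (A′ * (X * X) + B′ * Y)) - Y * (t * X - (A′ * (Y * Y) + B′ * X))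
            ≈⟨ +-cong (*-congˡ f₂) (-‿cong (*-congˡ f₁)) ⟩
          X * ι (+ 0) - Y * ι (+ 0) ≈⟨ solve 2 (λ x y → x :* con (+ 0) :- y :* con (+ 0) := con (+ 0)) ≈-refl X Y ⟩
          ι (+ 0)  ∎
        -- s = χ(p)⁴ = χ(p) and t = χ(p)².
        s-t : s - t ≈ ι (im (χ p)) * θ
        s-t = by-value (χ p)
          where
          by-value : ∀ v → ⟦ (v ∙ v) ∙ (v ∙ v) ⟧ - ⟦ v ∙ v ⟧ ≈ ι (im v) * θ
          by-value 𝟘  = solve 1 (λ θ → con (+ 0) :- con (+ 0) := con (+ 0) :* θ) ≈-refl θ
          by-value 𝟙  = solve 1 (λ θ → con (+ 1) :- con (+ 1) := con (+ 0) :* θ) ≈-refl θ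
          by-value 𝕨  = solve 1 (λ θ → θ := con (+ 1) :* θ) ≈-refl θ
          by-value 𝕨² = solve 1 (λ ω → ω :* ω :- ω := con (-[1+ 0 ]) :* (ω :- ω :* ω)) ≈-refl ω

  ^p-neg : ∀ x → (- x) ^ᴿ p ≈ - (x ^ᴿ p)
  ^p-neg x = begin
    (- x) ^ᴿ p ≈⟨ solve 2 (λ a b → b := (a :+ b) :- a) ≈-refl (x ^ᴿ p) ((- x) ^ᴿ p) ⟩
    (x ^ᴿ p + (- x) ^ᴿ p) - x ^ᴿ p ≈⟨ +-congʳ (≈-trans (≈-sym (^p-+ x (- x))) (≈-trans (^p-cong (-‿inverseʳ x)) (Frob.^p-0 p·1≈0))) ⟩
    0# - x ^ᴿ p ≈⟨ +-identityˡ _ ⟩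
    - (x ^ᴿ p)  ∎

  private
    -- Frobenius either fixes v and v² or exchanges them.
    fixed₁ : ∀ v → (ι (+ 1) * ⟦ v ⟧ + ι (+ 1) * ⟦ v ∙ v ⟧) ^ᴿ p ≈ ι (+ 1) * ⟦ v ⟧ + ι (+ 1) * ⟦ v ∙ v ⟧
    fixed₁ v = begin
      (ι (+ 1) * ⟦ v ⟧ + ι (+ 1) * ⟦ v ∙ v ⟧) ^ᴿ p ≈⟨ ^p-cong drop ⟩
      (⟦ v ⟧ + ⟦ v ∙ v ⟧) ^ᴿ p ≈⟨ ^p-+ _ _ ⟩
      ⟦ v ⟧ ^ᴿ p + ⟦ v ∙ v ⟧ ^ᴿ p ≈⟨ [ (λ h → +-cong (h v) (h (v ∙ v)))
          , (λ h → ≈-trans (+-cong (h v) (≈-trans (h (v ∙ v)) (reflexive (cong ⟦_⟧ (square-square v))))) (+-comm _ _)) ]′ ^p-value ⟩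
      ⟦ v ⟧ + ⟦ v ∙ v ⟧ ≈⟨ drop ⟨
      ι (+ 1) * ⟦ v ⟧ + ι (+ 1) * ⟦ v ∙ v ⟧  ∎
      where
      drop : ι (+ 1) * ⟦ v ⟧ + ι (+ 1) * ⟦ v ∙ v ⟧ ≈ ⟦ v ⟧ + ⟦ v ∙ v ⟧
      drop = solve 2 (λ a b → con (+ 1) :* a :+ con (+ 1) :* b := a :+ b) ≈-refl ⟦ v ⟧ ⟦ v ∙ v ⟧

    -- When Frobenius exchanges v and v², it also changes the sign of θ, and the two effects cancel.
    fixedθ : ∀ v → (θ * ⟦ v ⟧ + - θ * ⟦ v ∙ v ⟧) ^ᴿ p ≈ θ * ⟦ v ⟧ + - θ * ⟦ v ∙ v ⟧
    fixedθ v = begin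
      (θ * a + - θ * b) ^ᴿ p ≈⟨ ^p-+ _ _ ⟩
      (θ * a) ^ᴿ p + (- θ * b) ^ᴿ p ≈⟨ +-cong (^ᴿ-distrib-* θ a p) (≈-trans (^ᴿ-distrib-* (- θ) b p) (*-congʳ (^p-neg θ))) ⟩
      θ ^ᴿ p * a ^ᴿ p + - (θ ^ᴿ p) * b ^ᴿ p ≈⟨ +-cong (*-congʳ θ^p) (*-congʳ (-‿cong θ^p)) ⟩
      (ω ^ᴿ p - (ω * ω) ^ᴿ p) * a ^ᴿ p + - (ω ^ᴿ p - (ω * ω) ^ᴿ p) * b ^ᴿ p ≈⟨ [ same , swapped ]′ ^p-value ⟩
      θ * a + - θ * b  ∎
      where
      a b : Carrier
      a = ⟦ v ⟧
      b = ⟦ v ∙ v ⟧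
      θ^p : θ ^ᴿ p ≈ ω ^ᴿ p - (ω * ω) ^ᴿ p
      θ^p = ≈-trans (^p-+ ω (- (ω * ω))) (+-congˡ (^p-neg (ω * ω)))
      combine : ∀ {x x′ z z′ a′ b′} → x ≈ x′ → z ≈ z′ → a ^ᴿ p ≈ a′ → b ^ᴿ p ≈ b′ →
          (x - z) * a ^ᴿ p + - (x - z) * b ^ᴿ p ≈ (x′ - z′) * a′ + - (x′ - z′) * b′
      combine x≈ z≈ a≈ b≈ = +-cong (*-cong (+-cong x≈ (-‿cong z≈)) a≈) (*-cong (-‿cong (+-cong x≈ (-‿cong z≈))) b≈)
      same : (∀ v → ⟦ v ⟧ ^ᴿ p ≈ ⟦ v ⟧) → _
      same h = combine (h 𝕨) (h 𝕨²) (h v) (h (v ∙ v))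
      swapped : (∀ v → ⟦ v ⟧ ^ᴿ p ≈ ⟦ v ∙ v ⟧) → _
      swapped h = ≈-trans (combine (h 𝕨) (h 𝕨²) (h v) (≈-trans (h (v ∙ v)) (reflexive (cong ⟦_⟧ (square-square v)))))
        (solve 4 (λ x z a b → (z :- x) :* b :+ :- (z :- x) :* a := (x :- z) :* a :+ :- (x :- z) :* b) ≈-refl ω (ω * ω) a b)

    ι-2A-B : ι (+ 2 ℤ.* A ℤ.- B) ≈ ι (+ 2) * ι A - ι B
    ι-2A-B = ≈-trans (+-homo (+ 2 ℤ.* A) (ℤ.- B)) (+-cong (*-homo (+ 2) A) (-‿homo B))

  -- The cubic of X = G and Y = G′, where J + J′ = 2A - B and J - J′ = B θ.
  leading-q : Regular p (+ q) →
    leading (+ 3 ℤ.* + q) (+ q ℤ.* (+ 2 ℤ.* A ℤ.- B)) p ℤ.* B ≡ im (χ p) [modℤ p ]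
  leading-q regq = leading-p (ι (+ 1)) (ι (+ 1)) fixed₁ (+ q) (+ 2 ℤ.* A ℤ.- B) B J J′ regq
    (≈-trans (solve 2 (λ g g′ → con (+ 1) :* g :* (con (+ 1) :* g′) := g :* g′) ≈-refl G G′) G*G′≈q)
    (≈-trans (solve 1 (λ g → con (+ 1) :* g :* (con (+ 1) :* g) := g :* g) ≈-refl G)
      (≈-trans G²≈JG′ (solve 2 (λ j g → j :* g := j :* (con (+ 1) :* g)) ≈-refl J G′)))
    (≈-trans (solve 1 (λ g → con (+ 1) :* g :* (con (+ 1) :* g) := g :* g) ≈-refl G′)
      (≈-trans G′²≈J′G (solve 2 (λ j g → j :* g := j :* (con (+ 1) :* g)) ≈-refl J′ G)))
    (≈-trans (modΦ ω ω-root (ι B) (solve 3 (λ a b ω → a :+ b :* ω :+ (a :+ b :* (ω :* ω)) :=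
        con (+ 2) :* a :- b :+ (ω :* ω :+ ω :+ con (+ 1)) :* b) ≈-refl (ι A) (ι B) ω)) (≈-sym ι-2A-B))
    (solve 3 (λ a b ω → a :+ b :* ω :- (a :+ b :* (ω :* ω)) := b :* (ω :- ω :* ω)) ≈-refl (ι A) (ι B) ω)

  -- The cubic of X = θ G and Y = -θ G′. Since θ² = -3, the product XY is 3q, and the sum and
  -- difference of the Jacobi factors -θ J and θ J′ exchange the roles of B and 2A - B.
  leading-3q : Regular p (+ 3 ℤ.* + q) →
    leading (+ 3 ℤ.* (+ 3 ℤ.* + q)) (+ 3 ℤ.* + q ℤ.* (+ 3 ℤ.* B)) p ℤ.* (ℤ.- (+ 2 ℤ.* A ℤ.- B)) ≡ im (χ p) [modℤ p ]
  leading-3q reg3q = leading-p θ (- θ) fixedθ (+ 3 ℤ.* + q) (+ 3 ℤ.* B) (ℤ.- (+ 2 ℤ.* A ℤ.- B)) (- θ * J) (θ * J′) reg3q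
    (begin
      θ * G * (- θ * G′) ≈⟨ solve 3 (λ t g g′ → t :* g :* (:- t :* g′) := :- (t :* t) :* (g :* g′)) ≈-refl θ G G′ ⟩
      - (θ * θ) * (G * G′) ≈⟨ *-cong (-‿cong θ²≈-3) G*G′≈q ⟩
      - ι (-[1+ 2 ]) * ι (+ q) ≈⟨ solve 1 (λ q → :- con (-[1+ 2 ]) :* q := con (+ 3) :* q) ≈-refl (ι (+ q)) ⟩
      ι (+ 3) * ι (+ q) ≈⟨ *-homo (+ 3) (+ q) ⟨
      ι (+ 3 ℤ.* + q)  ∎)
    (≈-trans (solve 2 (λ t g → t :* g :* (t :* g) := t :* t :* (g :* g)) ≈-refl θ G)
      (≈-trans (*-congˡ G²≈JG′) (solve 3 (λ t j g → t :* t :* (j :* g) := :- t :* j :* (:- t :* g)) ≈-refl θ J G′)))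
    (≈-trans (solve 2 (λ t g → :- t :* g :* (:- t :* g) := t :* t :* (g :* g)) ≈-refl θ G′)
      (≈-trans (*-congˡ G′²≈J′G) (solve 3 (λ t j g → t :* t :* (j :* g) := t :* j :* (t :* g)) ≈-refl θ J′ G)))
    (begin
      - θ * J + θ * J′ ≈⟨ solve 3 (λ a b ω → :- (ω :- ω :* ω) :* (a :+ b :* ω) :+ (ω :- ω :* ω) :* (a :+ b :* (ω :* ω)) :=
          :- ((ω :- ω :* ω) :* (ω :- ω :* ω)) :* b) ≈-refl (ι A) (ι B) ω ⟩
      - (θ * θ) * ι B ≈⟨ *-congʳ (-‿cong θ²≈-3) ⟩
      - ι (-[1+ 2 ]) * ι B ≈⟨ solve 1 (λ q → :- con (-[1+ 2 ]) :* q := con (+ 3) :* q) ≈-refl (ι B) ⟩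
      ι (+ 3) * ι B ≈⟨ *-homo (+ 3) B ⟨
      ι (+ 3 ℤ.* B)  ∎)
    (begin
      - θ * J - θ * J′ ≈⟨ modΦ ω ω-root (- (ι B * θ)) (solve 3 (λ a b ω →
                                        :- (ω :- ω :* ω) :* (a :+ b :* ω) :- (ω :- ω :* ω) :* (a :+ b :* (ω :* ω)) :=
                                        :- (con (+ 2) :* a :- b) :* (ω :- ω :* ω) :+ (ω :* ω :+ ω :+ con (+ 1)) :* (:- (b :* (ω :- ω :* ω))))
                                        ≈-refl (ι A) (ι B) ω) ⟩
      - (ι (+ 2) * ι A - ι B) * θ ≈⟨ *-congʳ (≈-trans (-‿homo (+ 2 ℤ.* A ℤ.- B)) (-‿cong ι-2A-B)) ⟨
      ι (ℤ.- (+ 2 ℤ.* A ℤ.- B)) * θ ∎)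
    where
    θ²≈-3 : θ * θ ≈ ι (-[1+ 2 ])
    θ²≈-3 = modΦ ω ω-root (ω * ω - ι (+ 3) * ω + ι (+ 3)) (solve 1 (λ ω → (ω :- ω :* ω) :* (ω :- ω :* ω) :=
      con (-[1+ 2 ]) :+ (ω :* ω :+ ω :+ con (+ 1)) :* (ω :* ω :- con (+ 3) :* ω :+ con (+ 3))) ≈-refl ω)

-- Binomial coefficients modulo p

nC0≡1 : ∀ n → n C 0 ≡ 1
nC0≡1 n = trans (nCk≡nC[n∸k] {0} {n} ℕ.z≤n) (nCn≡1 n)

pascal : ∀ n k → + (suc n C suc k) ≡ + (n C k) ℤ.+ + (n C suc k)
pascal n k = trans (cong +_ (sym (nCk+nC[k+1]≡[n+1]C[k+1] n k))) (ℤ.pos-+ (n C k) (n C suc k))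

module BinomialsMod {p : ℕ} (pr : Prime p) where
  open import Data.Integer using (_+_; _*_; _-_; -_)
  open PrimeModulus pr
  open Fermat pr
  private
    module Z = CommutativeRing (ℤmod p)
  open SetoidReasoning Z.setoid

  -- Below degree p, (1+x)^(p+m) agrees modulo p with (1+x)^m; the induction on m is Pascal's rule.
  [p+m]Ck≡mCk : ∀ m k → k ℕ.< p → + ((p ℕ.+ m) C k) ≡ + (m C k) [modℤ p ]
  [p+m]Ck≡mCk m zero k<p = ≡⇒≡mod (cong +_ (trans (nC0≡1 (p ℕ.+ m)) (sym (nC0≡1 m))))
  [p+m]Ck≡mCk zero (suc k) k<p = begin
    + ((p ℕ.+ 0) C suc k) ≡⟨ cong (λ n → + (n C suc k)) (ℕ.+-identityʳ p) ⟩
    + (p C suc k) ≈⟨ ∣⇒≡0 (prime∣C pr (suc k) ℕ.z<s k<p) ⟩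
    + 0 ≡⟨ cong +_ (k>n⇒nCk≡0 {0} {suc k} ℕ.z<s) ⟨
    + (0 C suc k)  ∎
  [p+m]Ck≡mCk (suc m) (suc k) k<p = begin
    + ((p ℕ.+ suc m) C suc k) ≡⟨ cong (λ n → + (n C suc k)) (ℕ.+-suc p m) ⟩
    + (suc (p ℕ.+ m) C suc k) ≡⟨ pascal (p ℕ.+ m) k ⟩
    + ((p ℕ.+ m) C k) + + ((p ℕ.+ m) C suc k) ≈⟨ +-≡mod ([p+m]Ck≡mCk m k (ℕ.<-trans (ℕ.n<1+n k) k<p)) ([p+m]Ck≡mCk m (suc k) k<p) ⟩
    + (m C k) + + (m C suc k) ≡⟨ pascal m k ⟨
    + (suc m C suc k)  ∎

  sign : ℕ → ℤ
  sign zero    = + 1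
  sign (suc j) = - sign j

  -- Upper negation: the left side is (-1)^j times the binomial coefficient with upper entry -k-1,
  -- and -k-1 ≡ r modulo p.
  [k+j]Cj≡±rCj : ∀ r k → suc (k ℕ.+ r) ≡ p → ∀ j → j ℕ.< p → + ((k ℕ.+ j) C j) ≡ sign j * + (r C j) [modℤ p ]
  [k+j]Cj≡±rCj r k eq zero j<p = ≡⇒≡mod (trans (cong +_ (nC0≡1 (k ℕ.+ 0))) (sym (cong (λ c → + 1 * + c) (nC0≡1 r))))
  [k+j]Cj≡±rCj zero k eq (suc j) j<p = begin
    + ((k ℕ.+ suc j) C suc j) ≡⟨ cong (λ n → + (n C suc j)) (trans (ℕ.+-suc k j) (cong (ℕ._+ j) (trans (cong suc (sym (ℕ.+-identityʳ k))) eq))) ⟩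
    + ((p ℕ.+ j) C suc j) ≈⟨ [p+m]Ck≡mCk j (suc j) j<p ⟩
    + (j C suc j) ≡⟨ cong +_ (k>n⇒nCk≡0 (ℕ.n<1+n j)) ⟩
    + 0 ≡⟨ ℤ.*-zeroʳ (sign (suc j)) ⟨
    sign (suc j) * + 0 ≡⟨ cong (λ c → sign (suc j) * + c) (k>n⇒nCk≡0 {0} {suc j} ℕ.z<s) ⟨
    sign (suc j) * + (0 C suc j)  ∎
  [k+j]Cj≡±rCj (suc r) k eq (suc j) j<p = begin
    + ((k ℕ.+ suc j) C suc j) ≡⟨ lemma₁ (+ ((k ℕ.+ suc j) C suc j)) (+ ((k ℕ.+ suc j) C j)) ⟩
    (+ ((k ℕ.+ suc j) C j) + + ((k ℕ.+ suc j) C suc j)) - + ((k ℕ.+ suc j) C j)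
      ≡⟨ cong (λ x → x - + ((k ℕ.+ suc j) C j)) (pascal (k ℕ.+ suc j) j) ⟨
    + ((suc k ℕ.+ suc j) C suc j) - + ((k ℕ.+ suc j) C j)
      ≡⟨ cong (λ n → + ((suc k ℕ.+ suc j) C suc j) - + (n C j)) (ℕ.+-suc k j) ⟩
    + ((suc k ℕ.+ suc j) C suc j) - + ((suc k ℕ.+ j) C j)
      ≈⟨ +-≡mod ([k+j]Cj≡±rCj r (suc k) eq′ (suc j) j<p) (neg-≡mod ([k+j]Cj≡±rCj r (suc k) eq′ j (ℕ.<-trans (ℕ.n<1+n j) j<p))) ⟩
    sign (suc j) * + (r C suc j) - sign j * + (r C j)
      ≡⟨ lemma₂ (sign j) (+ (r C suc j)) (+ (r C j)) ⟩
    sign (suc j) * (+ (r C j) + + (r C suc j))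
      ≡⟨ cong (λ x → sign (suc j) * x) (pascal r j) ⟨
    sign (suc j) * + (suc r C suc j) ∎
    where
    eq′ : suc (suc k ℕ.+ r) ≡ p
    eq′ = trans (cong suc (sym (ℕ.+-suc k r))) eq
    lemma₁ : ∀ x y → x ≡ (y + x) - y
    lemma₁ = solve-∀
    lemma₂ : ∀ s x y → - s * x - s * y ≡ - s * (y + x)
    lemma₂ = solve-∀

  sign-odd : ∀ i → sign (suc (i ℕ.+ i)) ≡ - + 1
  sign-odd zero    = refl
  sign-odd (suc i) = trans (cong (λ n → - - sign n) (ℕ.+-suc i i)) (trans (ℤ.neg-involutive _) (sign-odd i))

  -- Here k = p - 1 - r lies in the upper range p < 2k, and 2i + 1 = 2k - p.
  C[3k,k] : ∀ r i k → p ≡ 3 ℕ.+ (r ℕ.+ r ℕ.+ (i ℕ.+ i)) → k ≡ 2 ℕ.+ (r ℕ.+ (i ℕ.+ i)) →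
      + ((3 ℕ.* k) C k) ≡ - + (r C suc (i ℕ.+ i)) [modℤ p ]
  C[3k,k] r i k p≡ k≡ = begin
    + ((3 ℕ.* k) C k) ≡⟨ cong (λ n → + (n C k)) 3k≡ ⟩
    + ((p ℕ.+ (k ℕ.+ j)) C k) ≈⟨ [p+m]Ck≡mCk (k ℕ.+ j) k k<p ⟩
    + ((k ℕ.+ j) C k) ≡⟨ cong +_ (trans (nCk≡nC[n∸k] (ℕ.m≤m+n k j)) (cong ((k ℕ.+ j) C_) (ℕ.m+n∸m≡n k j))) ⟩
    + ((k ℕ.+ j) C j) ≈⟨ [k+j]Cj≡±rCj r k suc[k+r]≡p j (ℕ.<-trans j<k k<p) ⟩
    sign j * + (r C j) ≡⟨ cong (λ s → s * + (r C j)) (sign-odd i) ⟩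
    - + 1 * + (r C j) ≡⟨ ℤ.-1*i≡-i (+ (r C j)) ⟩
    - + (r C j)  ∎
    where
    j : ℕ
    j = suc (i ℕ.+ i)
    3k≡ : 3 ℕ.* k ≡ p ℕ.+ (k ℕ.+ j)
    3k≡ = subst (λ k → 3 ℕ.* k ≡ p ℕ.+ (k ℕ.+ j)) (sym k≡) (subst (λ p → 3 ℕ.* (2 ℕ.+ (r ℕ.+ (i ℕ.+ i))) ≡ p ℕ.+ (2 ℕ.+ (r ℕ.+ (i ℕ.+ i)) ℕ.+ j)) (sym p≡) (lemma r i))
      where
      lemma : ∀ r i → 3 ℕ.* (2 ℕ.+ (r ℕ.+ (i ℕ.+ i))) ≡ 3 ℕ.+ (r ℕ.+ r ℕ.+ (i ℕ.+ i)) ℕ.+ (2 ℕ.+ (r ℕ.+ (i ℕ.+ i)) ℕ.+ suc (i ℕ.+ i))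
      lemma = ℕSolver.solve-∀
    suc[k+r]≡p : suc (k ℕ.+ r) ≡ p
    suc[k+r]≡p = trans (cong (λ k → suc (k ℕ.+ r)) k≡) (trans (lemma r i) (sym p≡))
      where
      lemma : ∀ r i → suc (2 ℕ.+ (r ℕ.+ (i ℕ.+ i)) ℕ.+ r) ≡ 3 ℕ.+ (r ℕ.+ r ℕ.+ (i ℕ.+ i))
      lemma = ℕSolver.solve-∀
    k<p : k ℕ.< p
    k<p = subst (k ℕ.<_) suc[k+r]≡p (ℕ.s≤s (ℕ.m≤m+n k r))
    j<k : j ℕ.< k
    j<k = subst (j ℕ.<_) (sym k≡) (ℕ.s≤s (ℕ.s≤s (ℕ.m≤n+m (i ℕ.+ i) r)))

-- The leading coefficient as a coefficient of a geometric series

delay : (ℕ → ℤ) → ℕ → ℤ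
delay f zero    = + 0
delay f (suc n) = f n

module Expansion (a b : ℤ) where
  open import Data.Integer using (_+_; _*_; _-_; -_)

  -- The coefficient of tⁿ in (a t² + b t³)ⁱ.
  coeff : ℕ → ℕ → ℤ
  coeff zero    zero          = + 1
  coeff zero    (suc n)       = + 0
  coeff (suc i) zero          = + 0
  coeff (suc i) (suc zero)    = + 0
  coeff (suc i) (suc (suc n)) = a * coeff i n + b * delay (coeff i) n

  partialSum : ℕ → ℕ → ℤ
  partialSum zero    n = + 0
  partialSum (suc N) n = partialSum N n + coeff N n

  private
    a*0+b*0≡0 : a * + 0 + b * + 0 ≡ + 0
    a*0+b*0≡0 = lemma a b
      where
      lemma : ∀ a b → a * + 0 + b * + 0 ≡ + 0
      lemma = solve-∀

  -- With u = a t² + b t³, this is 1 + u + ... + u^N = 1 + u (1 + ... + u^(N-1)) in degrees at least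
  -- 2.
  partialSum-suc : ∀ N n → partialSum (suc N) (2 ℕ.+ n) ≡ a * partialSum N n + b * delay (partialSum N) n
  partialSum-suc zero    zero    = sym a*0+b*0≡0
  partialSum-suc zero    (suc n) = sym a*0+b*0≡0
  partialSum-suc (suc N) zero    = trans (cong (λ x → x + coeff (suc N) 2) (partialSum-suc N 0)) (lemma a b (partialSum N 0) (coeff N 0))
    where
    lemma : ∀ a b x y → a * x + b * + 0 + (a * y + b * + 0) ≡ a * (x + y) + b * + 0
    lemma = solve-∀
  partialSum-suc (suc N) (suc n) = trans (cong (λ x → x + coeff (suc N) (3 ℕ.+ n)) (partialSum-suc N (suc n)))
      (lemma a b (partialSum N (suc n)) (partialSum N n) (coeff N (suc n)) (coeff N n))
    where
    lemma : ∀ a b x y x′ y′ → a * x + b * y + (a * x′ + b * y′) ≡ a * (x + x′) + b * (y + y′)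
    lemma = solve-∀

  partialSum-0 : ∀ N → partialSum (suc N) 0 ≡ + 1
  partialSum-0 zero    = refl
  partialSum-0 (suc N) = cong (λ x → x + + 0) (partialSum-0 N)

  partialSum-1 : ∀ N → partialSum N 1 ≡ + 0
  partialSum-1 zero          = refl
  partialSum-1 (suc zero)    = refl
  partialSum-1 (suc (suc N)) = cong (λ x → x + + 0) (partialSum-1 (suc N))

  -- The generating function of the leading coefficients from index 2 on is 1 / (1 - a t² - b t³).
  -- Truncating its geometric series after N > n terms does not affect degree n.
  partialSum≡leading : ∀ N n → n ℕ.< N → partialSum N n ≡ leading a b (2 ℕ.+ n)
  partialSum≡leading (suc N) zero _ = partialSum-0 N
  partialSum≡leading (suc N) (suc zero) _ = trans (partialSum-1 (suc N)) (sym a*0+b*0≡0)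
  partialSum≡leading (suc N) (suc (suc zero)) (ℕ.s≤s n<N) = trans (partialSum-suc N 0)
    (cong (λ x → a * x + b * + 0) (partialSum≡leading N 0 (ℕ.<-trans ℕ.z<s n<N)))
  partialSum≡leading (suc N) (suc (suc (suc n))) (ℕ.s≤s n<N) = trans (partialSum-suc N (suc n))
    (cong₂ (λ x y → a * x + b * y) (partialSum≡leading N (suc n) (ℕ.<-trans (ℕ.n<1+n _) n<N))
      (partialSum≡leading N n (ℕ.<-trans (ℕ.n<1+n _) (ℕ.<-trans (ℕ.n<1+n _) n<N))))

  coeff-below : ∀ i n → n ℕ.< i ℕ.+ i → coeff i n ≡ + 0
  coeff-below (suc i) zero          _  = refl
  coeff-below (suc i) (suc zero)    _  = refl
  coeff-below (suc i) (suc (suc n)) lt = trans (cong₂ (λ x y → a * x + b * y) (coeff-below i n n<) (delayed n n<)) a*0+b*0≡0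
    where
    n< : n ℕ.< i ℕ.+ i
    n< = ℕ.s≤s⁻¹ (ℕ.s≤s⁻¹ (subst (suc (suc (suc n)) ℕ.≤_) (cong suc (ℕ.+-suc i i)) lt))
    delayed : ∀ n → n ℕ.< i ℕ.+ i → delay (coeff i) n ≡ + 0
    delayed zero    _  = refl
    delayed (suc n) lt = coeff-below i n (ℕ.<-trans (ℕ.n<1+n n) lt)

  coeff-above : ∀ i n → 3 ℕ.* i ℕ.< n → coeff i n ≡ + 0
  coeff-above zero    (suc n) _ = refl
  coeff-above (suc i) zero ()
  coeff-above (suc i) (suc zero) _ = refl
  coeff-above (suc i) (suc (suc zero)) lt = ⊥-elim (ℕ.<⇒≱ lt (ℕ.≤-trans (ℕ.s≤s ℕ.z<s) (ℕ.*-monoʳ-≤ 3 (ℕ.s≤s (ℕ.z≤n {i})))))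
  coeff-above (suc i) (suc (suc (suc n))) lt = trans (cong₂ (λ x y → a * x + b * y) (coeff-above i (suc n) (ℕ.<-trans n< (ℕ.n<1+n n))) (coeff-above i n n<)) a*0+b*0≡0
    where
    n< : 3 ℕ.* i ℕ.< n
    n< = ℕ.s≤s⁻¹ (ℕ.s≤s⁻¹ (ℕ.s≤s⁻¹ (subst (ℕ._≤ suc (suc (suc n))) (cong suc (ℕ.*-suc 3 i)) lt)))

  -- The binomial theorem for t^(2i) (a + b t)^i. The factor a^j avoids the exponent i - j and also
  -- covers j > i, where both sides are 0.
  coeff-binomial : ∀ i j → a ℤ.^ j * coeff i (i ℕ.+ i ℕ.+ j) ≡ + (i C j) * (a ℤ.^ i * b ℤ.^ j)
  coeff-binomial zero zero = refl
  coeff-binomial zero (suc j) = trans (ℤ.*-zeroʳ (a ℤ.^ suc j)) (sym (trans (cong (λ c → + c * (+ 1 * b ℤ.^ suc j)) (k>n⇒nCk≡0 {0} {suc j} ℕ.z<s)) (ℤ.*-zeroˡ (+ 1 * b ℤ.^ suc j))))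
  coeff-binomial (suc i) zero = begin
    + 1 * coeff (suc i) (suc i ℕ.+ suc i ℕ.+ 0) ≡⟨ cong (λ n → + 1 * coeff (suc i) n) (cong suc (cong (ℕ._+ 0) (ℕ.+-suc i i))) ⟩
    + 1 * (a * coeff i (i ℕ.+ i ℕ.+ 0) + b * delay (coeff i) (i ℕ.+ i ℕ.+ 0))
      ≡⟨ cong₂ (λ x y → + 1 * (a * x + b * y)) (trans (sym (ℤ.*-identityˡ _)) (coeff-binomial i 0)) (trans (cong (delay (coeff i)) (ℕ.+-identityʳ (i ℕ.+ i))) (delay-0 i)) ⟩
    + 1 * (a * (+ (i C 0) * (a ℤ.^ i * + 1)) + b * + 0) ≡⟨ lemma a b (+ (i C 0)) (a ℤ.^ i) ⟩
    + (i C 0) * (a ℤ.^ suc i * + 1) ≡⟨ cong (λ c → + c * (a ℤ.^ suc i * + 1)) (trans (nC0≡1 i) (sym (nC0≡1 (suc i)))) ⟩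
    + (suc i C 0) * (a ℤ.^ suc i * + 1)  ∎
    where
    open ≡-Reasoning
    lemma : ∀ a b c x → + 1 * (a * (c * (x * + 1)) + b * + 0) ≡ c * (a * x * + 1)
    lemma = solve-∀
    delay-0 : ∀ i → delay (coeff i) (i ℕ.+ i) ≡ + 0
    delay-0 zero    = refl
    delay-0 (suc i) = coeff-below (suc i) (i ℕ.+ suc i) (ℕ.n<1+n _)
  coeff-binomial (suc i) (suc j) = begin
    a ℤ.^ suc j * coeff (suc i) (suc i ℕ.+ suc i ℕ.+ suc j)
      ≡⟨ cong (λ n → a ℤ.^ suc j * coeff (suc i) n) (cong suc (cong (ℕ._+ suc j) (ℕ.+-suc i i))) ⟩
    a ℤ.^ suc j * (a * coeff i (i ℕ.+ i ℕ.+ suc j) + b * delay (coeff i) (i ℕ.+ i ℕ.+ suc j))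
      ≡⟨ cong (λ n → a ℤ.^ suc j * (a * coeff i (i ℕ.+ i ℕ.+ suc j) + b * delay (coeff i) n)) (ℕ.+-suc (i ℕ.+ i) j) ⟩
    a ℤ.^ suc j * (a * x + b * y) ≡⟨ lemma₁ a b (a ℤ.^ j) x y ⟩
    a * (a ℤ.^ suc j * x) + a * b * (a ℤ.^ j * y) ≡⟨ cong₂ (λ x y → a * x + a * b * y) (coeff-binomial i (suc j)) (coeff-binomial i j) ⟩
    a * (+ (i C suc j) * (a ℤ.^ i * b ℤ.^ suc j)) + a * b * (+ (i C j) * (a ℤ.^ i * b ℤ.^ j))
      ≡⟨ lemma₂ a b (+ (i C suc j)) (+ (i C j)) (a ℤ.^ i) (b ℤ.^ j) ⟩
    (+ (i C j) + + (i C suc j)) * (a ℤ.^ suc i * b ℤ.^ suc j) ≡⟨ cong (λ c → c * (a ℤ.^ suc i * b ℤ.^ suc j)) (pascal i j) ⟨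
    + (suc i C suc j) * (a ℤ.^ suc i * b ℤ.^ suc j)  ∎
    where
    open ≡-Reasoning
    x y : ℤ
    x = coeff i (i ℕ.+ i ℕ.+ suc j)
    y = coeff i (i ℕ.+ i ℕ.+ j)
    lemma₁ : ∀ a b c x y → a * c * (a * x + b * y) ≡ a * (a * c * x) + a * b * (c * y)
    lemma₁ = solve-∀
    lemma₂ : ∀ a b c d x y → a * (c * (x * (b * y))) + a * b * (d * (x * y)) ≡ (d + c) * (a * x * (b * y))
    lemma₂ = solve-∀

sumℤ : (ℕ → ℤ) → ℕ → ℕ → ℤ
sumℤ f zero    k = + 0
sumℤ f (suc c) k = f k ℤ.+ sumℤ f c (suc k)

odd-prime : ∀ {p} → Prime p → p ≢ 2 → ∃ λ h → p ≡ suc (h ℕ.+ h)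
odd-prime {p} pr p≢2 = go (p ℕ.% 2) (ℕ.m%n<n p 2) refl
  where
  lemma : ∀ h → 1 ℕ.+ h ℕ.* 2 ≡ suc (h ℕ.+ h)
  lemma = ℕSolver.solve-∀
  go : ∀ r → r ℕ.< 2 → p ℕ.% 2 ≡ r → ∃ λ h → p ≡ suc (h ℕ.+ h)
  go 0 _ eq = [ (λ ()) , (λ 2≡p → ⊥-elim (p≢2 (sym 2≡p))) ]′ (prime⇒irreducible pr (ℕ.m%n≡0⇒n∣m p 2 eq))
  go 1 _ eq = p / 2 , trans (ℕ.m≡m%n+[m/n]*n p 2) (trans (cong (ℕ._+ p / 2 ℕ.* 2) eq) (lemma (p / 2)))
  go (suc (suc _)) (ℕ.s≤s (ℕ.s≤s ())) _

-- The sum over the upper range as a leading coefficient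

module UpperSum {p : ℕ} (pr : Prime p) (p≢2 : p ≢ 2) (p≢3 : p ≢ 3)
    (n ℓ : ℤ) (n≢0 : ¬ n ≡ + 0 [modℤ p ]) where
  open import Data.Integer using (_+_; _*_; _-_; -_)
  open PrimeModulus pr
  open Fermat pr
  open BinomialsMod pr
  open Expansion (+ 3 * n) (n * ℓ)
  private
    module Z = CommutativeRing (ℤmod p)
  open SetoidReasoning Z.setoid

  -- An integer congruent to the binomial coefficient times (ℓ²/27n)^k: the factor (27n)^(p-1-k)
  -- represents the inverse of (27n)^k.
  summand : ℕ → ℤ
  summand k = + ((3 ℕ.* k) C k) * ℓ ℤ.^ (2 ℕ.* k) * (+ 27 * n) ℤ.^ (p ∸ 1 ∸ k)

  3≢0 : ¬ + 3 ≡ + 0 [modℤ p ]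
  3≢0 = prime≢⇒≢0 prime3 p≢3
    where
    prime3 : Prime 3
    prime3 = from-yes (prime? 3)

  private
    h : ℕ
    h = proj₁ (odd-prime pr p≢2)
    p≡ : p ≡ suc (h ℕ.+ h)
    p≡ = proj₂ (odd-prime pr p≢2)
    k₁ : ℕ
    k₁ = 2 ℕ.* p / 3
    m : ℕ
    m = p ∸ 2
    p≡2+m : p ≡ 2 ℕ.+ m
    p≡2+m = sym (ℕ.m+[n∸m]≡n (prime>1 pr))

    27^r : ∀ r → (+ 27) ℤ.^ r ≡ (+ 3) ℤ.^ r * ((+ 3) ℤ.^ r * (+ 3) ℤ.^ r)
    27^r r = trans (ℤ^-distrib-* (+ 3) (+ 9) r) (cong (λ x → (+ 3) ℤ.^ r * x) (ℤ^-distrib-* (+ 3) (+ 3) r))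

  -- Here r = p-1-k and j = 2k-p, so 2r + j = p-2 is the degree that yields the leading coefficient
  -- of y^p. Fermat reduces ℓ^(2k) = ℓ^(p+j) to ℓ ℓ^j, and the extra factor 3 completes 3^(j+2r) to
  -- 3^(p-1).
  summand≡coeff : ∀ r i k → p ≡ 3 ℕ.+ (r ℕ.+ r ℕ.+ (i ℕ.+ i)) → k ≡ 2 ℕ.+ (r ℕ.+ (i ℕ.+ i)) →
      + 3 * summand k ≡ - ℓ * coeff r m [modℤ p ]
  summand≡coeff r i k p≡′ k≡ = *-cancelˡ (a ℤ.^ j) (^-≢0 j (*-≢0 3≢0 n≢0)) (begin
    a ℤ.^ j * (+ 3 * summand k)
      ≡⟨ cong₂ (λ x y → x * (+ 3 * (+ ((3 ℕ.* k) C k) * ℓ ℤ.^ (2 ℕ.* k) * y))) (ℤ^-distrib-* (+ 3) n j) power-27n ⟩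
    3ʲ * nʲ * (+ 3 * (+ ((3 ℕ.* k) C k) * ℓ ℤ.^ (2 ℕ.* k) * (t * (t * t) * nʳ)))
      ≈⟨ *-≡modˡ (3ʲ * nʲ) (*-≡modˡ (+ 3) (*-≡modʳ (t * (t * t) * nʳ) (*-≡mod (C[3k,k] r i k p≡′ k≡) power-ℓ))) ⟩
    3ʲ * nʲ * (+ 3 * (- c * (ℓ * ℓʲ) * (t * (t * t) * nʳ)))
      ≡⟨ lemma₁ 3ʲ nʲ c ℓ ℓʲ t nʳ ⟩
    (+ 3 * (3ʲ * (t * t))) * (- ℓ * (c * (t * nʳ * (nʲ * ℓʲ))))
      ≈⟨ *-≡modʳ (- ℓ * (c * (t * nʳ * (nʲ * ℓʲ)))) 3^[p-1]≡1 ⟩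
    + 1 * (- ℓ * (c * (t * nʳ * (nʲ * ℓʲ))))
      ≡⟨ ℤ.*-identityˡ _ ⟩
    - ℓ * (c * (t * nʳ * (nʲ * ℓʲ)))
      ≡⟨ cong₂ (λ x y → - ℓ * (c * (x * y))) (ℤ^-distrib-* (+ 3) n r) (ℤ^-distrib-* n ℓ j) ⟨
    - ℓ * (c * (a ℤ.^ r * (n * ℓ) ℤ.^ j))
      ≡⟨ cong (λ x → - ℓ * x) (coeff-binomial r j) ⟨
    - ℓ * (a ℤ.^ j * coeff r (r ℕ.+ r ℕ.+ j))
      ≡⟨ cong (λ x → - ℓ * (a ℤ.^ j * coeff r x)) index ⟩
    - ℓ * (a ℤ.^ j * coeff r m)
      ≡⟨ lemma₂ (- ℓ) (a ℤ.^ j) (coeff r m) ⟩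
    a ℤ.^ j * (- ℓ * coeff r m) ∎)
    where
    j : ℕ
    j = suc (i ℕ.+ i)
    a c t 3ʲ nʲ ℓʲ nʳ : ℤ
    a = + 3 * n
    c = + (r C j)
    t = (+ 3) ℤ.^ r
    3ʲ = (+ 3) ℤ.^ j
    nʲ = n ℤ.^ j
    ℓʲ = ℓ ℤ.^ j
    nʳ = n ℤ.^ r
    lemma₁ : ∀ x y c ℓ z t u → x * y * (+ 3 * (- c * (ℓ * z) * (t * (t * t) * u))) ≡
        (+ 3 * (x * (t * t))) * (- ℓ * (c * (t * u * (y * z))))
    lemma₁ = solve-∀
    lemma₂ : ∀ x y z → x * (y * z) ≡ y * (x * z)
    lemma₂ = solve-∀
    index : r ℕ.+ r ℕ.+ j ≡ m
    index = trans (ℕ.+-suc (r ℕ.+ r) (i ℕ.+ i)) (sym (cong (_∸ 2) p≡′))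
    exponent : p ∸ 1 ∸ k ≡ r
    exponent = trans (cong₂ (λ p k → p ∸ 1 ∸ k) (trans p≡′ (ℕlemma r i)) k≡) (ℕ.m+n∸m≡n (2 ℕ.+ (r ℕ.+ (i ℕ.+ i))) r)
      where
      ℕlemma : ∀ r i → 3 ℕ.+ (r ℕ.+ r ℕ.+ (i ℕ.+ i)) ≡ suc (2 ℕ.+ (r ℕ.+ (i ℕ.+ i)) ℕ.+ r)
      ℕlemma = ℕSolver.solve-∀
    power-27n : (+ 27 * n) ℤ.^ (p ∸ 1 ∸ k) ≡ t * (t * t) * nʳ
    power-27n = trans (cong ((+ 27 * n) ℤ.^_) exponent) (trans (ℤ^-distrib-* (+ 27) n r) (cong (λ x → x * nʳ) (27^r r)))
    2k≡p+j : 2 ℕ.* k ≡ p ℕ.+ j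
    2k≡p+j = trans (cong (2 ℕ.*_) k≡) (trans (ℕlemma r i) (cong (ℕ._+ j) (sym p≡′)))
      where
      ℕlemma : ∀ r i → 2 ℕ.* (2 ℕ.+ (r ℕ.+ (i ℕ.+ i))) ≡ 3 ℕ.+ (r ℕ.+ r ℕ.+ (i ℕ.+ i)) ℕ.+ suc (i ℕ.+ i)
      ℕlemma = ℕSolver.solve-∀
    power-ℓ : ℓ ℤ.^ (2 ℕ.* k) ≡ ℓ * ℓʲ [modℤ p ]
    power-ℓ = Z.trans (≡⇒≡mod (trans (cong (ℓ ℤ.^_) 2k≡p+j) (ℤ.^-distribˡ-+-* ℓ p j))) (*-≡modʳ ℓʲ (x^p≡x ℓ))
    3^[p-1]≡1 : + 3 * (3ʲ * (t * t)) ≡ + 1 [modℤ p ]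
    3^[p-1]≡1 = Z.trans (≡⇒≡mod (trans (cong (λ x → + 3 * x) (trans (cong (λ x → 3ʲ * x) (sym (ℤ.^-distribˡ-+-* (+ 3) r r))) (sym (ℤ.^-distribˡ-+-* (+ 3) j (r ℕ.+ r)))))
      (cong ((+ 3) ℤ.^_) (trans (ℕlemma r i) (cong (_∸ 1) (sym p≡′)))))) (x^[p∸1]≡1 3≢0)
      where
      ℕlemma : ∀ r i → suc (suc (i ℕ.+ i) ℕ.+ (r ℕ.+ r)) ≡ 2 ℕ.+ (r ℕ.+ r ℕ.+ (i ℕ.+ i))
      ℕlemma = ℕSolver.solve-∀

  partialSum-zero : ∀ N → (∀ i → i ℕ.< N → coeff i m ≡ + 0) → partialSum N m ≡ + 0
  partialSum-zero zero    _  = refl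
  partialSum-zero (suc N) ≡0 = cong₂ ℤ._+_ (partialSum-zero N (λ i i<N → ≡0 i (ℕ.m<n⇒m<1+n i<N))) (≡0 N (ℕ.n<1+n N))

  private
    2p<3[1+k₁] : 2 ℕ.* p ℕ.< 3 ℕ.* suc k₁
    2p<3[1+k₁] = subst₂ ℕ._<_ (sym (ℕ.m≡m%n+[m/n]*n (2 ℕ.* p) 3)) (trans (cong (3 ℕ.+_) (ℕ.*-comm k₁ 3)) (sym (ℕ.*-suc 3 k₁)))
      (ℕ.+-monoˡ-< (k₁ ℕ.* 3) (ℕ.m%n<n (2 ℕ.* p) 3))

    3k₁≤2p : 3 ℕ.* k₁ ℕ.≤ 2 ℕ.* p
    3k₁≤2p = subst (ℕ._≤ 2 ℕ.* p) (ℕ.*-comm k₁ 3) (ℕ.m/n*n≤m (2 ℕ.* p) 3)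

    -- As k rises, the exponent r = p-1-k of a t² + b t³ falls, so each summand removes the last
    -- term of the partial sum.
    sums : ∀ c k N → k ℕ.+ N ≡ p → k ℕ.+ c ≡ suc k₁ → suc h ℕ.≤ k →
        + 3 * sumℤ summand c k ≡ - ℓ * partialSum N m [modℤ p ]
    -- Past k = ⌊2p/3⌋ the remaining exponents satisfy 3i < p-2, too small for the degree p-2 to
    -- occur.
    sums zero k N k+N≡p k+c≡ h<k = ≡⇒≡mod (trans (ℤ.*-zeroʳ (+ 3)) (sym (trans
        (cong (λ x → - ℓ * x) (partialSum-zero N (λ i i<N → coeff-above i m (3i<m i i<N)))) (ℤ.*-zeroʳ (- ℓ)))))
      where
      2p<3k : 2 ℕ.* p ℕ.< 3 ℕ.* k
      2p<3k = subst (λ k → 2 ℕ.* p ℕ.< 3 ℕ.* k) (trans (sym k+c≡) (ℕ.+-identityʳ k)) 2p<3[1+k₁]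
      3N<p : 3 ℕ.* N ℕ.< p
      3N<p = ℕ.+-cancelˡ-< (2 ℕ.* p) (3 ℕ.* N) p (ℕ.<-≤-trans (ℕ.+-monoˡ-< (3 ℕ.* N) 2p<3k)
        (ℕ.≤-reflexive (trans (sym (ℕ.*-distribˡ-+ 3 k N)) (trans (cong (3 ℕ.*_) k+N≡p) (ℕlemma p)))))
        where
        ℕlemma : ∀ p → 3 ℕ.* p ≡ 2 ℕ.* p ℕ.+ p
        ℕlemma = ℕSolver.solve-∀
      3i<m : ∀ i → i ℕ.< N → 3 ℕ.* i ℕ.< m
      3i<m i i<N = ℕ.s≤s⁻¹ (ℕ.s≤s⁻¹ (ℕ.≤-trans (ℕ.≤-reflexive (sym (ℕ.*-suc 3 i))) (ℕ.≤-trans (ℕ.*-monoʳ-≤ 3 i<N) (ℕ.≤-trans (ℕ.<⇒≤ 3N<p) (ℕ.≤-reflexive p≡2+m)))))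
    sums (suc c) k zero k+N≡p k+c≡ h<k = ⊥-elim (ℕ.<⇒≱ 2p<3p (ℕ.≤-trans (ℕ.*-monoʳ-≤ 3 p≤k₁) 3k₁≤2p))
      where
      p≤k₁ : p ℕ.≤ k₁
      p≤k₁ = subst (ℕ._≤ k₁) (trans (sym (ℕ.+-identityʳ k)) k+N≡p)
        (subst (k ℕ.≤_) (ℕ.suc-injective (trans (sym (ℕ.+-suc k c)) k+c≡)) (ℕ.m≤m+n k c))
      2p<3p : 2 ℕ.* p ℕ.< 3 ℕ.* p
      2p<3p = ℕ.*-monoˡ-< p {{prime⇒nonZero pr}} (ℕ.n<1+n 2)
    sums (suc c) k (suc r) k+N≡p k+c≡ h<k = begin
      + 3 * (summand k + sumℤ summand c (suc k)) ≡⟨ ℤ.*-distribˡ-+ (+ 3) (summand k) _ ⟩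
      + 3 * summand k + + 3 * sumℤ summand c (suc k)
        ≈⟨ +-≡mod (summand≡coeff r i k p≡′ k≡) (sums c (suc k) r (trans (sym (ℕ.+-suc k r)) k+N≡p) (trans (sym (ℕ.+-suc k c)) k+c≡) (ℕ.m≤n⇒m≤1+n h<k)) ⟩
      - ℓ * coeff r m + - ℓ * partialSum r m ≡⟨ lemma (- ℓ) (coeff r m) (partialSum r m) ⟩
      - ℓ * (partialSum r m + coeff r m)  ∎
      where
      lemma : ∀ l x y → l * x + l * y ≡ l * (y + x)
      lemma = solve-∀
      i : ℕ
      i = k ∸ suc h
      k≡h+i : k ≡ suc h ℕ.+ i
      k≡h+i = sym (ℕ.m+[n∸m]≡n h<k)
      h≡ : h ≡ suc (i ℕ.+ r)
      h≡ = ℕ.+-cancelˡ-≡ (suc h) h (suc (i ℕ.+ r)) (trans (sym p≡) (trans (sym k+N≡p) (trans (cong (ℕ._+ suc r) k≡h+i) (ℕlemma h i r))))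
        where
        ℕlemma : ∀ h i r → suc h ℕ.+ i ℕ.+ suc r ≡ suc h ℕ.+ suc (i ℕ.+ r)
        ℕlemma = ℕSolver.solve-∀
      p≡′ : p ≡ 3 ℕ.+ (r ℕ.+ r ℕ.+ (i ℕ.+ i))
      p≡′ = trans p≡ (trans (cong (λ h → suc (h ℕ.+ h)) h≡) (ℕlemma i r))
        where
        ℕlemma : ∀ i r → suc (suc (i ℕ.+ r) ℕ.+ suc (i ℕ.+ r)) ≡ 3 ℕ.+ (r ℕ.+ r ℕ.+ (i ℕ.+ i))
        ℕlemma = ℕSolver.solve-∀
      k≡ : k ≡ 2 ℕ.+ (r ℕ.+ (i ℕ.+ i))
      k≡ = trans k≡h+i (trans (cong (λ h → suc h ℕ.+ i) h≡) (ℕlemma i r))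
        where
        ℕlemma : ∀ i r → suc (suc (i ℕ.+ r)) ℕ.+ i ≡ 2 ℕ.+ (r ℕ.+ (i ℕ.+ i))
        ℕlemma = ℕSolver.solve-∀

    suc-m : suc m ≡ h ℕ.+ h
    suc-m = ℕ.suc-injective (trans (sym p≡2+m) p≡)

    -- An exponent i ≥ h = (p-1)/2 contributes only from degree 2i > p-2 on. So starting the sum at
    -- k = (p+1)/2 loses nothing.
    stable : ∀ d → partialSum (h ℕ.+ d) m ≡ partialSum h m
    stable zero    = cong (λ N → partialSum N m) (ℕ.+-identityʳ h)
    stable (suc d) = trans (cong (λ N → partialSum N m) (ℕ.+-suc h d)) (trans (cong₂ ℤ._+_ (stable d)
      (coeff-below (h ℕ.+ d) m (subst (ℕ._≤ h ℕ.+ d ℕ.+ (h ℕ.+ d)) (sym suc-m) (ℕ.+-mono-≤ (ℕ.m≤m+n h d) (ℕ.m≤m+n h d))))) (ℤ.+-identityʳ _))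

    [p+1]/2≡ : (p ℕ.+ 1) / 2 ≡ suc h
    [p+1]/2≡ = trans (ℕ./-congˡ {o = 2} (trans (cong (ℕ._+ 1) p≡) (ℕlemma h))) (ℕ.m*n/n≡m (suc h) 2)
      where
      ℕlemma : ∀ h → suc (h ℕ.+ h) ℕ.+ 1 ≡ suc h ℕ.* 2
      ℕlemma = ℕSolver.solve-∀

    h≤k₁ : h ℕ.≤ k₁
    h≤k₁ = subst (ℕ._≤ k₁) (ℕ.m*n/n≡m h 3) (ℕ./-monoˡ-≤ 3 (subst (λ p → h ℕ.* 3 ℕ.≤ 2 ℕ.* p) (sym p≡)
      (subst (h ℕ.* 3 ℕ.≤_) (ℕlemma h) (ℕ.m≤m+n (h ℕ.* 3) (h ℕ.+ 2)))))
      where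
      ℕlemma : ∀ h → h ℕ.* 3 ℕ.+ (h ℕ.+ 2) ≡ 2 ℕ.* suc (h ℕ.+ h)
      ℕlemma = ℕSolver.solve-∀

  upper-range : (p ℕ.+ 1) / 2 ℕ.+ (suc (2 ℕ.* p / 3) ∸ (p ℕ.+ 1) / 2) ℕ.≤ p
  upper-range = subst (λ k → k ℕ.+ (suc k₁ ∸ k) ℕ.≤ p) (sym [p+1]/2≡) (ℕ.≤-trans (ℕ.≤-reflexive (ℕ.m+[n∸m]≡n (ℕ.s≤s h≤k₁)))
    (ℕ.*-cancelˡ-< 3 k₁ p (ℕ.≤-<-trans 3k₁≤2p (ℕ.*-monoˡ-< p {{prime⇒nonZero pr}} (ℕ.n<1+n 2)))))

  upper-sum : let k₀ = (p ℕ.+ 1) / 2 in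
    + 3 * sumℤ summand (suc (2 ℕ.* p / 3) ∸ k₀) k₀ ≡ - ℓ * leading (+ 3 * n) (n * ℓ) p [modℤ p ]
  upper-sum = begin
    + 3 * sumℤ summand (suc k₁ ∸ (p ℕ.+ 1) / 2) ((p ℕ.+ 1) / 2) ≡⟨ cong (λ k → + 3 * sumℤ summand (suc k₁ ∸ k) k) [p+1]/2≡ ⟩
    + 3 * sumℤ summand (suc k₁ ∸ suc h) (suc h)
      ≈⟨ sums (suc k₁ ∸ suc h) (suc h) h (sym p≡) (ℕ.m+[n∸m]≡n (ℕ.s≤s h≤k₁)) ℕ.≤-refl ⟩
    - ℓ * partialSum h m ≡⟨ cong (λ x → - ℓ * x) (trans (sym (stable h)) (cong (λ N → partialSum N m) (sym suc-m))) ⟩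
    - ℓ * partialSum (suc m) m ≡⟨ cong (λ x → - ℓ * x) (partialSum≡leading (suc m) m (ℕ.n<1+n m)) ⟩
    - ℓ * leading (+ 3 * n) (n * ℓ) (2 ℕ.+ m) ≡⟨ cong (λ k → - ℓ * leading (+ 3 * n) (n * ℓ) k) p≡2+m ⟨
    - ℓ * leading (+ 3 * n) (n * ℓ) p  ∎

-- Rational sums and fractions modulo a prime

sumℚ : (ℕ → ℚ) → ℕ → ℕ → ℚ
sumℚ f zero    k = 0ℚ
sumℚ f (suc c) k = f k ℚ.+ sumℚ f c (suc k)

-- The local recursion of sumFromTo cannot be named, so the left-hand side of
-- the second equation is left to be inferred from its use in the first.
mutual
  sumFromTo≡sumℚ : ∀ a b f → sumFromTo a b f ≡ sumℚ f (suc b ∸ a) a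
  sumFromTo≡sumℚ a b f with suc b ∸ a
  ... | zero = refl
  ... | suc c with suc a
  ...   | k = cong (λ x → f a ℚ.+ x) (recursion≡sumℚ a b f c k)

  recursion≡sumℚ : ∀ a b f c k → _ ≡ sumℚ f c k
  recursion≡sumℚ a b f zero    k = refl
  recursion≡sumℚ a b f (suc c) k = cong (λ x → f k ℚ.+ x) (recursion≡sumℚ a b f c (suc k))

module RationalsMod {m : ℕ} (pr : Prime m) where
  open import Data.Integer using (_+_; _*_; _-_; -_)
  open PrimeModulus pr
  private
    module Z = CommutativeRing (ℤmod m)
  open SetoidReasoning Z.setoid

  infix 4 _≃_÷_

  -- The fraction u/v is only congruent to x, so a rational sum can be represented by an integer
  -- over 1. Both denominators are required to be units, which makes the relation transitive.
  record _≃_÷_ (x : ℚ) (u v : ℤ) : Set where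
    constructor fraction
    field
      ↧≢0   : ¬ ↧ x ≡ + 0 [modℤ m ]
      v≢0   : ¬ v ≡ + 0 [modℤ m ]
      cross : ↥ x * v ≡ u * ↧ x [modℤ m ]
  open _≃_÷_

  private
    factor≢0 : ∀ {x y z} → x * y ≡ z → ¬ z ≡ + 0 [modℤ m ] → ¬ x ≡ + 0 [modℤ m ] × ¬ y ≡ + 0 [modℤ m ]
    factor≢0 {x} {y} refl z≢0 =
      (λ x≡0 → z≢0 (*-≡modʳ y x≡0)) ,
      (λ y≡0 → z≢0 (Z.trans (*-≡modˡ x y≡0) (≡⇒≡mod (ℤ.*-zeroʳ x))))

  ÷-reduced : ∀ {x u v} g → ↥ x * g ≡ u → ↧ x * g ≡ v → ¬ v ≡ + 0 [modℤ m ] → x ≃ u ÷ v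
  ÷-reduced {x} g refl refl v≢0 = fraction (proj₁ (factor≢0 {↧ x} {g} refl v≢0)) v≢0 (≡⇒≡mod (lemma (↥ x) (↧ x) g))
    where
    lemma : ∀ a b g → a * (b * g) ≡ a * g * b
    lemma = solve-∀

  ÷-cong : ∀ {x u v u′ v′} → x ≃ u ÷ v → ¬ v′ ≡ + 0 [modℤ m ] → u * v′ ≡ u′ * v [modℤ m ] → x ≃ u′ ÷ v′
  ÷-cong {x} {u} {v} {u′} {v′} r v′≢0 eq = fraction (↧≢0 r) v′≢0 (*-cancelˡ v (v≢0 r) (begin
    v * (↥ x * v′) ≡⟨ lemma₁ v (↥ x) v′ ⟩
    (↥ x * v) * v′ ≈⟨ *-≡modʳ v′ (cross r) ⟩
    (u * ↧ x) * v′ ≡⟨ lemma₂ u (↧ x) v′ ⟩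
    (u * v′) * ↧ x ≈⟨ *-≡modʳ (↧ x) eq ⟩
    (u′ * v) * ↧ x ≡⟨ lemma₃ u′ v (↧ x) ⟩
    v * (u′ * ↧ x)          ∎))
    where
    lemma₁ : ∀ a b c → a * (b * c) ≡ (b * a) * c
    lemma₁ = solve-∀
    lemma₂ : ∀ a b c → (a * b) * c ≡ (a * c) * b
    lemma₂ = solve-∀
    lemma₃ : ∀ a b c → (a * b) * c ≡ b * (a * c)
    lemma₃ = solve-∀

  ÷-// : ∀ u v → ¬ v ≡ + 0 [modℤ m ] → (u // v) ≃ u ÷ v
  ÷-// u (+ zero)  v≢0 = ⊥-elim (v≢0 Z.refl)
  ÷-// u (+ suc n) v≢0 = ÷-reduced (ℤ.gcd u (+ suc n)) (ℚ.↥-/ u (suc n)) (ℚ.↧-/ u (suc n)) v≢0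
  ÷-// u -[1+ n ]  v≢0 = ÷-cong {u = - u} {v = + suc n}
    (÷-reduced (ℤ.gcd (- u) (+ suc n)) (ℚ.↥-/ (- u) (suc n)) (ℚ.↧-/ (- u) (suc n)) (λ eq → v≢0 (neg-≡mod eq)))
    v≢0 (≡⇒≡mod (lemma u (+ suc n)))
    where
    lemma : ∀ u v → - u * (- v) ≡ u * v
    lemma = solve-∀

  ÷-neg : ∀ {x u v} → x ≃ u ÷ v → ℚ.- x ≃ - u ÷ v
  ÷-neg {x} {u} {v} r = fraction
    (subst (λ d → ¬ d ≡ + 0 [modℤ m ]) (sym (ℚ.↧-neg x)) (↧≢0 r)) (v≢0 r) (begin
    ↥ (ℚ.- x) * v ≡⟨ cong (λ n → n * v) (ℚ.↥-neg x) ⟩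
    - ↥ x * v ≡⟨ ℤ.neg-distribˡ-* (↥ x) v ⟨
    - (↥ x * v) ≈⟨ neg-≡mod (cross r) ⟩
    - (u * ↧ x) ≡⟨ ℤ.neg-distribˡ-* u (↧ x) ⟩
    - u * ↧ x ≡⟨ cong (λ d → - u * d) (ℚ.↧-neg x) ⟨
    - u * ↧ (ℚ.- x)  ∎)

  ÷-+ : ∀ {x y u v s t} → x ≃ u ÷ v → y ≃ s ÷ t → x ℚ.+ y ≃ (u * t + s * v) ÷ (v * t)
  ÷-+ {x} {y} {u} {v} {s} {t} r r′ =
    ÷-cong (÷-reduced (ℤ.gcd (↥ x * ↧ y + ↥ y * ↧ x) (↧ x * ↧ y)) (ℚ.↥-+ x y) (ℚ.↧-+ x y) (*-≢0 (↧≢0 r) (↧≢0 r′))) (*-≢0 (v≢0 r) (v≢0 r′)) (begin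
    (↥ x * ↧ y + ↥ y * ↧ x) * (v * t) ≡⟨ lemma₁ (↥ x) (↧ x) (↥ y) (↧ y) v t ⟩
    (↥ x * v) * (↧ y * t) + (↥ y * t) * (↧ x * v) ≈⟨ +-≡mod (*-≡modʳ (↧ y * t) (cross r)) (*-≡modʳ (↧ x * v) (cross r′)) ⟩
    (u * ↧ x) * (↧ y * t) + (s * ↧ y) * (↧ x * v) ≡⟨ lemma₂ u (↧ x) s (↧ y) v t ⟩
    (u * t + s * v) * (↧ x * ↧ y)  ∎)
    where
    lemma₁ : ∀ a b c d v t → (a * d + c * b) * (v * t) ≡ (a * v) * (d * t) + (c * t) * (b * v)
    lemma₁ = solve-∀
    lemma₂ : ∀ u b s d v t → (u * b) * (d * t) + (s * d) * (b * v) ≡ (u * t + s * v) * (b * d)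
    lemma₂ = solve-∀

  private
    *-rearrange : ∀ a b c d → (a * b) * (c * d) ≡ (c * a) * (b * d)
    *-rearrange = solve-∀
    *-middle : ∀ a b c d → (a * b) * (c * d) ≡ (a * c) * (b * d)
    *-middle = solve-∀
    *-last : ∀ a b c d → (a * b) * (c * d) ≡ (a * d) * (b * c)
    *-last = solve-∀
    *-outer : ∀ a b c d → (a * b) * (c * d) ≡ (c * b) * (a * d)
    *-outer = solve-∀
    *-swap : ∀ a b c d → (a * b) * (c * d) ≡ (a * d) * (c * b)
    *-swap = solve-∀
    *-flip : ∀ a b c d → (a * b) * (c * d) ≡ (d * b) * (a * c)
    *-flip = solve-∀

  ÷-* : ∀ {x y u v s t} → x ≃ u ÷ v → y ≃ s ÷ t → x ℚ.* y ≃ (u * s) ÷ (v * t)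
  ÷-* {x} {y} {u} {v} {s} {t} r r′ =
    ÷-cong (÷-reduced (ℤ.gcd (↥ x * ↥ y) (↧ x * ↧ y)) (ℚ.↥-* x y) (ℚ.↧-* x y) (*-≢0 (↧≢0 r) (↧≢0 r′))) (*-≢0 (v≢0 r) (v≢0 r′)) (begin
    (↥ x * ↥ y) * (v * t) ≡⟨ *-middle (↥ x) (↥ y) v t ⟩
    (↥ x * v) * (↥ y * t) ≈⟨ *-≡mod (cross r) (cross r′) ⟩
    (u * ↧ x) * (s * ↧ y) ≡⟨ *-middle u (↧ x) s (↧ y) ⟩
    (u * s) * (↧ x * ↧ y)  ∎)

  ÷-0 : 0ℚ ≃ + 0 ÷ + 1
  ÷-0 = fraction 1≢0 1≢0 Z.refl

  ÷-1 : 1ℚ ≃ + 1 ÷ + 1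
  ÷-1 = fraction 1≢0 1≢0 Z.refl

  ÷-½ : ¬ + 2 ≡ + 0 [modℤ m ] → ½ ≃ + 1 ÷ + 2
  ÷-½ 2≢0 = fraction 2≢0 2≢0 Z.refl

  ÷⇒≡modℚ : ∀ {x y u v s t} → x ≃ u ÷ v → y ≃ s ÷ t → u * t ≡ s * v [modℤ m ] → x ≡ y [modℚ m ]
  ÷⇒≡modℚ {x} {y} {u} {v} {s} {t} r r′ eq = ≡0⇒∣ (≡mod⇒-≡0 {x = ↥ x * ↧ y} {↥ y * ↧ x} (*-cancelˡ (v * t) (*-≢0 (v≢0 r) (v≢0 r′)) (begin
    (v * t) * (↥ x * ↧ y) ≡⟨ *-rearrange v t (↥ x) (↧ y) ⟩
    (↥ x * v) * (t * ↧ y) ≈⟨ *-≡modʳ (t * ↧ y) (cross r) ⟩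
    (u * ↧ x) * (t * ↧ y) ≡⟨ *-middle u (↧ x) t (↧ y) ⟩
    (u * t) * (↧ x * ↧ y) ≈⟨ *-≡modʳ (↧ x * ↧ y) eq ⟩
    (s * v) * (↧ x * ↧ y) ≡⟨ *-last s v (↧ x) (↧ y) ⟩
    (s * ↧ y) * (v * ↧ x) ≈⟨ *-≡modʳ (v * ↧ x) (cross r′) ⟨
    (↥ y * t) * (v * ↧ x) ≡⟨ *-outer (↥ y) t v (↧ x) ⟩
    (v * t) * (↥ y * ↧ x)          ∎)))

  ≡modℚ⇒÷ : ∀ {x y u v s t} → x ≃ u ÷ v → y ≃ s ÷ t → x ≡ y [modℚ m ] → u * t ≡ s * v [modℤ m ]
  ≡modℚ⇒÷ {x} {y} {u} {v} {s} {t} r r′ eq = *-cancelˡ (↧ x * ↧ y) (*-≢0 (↧≢0 r) (↧≢0 r′)) (begin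
    (↧ x * ↧ y) * (u * t) ≡⟨ *-rearrange (↧ x) (↧ y) u t ⟩
    (u * ↧ x) * (↧ y * t) ≈⟨ *-≡modʳ (↧ y * t) (cross r) ⟨
    (↥ x * v) * (↧ y * t) ≡⟨ *-middle (↥ x) v (↧ y) t ⟩
    (↥ x * ↧ y) * (v * t) ≈⟨ *-≡modʳ (v * t) (-≡0⇒≡mod {x = ↥ x * ↧ y} {↥ y * ↧ x} (∣⇒≡0 eq)) ⟩
    (↥ y * ↧ x) * (v * t) ≡⟨ *-swap (↥ y) (↧ x) v t ⟩
    (↥ y * t) * (v * ↧ x) ≈⟨ *-≡modʳ (v * ↧ x) (cross r′) ⟩
    (s * ↧ y) * (v * ↧ x) ≡⟨ *-flip s (↧ y) v (↧ x) ⟩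
    (↧ x * ↧ y) * (s * v)  ∎)
  ÷-sum : ∀ {f g N} → (∀ k → k ℕ.< N → f k ≃ g k ÷ + 1) → ∀ c k → k ℕ.+ c ℕ.≤ N → sumℚ f c k ≃ sumℤ g c k ÷ + 1
  ÷-sum hyp zero k le = ÷-0
  ÷-sum {f} {g} {N} hyp (suc c) k le = ÷-cong
    (÷-+ (hyp k (ℕ.≤-trans (ℕ.s≤s (ℕ.m≤m+n k c)) le′)) (÷-sum hyp c (suc k) le′)) 1≢0
    (≡⇒≡mod (lemma (g k) (sumℤ g c (suc k))))
    where
    le′ : suc k ℕ.+ c ℕ.≤ N
    le′ = subst (ℕ._≤ N) (ℕ.+-suc k c) le
    lemma : ∀ a b → (a * + 1 + b * + 1) * + 1 ≡ (a + b) * (+ 1 * + 1)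
    lemma = solve-∀

pos-^ : ∀ d k → + (d ^ k) ≡ (+ d) ℤ.^ k
pos-^ d zero    = refl
pos-^ d (suc k) = trans (ℤ.pos-* d (d ^ k)) (cong (λ x → + d ℤ.* x) (pos-^ d k))

-- Q²/D is the ratio in the stated sum and ℓ²/(27n) the one attached to the cubic; `same-ratio`
-- equates them.
module UpperSumℚ {p : ℕ} (pr : Prime p) (p≢2 : p ≢ 2) (p≢3 : p ≢ 3)
                 (n ℓ : ℤ) (n≢0 : ¬ n ≡ + 0 [modℤ p ])
                 (Q : ℤ) (D : ℕ) (D≢0 : ¬ + D ≡ + 0 [modℤ p ])
                 (same-ratio : ℓ ℤ.^ 2 ℤ.* + D ≡ Q ℤ.^ 2 ℤ.* (+ 27 ℤ.* n)) where
  open import Data.Integer using (_+_; _*_; _-_; -_)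
  open PrimeModulus pr
  open Fermat pr
  open RationalsMod pr
  open UpperSum pr p≢2 p≢3 n ℓ n≢0
  private
    module Z = CommutativeRing (ℤmod p)
  open SetoidReasoning Z.setoid

  private
    E : ℤ
    E = + 27 * n
    E≢0 : ¬ E ≡ + 0 [modℤ p ]
    E≢0 = *-≢0 (*-≢0 3≢0 (*-≢0 3≢0 3≢0)) n≢0

    ratio-power : ∀ k → ℓ ℤ.^ (2 ℕ.* k) * (+ D) ℤ.^ k ≡ Q ℤ.^ (2 ℕ.* k) * E ℤ.^ k
    ratio-power k = trans (cong (λ x → x * (+ D) ℤ.^ k) (sym (ℤ.^-*-assoc ℓ 2 k))) (trans (sym (ℤ^-distrib-* (ℓ ℤ.^ 2) (+ D) k))
      (trans (cong (ℤ._^ k) same-ratio) (trans (ℤ^-distrib-* (Q ℤ.^ 2) E k) (cong (λ x → x * E ℤ.^ k) (ℤ.^-*-assoc Q 2 k)))))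

  rational-summand : ℕ → ℚ
  rational-summand k = (+ ((3 ℕ.* k) C k) * Q ℤ.^ (2 ℕ.* k)) // (+ (D ^ k))

  -- Insert E^(p-1) ≡ 1 for E = 27n, split it as E^k E^(p-1-k), and trade Q^(2k) E^k for ℓ^(2k) D^k.
  rational-summand≃ : ∀ k → k ℕ.< p → rational-summand k ≃ summand k ÷ + 1
  rational-summand≃ k k<p = ÷-cong (÷-// (c * Q ℤ.^ (2 ℕ.* k)) (+ (D ^ k)) (subst (λ x → ¬ x ≡ + 0 [modℤ p ]) (sym (pos-^ D k)) (^-≢0 k D≢0))) 1≢0 (begin
    c * Q ℤ.^ (2 ℕ.* k) * + 1 ≈⟨ *-≡modˡ (c * Q ℤ.^ (2 ℕ.* k)) (x^[p∸1]≡1 E≢0) ⟨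
    c * Q ℤ.^ (2 ℕ.* k) * E ℤ.^ (p ∸ 1) ≡⟨ cong (λ x → c * Q ℤ.^ (2 ℕ.* k) * E ℤ.^ x) (ℕ.m+[n∸m]≡n {k} {p ∸ 1} k≤p∸1) ⟨
    c * Q ℤ.^ (2 ℕ.* k) * E ℤ.^ (k ℕ.+ (p ∸ 1 ∸ k)) ≡⟨ cong (λ x → c * Q ℤ.^ (2 ℕ.* k) * x) (ℤ.^-distribˡ-+-* E k (p ∸ 1 ∸ k)) ⟩
    c * Q ℤ.^ (2 ℕ.* k) * (E ℤ.^ k * E ℤ.^ (p ∸ 1 ∸ k)) ≡⟨ lemma₁ c (Q ℤ.^ (2 ℕ.* k)) (E ℤ.^ k) (E ℤ.^ (p ∸ 1 ∸ k)) ⟩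
    c * (Q ℤ.^ (2 ℕ.* k) * E ℤ.^ k) * E ℤ.^ (p ∸ 1 ∸ k) ≡⟨ cong (λ x → c * x * E ℤ.^ (p ∸ 1 ∸ k)) (ratio-power k) ⟨
    c * (ℓ ℤ.^ (2 ℕ.* k) * (+ D) ℤ.^ k) * E ℤ.^ (p ∸ 1 ∸ k) ≡⟨ lemma₂ c (ℓ ℤ.^ (2 ℕ.* k)) ((+ D) ℤ.^ k) (E ℤ.^ (p ∸ 1 ∸ k)) ⟩
    c * ℓ ℤ.^ (2 ℕ.* k) * E ℤ.^ (p ∸ 1 ∸ k) * (+ D) ℤ.^ k ≡⟨ cong (λ x → summand k * x) (pos-^ D k) ⟨
    summand k * + (D ^ k)  ∎)
    where
    c : ℤ
    c = + ((3 ℕ.* k) C k)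
    k≤p∸1 : k ℕ.≤ p ∸ 1
    k≤p∸1 = ℕ.<⇒≤pred k<p
    lemma₁ : ∀ c x y z → c * x * (y * z) ≡ c * (x * y) * z
    lemma₁ = solve-∀
    lemma₂ : ∀ c x y z → c * (x * y) * z ≡ c * x * z * y
    lemma₂ = solve-∀

  T : ℤ
  T = sumℤ summand (suc (2 ℕ.* p / 3) ∸ (p ℕ.+ 1) / 2) ((p ℕ.+ 1) / 2)

  sum≃T : sumFromTo ((p ℕ.+ 1) / 2) (2 ℕ.* p / 3) rational-summand ≃ T ÷ + 1
  sum≃T = subst (_≃ T ÷ + 1) (sym (sumFromTo≡sumℚ ((p ℕ.+ 1) / 2) (2 ℕ.* p / 3) rational-summand))
    (÷-sum rational-summand≃ (suc (2 ℕ.* p / 3) ∸ (p ℕ.+ 1) / 2) ((p ℕ.+ 1) / 2) upper-range)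

-- Uniqueness of the representation 4q = L² + 27M²

square≡∣∣² : ∀ x → x ℤ.* x ≡ + (ℤ.∣ x ∣ ℕ.* ℤ.∣ x ∣)
square≡∣∣² (+ n)    = sym (ℤ.pos-* n n)
square≡∣∣² -[1+ n ] = refl

x²+27y²≡16⇒y≡0 : ∀ x y → x ℤ.* x ℤ.+ + 27 ℤ.* (y ℤ.* y) ≡ + 16 → y ≡ + 0
x²+27y²≡16⇒y≡0 x y eq = ℤ.∣i∣≡0⇒i≡0 (go ℤ.∣ y ∣ (ℤ.+-injective (trans (sym squares) eq)))
  where
  squares : x ℤ.* x ℤ.+ + 27 ℤ.* (y ℤ.* y) ≡ + (ℤ.∣ x ∣ ℕ.* ℤ.∣ x ∣ ℕ.+ 27 ℕ.* (ℤ.∣ y ∣ ℕ.* ℤ.∣ y ∣))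
  squares = trans (cong₂ (λ a b → a ℤ.+ + 27 ℤ.* b) (square≡∣∣² x) (square≡∣∣² y))
    (trans (cong (λ b → + (ℤ.∣ x ∣ ℕ.* ℤ.∣ x ∣) ℤ.+ b) (sym (ℤ.pos-* 27 (ℤ.∣ y ∣ ℕ.* ℤ.∣ y ∣)))) (sym (ℤ.pos-+ (ℤ.∣ x ∣ ℕ.* ℤ.∣ x ∣) _)))
  go : ∀ k → ℤ.∣ x ∣ ℕ.* ℤ.∣ x ∣ ℕ.+ 27 ℕ.* (k ℕ.* k) ≡ 16 → k ≡ 0
  go zero    _  = refl
  go (suc k) eq = ⊥-elim (ℕ.<⇒≱ (from-yes (16 ℕ.<? 27)) (ℕ.≤-trans (ℕ.*-monoʳ-≤ 27 (ℕ.s≤s (ℕ.z≤n {k ℕ.+ k ℕ.* suc k})))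
    (ℕ.≤-trans (ℕ.m≤n+m _ (ℤ.∣ x ∣ ℕ.* ℤ.∣ x ∣)) (ℕ.≤-reflexive eq))))

module Representations {q : ℕ} (pr : Prime q) (3≢0 : ¬ + 3 ≡ + 0 [modℤ q ])
  {L M L′ M′ : ℤ}
  (rep  : + 4 ℤ.* + q ≡ L ℤ.* L ℤ.+ + 27 ℤ.* (M ℤ.* M))
  (rep′ : + 4 ℤ.* + q ≡ L′ ℤ.* L′ ℤ.+ + 27 ℤ.* (M′ ℤ.* M′))
  (orthogonal : L ℤ.* L′ ℤ.+ + 27 ℤ.* (M ℤ.* M′) ≡ + 0 [modℤ q ]) where
  open import Data.Integer using (_+_; _*_; _-_; -_)
  open PrimeModulus pr
  private
    module Z = CommutativeRing (ℤmod q)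
    u v : ℤ
    u = L * L′ + + 27 * (M * M′)
    v = L * M′ - L′ * M
    instance
      q≢0 : ℕ.NonZero q
      q≢0 = prime⇒nonZero pr

    u²+27v² : u * u + + 27 * (v * v) ≡ + 16 * (+ q * + q)
    u²+27v² = trans (brahmagupta L M L′ M′) (trans (cong₂ ℤ._*_ (sym rep) (sym rep′)) (lemma (+ q)))
      where
      brahmagupta : ∀ L M L′ M′ → (L * L′ + + 27 * (M * M′)) * (L * L′ + + 27 * (M * M′)) ℤ.+
          + 27 * ((L * M′ - L′ * M) * (L * M′ - L′ * M)) ≡
        (L * L + + 27 * (M * M)) * (L′ * L′ + + 27 * (M′ * M′))
      brahmagupta = solve-∀
      lemma : ∀ q → + 4 * q * (+ 4 * q) ≡ + 16 * (q * q)
      lemma = solve-∀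

    v≡0 : v ≡ + 0 [modℤ q ]
    v≡0 = [ (λ eq → eq) , (λ eq → eq) ]′ (*≡0⇒≡0⊎≡0 v v (regular (*-≢0 3≢0 (*-≢0 3≢0 3≢0)) (v * v)
      (Z.trans (≡⇒≡mod (lemma (u * u) (+ 27 * (v * v)))) (Z.trans (+-≡mod (≡⇒≡mod u²+27v²) (neg-≡mod (*-≡modʳ u orthogonal)))
        (Z.trans (+-≡modʳ (- (+ 0 * u)) (*-≡modˡ (+ 16) (*-≡modʳ (+ q) (m≡0 {q})))) (≡⇒≡mod (lemma′ (+ q) u)))))))
      where
      lemma : ∀ x y → y ≡ x + y - x
      lemma = solve-∀
      lemma′ : ∀ q u → + 16 * (+ 0 * q) - + 0 * u ≡ + 0
      lemma′ = solve-∀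

  -- Brahmagupta's identity gives u² + 27v² = 16q², and q ∣ u forces q ∣ v. Dividing by q² leaves x²
  -- + 27k² = 16, so k = 0 and v = 0.
  proportional : L * M′ ≡ L′ * M
  proportional = go orthogonal v≡0
    where
    go : u ≡ + 0 [modℤ q ] → v ≡ + 0 [modℤ q ] → L * M′ ≡ L′ * M
    go (congruent x u≡) (congruent k v≡) = trans (lemma₁ (L * M′) (L′ * M)) (trans (cong (λ z → z + L′ * M)
        (trans v≡ (cong (λ k → + 0 + k * + q) (x²+27y²≡16⇒y≡0 x k x²+27k²≡16)))) (lemma₂ (+ q) (L′ * M)))
      where
      lemma₁ : ∀ a b → a ≡ a - b + b
      lemma₁ = solve-∀
      lemma₂ : ∀ q b → + 0 + + 0 * q + b ≡ b
      lemma₂ = solve-∀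
      lemma₃ : ∀ x k q → (x * x + + 27 * (k * k)) * q * q ≡
        (+ 0 + x * q) * (+ 0 + x * q) + + 27 * ((+ 0 + k * q) * (+ 0 + k * q))
      lemma₃ = solve-∀
      x²+27k²≡16 : x * x + + 27 * (k * k) ≡ + 16
      x²+27k²≡16 = ℤ.*-cancelʳ-≡ _ _ (+ q) (ℤ.*-cancelʳ-≡ _ _ (+ q) (trans (lemma₃ x k (+ q))
        (trans (sym (cong₂ (λ a b → a * a + + 27 * (b * b)) u≡ v≡)) (trans u²+27v² (sym (ℤ.*-assoc (+ 16) (+ q) (+ q)))))))

  L′²≡L² : L′ * L′ ≡ L * L
  L′²≡L² = ℤ.*-cancelˡ-≡ (+ 4 * + q) _ _ {{ℤ.i*j≢0 (+ 4) (+ q)}} (begin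
    + 4 * + q * (L′ * L′) ≡⟨ cong (λ x → x * (L′ * L′)) rep ⟩
    (L * L + + 27 * (M * M)) * (L′ * L′) ≡⟨ lemma₁ L M L′ ⟩
    L * L * (L′ * L′) + + 27 * (L′ * M * (L′ * M)) ≡⟨ cong (λ x → L * L * (L′ * L′) + + 27 * (x * x)) proportional ⟨
    L * L * (L′ * L′) + + 27 * (L * M′ * (L * M′)) ≡⟨ lemma₂ L L′ M′ ⟩
    (L′ * L′ + + 27 * (M′ * M′)) * (L * L) ≡⟨ cong (λ x → x * (L * L)) rep′ ⟨
    + 4 * + q * (L * L)  ∎)
    where
    open ≡-Reasoning
    lemma₁ : ∀ L M L′ → (L * L + + 27 * (M * M)) * (L′ * L′) ≡ L * L * (L′ * L′) + + 27 * (L′ * M * (L′ * M))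
    lemma₁ = solve-∀
    lemma₂ : ∀ L L′ M′ → L * L * (L′ * L′) + + 27 * (L * M′ * (L * M′)) ≡ (L′ * L′ + + 27 * (M′ * M′)) * (L * L)
    lemma₂ = solve-∀

  M′²≡M² : M′ * M′ ≡ M * M
  M′²≡M² = ℤ.*-cancelˡ-≡ (+ 27) _ _ (trans (lemma (L′ * L′) (+ 27 * (M′ * M′)))
    (trans (cong₂ (λ x y → x - y) (trans (sym rep′) rep) L′²≡L²) (sym (lemma (L * L) (+ 27 * (M * M))))))
    where
    lemma : ∀ x y → y ≡ x + y - x
    lemma = solve-∀

-- Evaluation of the two sums

module CubicResidues (q : ℕ) (qPrime : Prime q) (3∣q-1 : + 3 ∣ (+ q ℤ.- + 1))
            (L M : ℤ) (4q≡L²+27M² : + (4 ℕ.* q) ≡ L ℤ.^ 2 ℤ.+ + 27 ℤ.* M ℤ.^ 2)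
            (p : ℕ) (pPrime : Prime p) (p≢2 : p ≢ 2) (p≢3 : p ≢ 3) (p≢q : p ≢ q)
            (p∤LM : ¬ (+ p ∣ (L ℤ.* M))) where
  open import Data.Integer using (_+_; _*_; _-_; -_)

  e : ℕ
  e = (q ∸ 1) / 3

  private
    module q = PrimeModulus qPrime
    module p = PrimeModulus pPrime
    module Zq = CommutativeRing (ℤmod q)
    module Zp = CommutativeRing (ℤmod p)

    1<q : 1 ℕ.< q
    1<q = prime>1 qPrime

    q≡1+[q∸1] : q ≡ suc (q ∸ 1)
    q≡1+[q∸1] = sym (ℕ.m+[n∸m]≡n (ℕ.<⇒≤ 1<q))

    q≡1+3e : q ≡ suc (3 ℕ.* e)
    q≡1+3e = trans q≡1+[q∸1] (cong suc (sym (ℕ.m*[n/m]≡n (subst (3 ℕ.∣_) ∣q-1∣≡ 3∣q-1))))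
      where
      lemma : ∀ n → + 1 + n - + 1 ≡ n
      lemma = solve-∀
      ∣q-1∣≡ : ℤ.∣ + q - + 1 ∣ ≡ q ∸ 1
      ∣q-1∣≡ = cong ℤ.∣_∣ (trans (cong (λ n → + n - + 1) q≡1+[q∸1]) (lemma (+ (q ∸ 1))))

    3<q : 3 ℕ.< q
    3<q = subst (3 ℕ.<_) (sym q≡1+3e) (ℕ.s≤s (ℕ.*-monoʳ-≤ 3 (0<e e q≡1+3e)))
      where
      0<e : ∀ e → q ≡ suc (3 ℕ.* e) → 0 ℕ.< e
      0<e zero    q≡1 = ⊥-elim (ℕ.<⇒≢ 1<q (sym q≡1))
      0<e (suc _) _   = ℕ.s≤s ℕ.z≤n

    2≢0 : ¬ + 2 ≡ + 0 [modℤ q ]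
    2≢0 = q.small≢0 ℕ.z<s (ℕ.<-trans (ℕ.n<1+n 2) 3<q)

    3≢0 : ¬ + 3 ≡ + 0 [modℤ q ]
    3≢0 = q.small≢0 ℕ.z<s 3<q

    rep : + 4 * + q ≡ L * L + + 27 * (M * M)
    rep = trans (sym (ℤ.pos-* 4 q)) (trans 4q≡L²+27M² (cong₂ (λ x y → L * x + + 27 * (M * y)) (ℤ.*-identityʳ L) (ℤ.*-identityʳ M)))

    L²≡-27M² : L * L ≡ - (+ 27 * (M * M)) [modℤ q ]
    L²≡-27M² = Zq.trans (≡⇒≡mod (trans (lemma (L * L) (+ 27 * (M * M))) (cong (λ x → x - + 27 * (M * M)) (sym rep))))
      (Zq.trans (+-≡modʳ (- (+ 27 * (M * M))) (*-≡modˡ (+ 4) (m≡0 {q}))) (≡⇒≡mod (ℤ.+-identityˡ _)))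
      where
      lemma : ∀ x y → x ≡ x + y - y
      lemma = solve-∀

    instance
      q≢0 : ℕ.NonZero q
      q≢0 = prime⇒nonZero qPrime

    -- If q divided L, it would divide M too, so q² would divide 4q and q would divide 4.
    L≢0 : ¬ L ≡ + 0 [modℤ q ]
    L≢0 L≡0 = go L≡0 M≡0
      where
      M≡0 : M ≡ + 0 [modℤ q ]
      M≡0 = [ (λ eq → eq) , (λ eq → eq) ]′ (q.*≡0⇒≡0⊎≡0 M M (q.regular (q.*-≢0 3≢0 (q.*-≢0 3≢0 3≢0)) (M * M)
        (Zq.trans (≡⇒≡mod (sym (ℤ.neg-involutive _))) (neg-≡mod (Zq.trans (Zq.sym L²≡-27M²) (*-≡modʳ L L≡0))))))
      go : L ≡ + 0 [modℤ q ] → M ≡ + 0 [modℤ q ] → ⊥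
      go (congruent l L≡) (congruent m M≡) = q.*-≢0 2≢0 2≢0 (congruent (l * l + + 27 * (m * m))
        (trans (ℤ.*-cancelʳ-≡ (+ 4) ((l * l + + 27 * (m * m)) * + q) (+ q) (trans rep (trans (cong₂ (λ x y → x * x + + 27 * (y * y)) L≡ M≡) (lemma l m (+ q))))) (sym (ℤ.+-identityˡ _))))
        where
        lemma : ∀ l m q → (+ 0 + l * q) * (+ 0 + l * q) + + 27 * ((+ 0 + m * q) * (+ 0 + m * q)) ≡
            (l * l + + 27 * (m * m)) * q * q
        lemma = solve-∀

    M≢0 : ¬ M ≡ + 0 [modℤ q ]
    M≢0 M≡0 = q.*-≢0 L≢0 L≢0 (Zq.trans L²≡-27M² (neg-≡mod (*-≡modˡ (+ 27) (*-≡modʳ M M≡0))))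

    w : ℤ
    w = (+ 9 * M * proj₁ (Fermat.inverse qPrime L L≢0) - + 1) * proj₁ (Fermat.inverse qPrime (+ 2) 2≢0)

    L[2w+1]≡9M : L * (+ 2 * w + + 1) ≡ + 9 * M [modℤ q ]
    L[2w+1]≡9M = begin
      L * (+ 2 * ((+ 9 * M * L⁻¹ - + 1) * 2⁻¹) + + 1) ≡⟨ lemma₁ L M L⁻¹ 2⁻¹ ⟩
      L * ((+ 9 * M * L⁻¹ - + 1) * (+ 2 * 2⁻¹) + + 1)
        ≈⟨ *-≡modˡ L (+-≡modʳ (+ 1) (*-≡modˡ (+ 9 * M * L⁻¹ - + 1) (proj₂ (Fermat.inverse qPrime (+ 2) 2≢0)))) ⟩
      L * ((+ 9 * M * L⁻¹ - + 1) * + 1 + + 1) ≡⟨ lemma₂ L M L⁻¹ ⟩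
      + 9 * M * (L * L⁻¹) ≈⟨ *-≡modˡ (+ 9 * M) (proj₂ (Fermat.inverse qPrime L L≢0)) ⟩
      + 9 * M * + 1 ≡⟨ ℤ.*-identityʳ (+ 9 * M) ⟩
      + 9 * M  ∎
      where
      open SetoidReasoning Zq.setoid
      L⁻¹ 2⁻¹ : ℤ
      L⁻¹ = proj₁ (Fermat.inverse qPrime L L≢0)
      2⁻¹ = proj₁ (Fermat.inverse qPrime (+ 2) 2≢0)
      lemma₁ : ∀ L M i j → L * (+ 2 * ((+ 9 * M * i - + 1) * j) + + 1) ≡ L * ((+ 9 * M * i - + 1) * (+ 2 * j) + + 1)
      lemma₁ = solve-∀
      lemma₂ : ∀ L M i → L * ((+ 9 * M * i - + 1) * + 1 + + 1) ≡ + 9 * M * (L * i)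
      lemma₂ = solve-∀

    -- 4 (w² + w + 1) = (2w+1)² + 3, and (9M)² = 81M² ≡ -3L².
    w-root : w * w + w + + 1 ≡ + 0 [modℤ q ]
    w-root = q.regular (q.*-≢0 (q.*-≢0 2≢0 2≢0) (q.*-≢0 L≢0 L≢0)) (w * w + w + + 1) (begin
      + 4 * (L * L) * (w * w + w + + 1) ≡⟨ lemma₁ L w ⟩
      L * (+ 2 * w + + 1) * (L * (+ 2 * w + + 1)) + + 3 * (L * L)
        ≈⟨ +-≡mod (*-≡mod L[2w+1]≡9M L[2w+1]≡9M) (*-≡modˡ (+ 3) L²≡-27M²) ⟩
      + 9 * M * (+ 9 * M) + + 3 * - (+ 27 * (M * M)) ≡⟨ lemma₂ M ⟩
      + 0  ∎)
      where
      open SetoidReasoning Zq.setoid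
      lemma₁ : ∀ L w → + 4 * (L * L) * (w * w + w + + 1) ≡ L * (+ 2 * w + + 1) * (L * (+ 2 * w + + 1)) + + 3 * (L * L)
      lemma₁ = solve-∀
      lemma₂ : ∀ M → + 9 * M * (+ 9 * M) + + 3 * - (+ 27 * (M * M)) ≡ + 0
      lemma₂ = solve-∀

  open CubicSymbol {e = e} qPrime q≡1+3e w w-root using (χ; χ-unique)
  open JacobiSum {e = e} qPrime q≡1+3e w w-root using (A; B; A+Bw≡0; norm≡q; B≡0mod3)

  private
    L′ M′ : ℤ
    L′ = + 2 * A - B
    M′ = _≡_[modℤ_].factor B≡0mod3

    B≡3M′ : B ≡ + 3 * M′
    B≡3M′ = trans (_≡_[modℤ_].equality B≡0mod3) (trans (ℤ.+-identityˡ _) (ℤ.*-comm M′ (+ 3)))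

    rep′ : + 4 * + q ≡ L′ * L′ + + 27 * (M′ * M′)
    rep′ = trans (cong (λ x → + 4 * x) (sym norm≡q)) (trans (lemma₁ A B) (trans (cong (λ b → L′ * L′ + + 3 * (b * b)) B≡3M′) (lemma₂ L′ M′)))
      where
      lemma₁ : ∀ A B → + 4 * (A * A - A * B + B * B) ≡ (+ 2 * A - B) * (+ 2 * A - B) + + 3 * (B * B)
      lemma₁ = solve-∀
      lemma₂ : ∀ l m → l * l + + 3 * (+ 3 * m * (+ 3 * m)) ≡ l * l + + 27 * (m * m)
      lemma₂ = solve-∀

    -- Equal to 2L (A + B w) modulo q. This ties (L′, M′) to the ratio M/L from which w was made,
    -- and not to its negative.
    orthogonal : L * L′ + + 27 * (M * M′) ≡ + 0 [modℤ q ]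
    orthogonal = begin
      L * L′ + + 27 * (M * M′) ≡⟨ lemma₁ (L * L′) M M′ ⟩
      L * L′ + (+ 3 * M′) * (+ 9 * M) ≡⟨ cong (λ b → L * L′ + b * (+ 9 * M)) B≡3M′ ⟨
      L * L′ + B * (+ 9 * M) ≈⟨ +-≡modˡ (L * L′) (*-≡modˡ B L[2w+1]≡9M) ⟨
      L * L′ + B * (L * (+ 2 * w + + 1)) ≡⟨ lemma₂ L A B w ⟩
      + 2 * L * (A + B * w) ≈⟨ *-≡modˡ (+ 2 * L) A+Bw≡0 ⟩
      + 2 * L * + 0 ≡⟨ ℤ.*-zeroʳ (+ 2 * L) ⟩
      + 0  ∎
      where
      open SetoidReasoning Zq.setoid
      lemma₁ : ∀ x m n → x + + 27 * (m * n) ≡ x + (+ 3 * n) * (+ 9 * m)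
      lemma₁ = solve-∀
      lemma₂ : ∀ L A B w → L * (+ 2 * A - B) + B * (L * (+ 2 * w + + 1)) ≡ + 2 * L * (A + B * w)
      lemma₂ = solve-∀

    open Representations qPrime 3≢0 {L} {M} {L′} {M′} rep rep′ orthogonal

    p∤L : ¬ L ≡ + 0 [modℤ p ]
    p∤L L≡0 = p∤LM (≡0⇒∣ (*-≡modʳ M L≡0))

    p∤M : ¬ M ≡ + 0 [modℤ p ]
    p∤M M≡0 = p∤LM (≡0⇒∣ (Zp.trans (*-≡modˡ L M≡0) (≡⇒≡mod (ℤ.*-zeroʳ L))))

    p∤L′ : ¬ L′ ≡ + 0 [modℤ p ]
    p∤L′ L′≡0 = p.*-≢0 p∤L p∤L (Zp.trans (≡⇒≡mod (sym L′²≡L²)) (*-≡modʳ L′ L′≡0))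

    p∤3 : ¬ + 3 ≡ + 0 [modℤ p ]
    p∤3 = p.prime≢⇒≢0 (from-yes (prime? 3)) p≢3

    p∤q : ¬ + q ≡ + 0 [modℤ p ]
    p∤q = p.prime≢⇒≢0 qPrime p≢q

    p∤9M : ¬ + 9 * M ≡ + 0 [modℤ p ]
    p∤9M = p.*-≢0 (p.*-≢0 p∤3 p∤3) p∤M

    module CP = CubicPowers {e = e} qPrime q≡1+3e w w-root pPrime p≢q p≢3 (FormalSums.cyclotomic p q 1<q) (p.regular p∤3)

    ratio₁ : (+ 3 * B) ℤ.^ 2 * + q ≡ M ℤ.^ 2 * (+ 27 * (+ 3 * + q))
    ratio₁ = trans (cong (λ b → (+ 3 * b) ℤ.^ 2 * + q) B≡3M′) (trans (lemma₁ M′ (+ q)) (trans (cong (λ x → + 81 * x * + q) M′²≡M²) (lemma₂ M (+ q))))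
      where
      lemma₁ : ∀ m q → + 3 * (+ 3 * m) * (+ 3 * (+ 3 * m) * + 1) * q ≡ + 81 * (m * m) * q
      lemma₁ = solve-∀
      lemma₂ : ∀ m q → + 81 * (m * m) * q ≡ m * (m * + 1) * (+ 27 * (+ 3 * q))
      lemma₂ = solve-∀

    ratio₂ : L′ ℤ.^ 2 * + (27 ℕ.* q) ≡ L ℤ.^ 2 * (+ 27 * + q)
    ratio₂ = cong₂ ℤ._*_ (trans (cong (λ x → L′ * x) (ℤ.*-identityʳ L′)) (trans L′²≡L² (cong (λ x → L * x) (sym (ℤ.*-identityʳ L))))) (ℤ.pos-* 27 q)

    p∤27q : ¬ + (27 ℕ.* q) ≡ + 0 [modℤ p ]
    p∤27q eq = p.*-≢0 (p.*-≢0 p∤3 (p.*-≢0 p∤3 p∤3)) p∤q (Zp.trans (≡⇒≡mod (sym (ℤ.pos-* 27 q))) eq)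

    -- M²/q = (3B)²/(27·3q) selects the cubic with n = 3q, whereas L²/(27q) selects the one with n =
    -- q.
    module S₁ = UpperSumℚ pPrime p≢2 p≢3 (+ 3 * + q) (+ 3 * B) (p.*-≢0 p∤3 p∤q) M q p∤q ratio₁
    module S₂ = UpperSumℚ pPrime p≢2 p≢3 (+ q) L′ p∤q L (27 ℕ.* q) p∤27q ratio₂
    module U₁ = UpperSum pPrime p≢2 p≢3 (+ 3 * + q) (+ 3 * B) (p.*-≢0 p∤3 p∤q)
    module U₂ = UpperSum pPrime p≢2 p≢3 (+ q) L′ p∤q

    σ : ℤ
    σ = im (χ p)

    -- Eliminating the leading coefficient gives T₁ ≡ (B/L′) σ = (3M′/L′) σ, and M′/L′ = M/L.
    L*T₁≡3M*σ : L * S₁.T ≡ + 3 * M * σ [modℤ p ]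
    L*T₁≡3M*σ = p.*-cancelˡ (+ 3 * L′) (p.*-≢0 p∤3 p∤L′) (begin
      + 3 * L′ * (L * S₁.T) ≡⟨ lemma₁ L′ L S₁.T ⟩
      L * L′ * (+ 3 * S₁.T) ≈⟨ *-≡modˡ (L * L′) U₁.upper-sum ⟩
      L * L′ * (- (+ 3 * B) * ld) ≡⟨ lemma₂ L L′ B ld ⟩
      + 3 * (L * B) * (ld * - L′) ≈⟨ *-≡modˡ (+ 3 * (L * B)) (CP.leading-3q (p.regular (p.*-≢0 p∤3 p∤q))) ⟩
      + 3 * (L * B) * σ ≡⟨ cong (λ b → + 3 * (L * b) * σ) B≡3M′ ⟩
      + 3 * (L * (+ 3 * M′)) * σ ≡⟨ lemma₃ L M′ σ ⟩
      + 9 * (L * M′) * σ ≡⟨ cong (λ x → + 9 * x * σ) proportional ⟩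
      + 9 * (L′ * M) * σ ≡⟨ lemma₄ L′ M σ ⟩
      + 3 * L′ * (+ 3 * M * σ)  ∎)
      where
      open SetoidReasoning Zp.setoid
      ld : ℤ
      ld = leading (+ 3 * (+ 3 * + q)) (+ 3 * + q * (+ 3 * B)) p
      lemma₁ : ∀ a b t → + 3 * a * (b * t) ≡ b * a * (+ 3 * t)
      lemma₁ = solve-∀
      lemma₂ : ∀ a b c d → a * b * (- (+ 3 * c) * d) ≡ + 3 * (a * c) * (d * - b)
      lemma₂ = solve-∀
      lemma₃ : ∀ a b s → + 3 * (a * (+ 3 * b)) * s ≡ + 9 * (a * b) * s
      lemma₃ = solve-∀
      lemma₄ : ∀ a b s → + 9 * (a * b) * s ≡ + 3 * a * (+ 3 * b * s)
      lemma₄ = solve-∀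

    -- Likewise T₂ ≡ -(L′/3B) σ = -(L′/9M′) σ. The sign is opposite to that of the first sum.
    9M*T₂≡-L*σ : + 9 * M * S₂.T ≡ L * - σ [modℤ p ]
    9M*T₂≡-L*σ = p.*-cancelˡ L′ p∤L′ (begin
      L′ * (+ 9 * M * S₂.T) ≡⟨ lemma₁ L′ M S₂.T ⟩
      + 9 * (L′ * M) * S₂.T ≡⟨ cong (λ x → + 9 * x * S₂.T) proportional ⟨
      + 9 * (L * M′) * S₂.T ≡⟨ lemma₂ L M′ S₂.T ⟩
      L * (+ 3 * M′) * (+ 3 * S₂.T) ≡⟨ cong (λ b → L * b * (+ 3 * S₂.T)) B≡3M′ ⟨
      L * B * (+ 3 * S₂.T) ≈⟨ *-≡modˡ (L * B) U₂.upper-sum ⟩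
      L * B * (- L′ * ld) ≡⟨ lemma₃ L B L′ ld ⟩
      - (L * L′) * (ld * B) ≈⟨ *-≡modˡ (- (L * L′)) (CP.leading-q (p.regular p∤q)) ⟩
      - (L * L′) * σ ≡⟨ lemma₄ L L′ σ ⟩
      L′ * (L * - σ)  ∎)
      where
      open SetoidReasoning Zp.setoid
      ld : ℤ
      ld = leading (+ 3 * + q) (+ q * L′) p
      lemma₁ : ∀ a b t → a * (+ 9 * b * t) ≡ + 9 * (a * b) * t
      lemma₁ = solve-∀
      lemma₂ : ∀ a b t → + 9 * (a * b) * t ≡ a * (+ 3 * b) * (+ 3 * t)
      lemma₂ = solve-∀
      lemma₃ : ∀ a b c d → a * b * (- c * d) ≡ - (a * c) * (d * b)
      lemma₃ = solve-∀
      lemma₄ : ∀ a b s → - (a * b) * s ≡ b * (a * - s)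
      lemma₄ = solve-∀

    module Rq = RationalsMod qPrime
    module Rp = RationalsMod pPrime

    P : ℤ
    P = + (p ^ e)

    P≃ : (P // (+ 1)) Rq.≃ P ÷ (+ 1)
    P≃ = Rq.÷-// P (+ 1) q.1≢0

    χp-unique : ∀ v → CubicSymbol.evalw {e = e} qPrime q≡1+3e w w-root v ≡ P [modℤ q ] → χ p ≡ v
    χp-unique v eq = χ-unique p v (Zq.trans eq (≡⇒≡mod (pos-^ p e)))

    2P+1≡z⇒P≡ : ∀ {x} → + 2 * P + + 1 ≡ + 2 * x + + 1 [modℤ q ] → x ≡ P [modℤ q ]
    2P+1≡z⇒P≡ {x} eq = q.*-cancelˡ (+ 2) 2≢0 (Zq.trans (≡⇒≡mod (lemma (+ 2 * x))) (Zq.trans (+-≡modʳ (- + 1) (Zq.sym eq)) (≡⇒≡mod (sym (lemma (+ 2 * P))))))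
      where
      lemma : ∀ x → x ≡ x + + 1 - + 1
      lemma = solve-∀

    χp≡𝕨 : + 2 * P + + 1 ≡ + 2 * w + + 1 [modℤ q ] → χ p ≡ 𝕨
    χp≡𝕨 eq = χp-unique 𝕨 (2P+1≡z⇒P≡ eq)

    -- w² ≡ -w-1, hence 2w² + 1 ≡ -(2w+1).
    χp≡𝕨² : + 2 * P + + 1 ≡ - (+ 2 * w + + 1) [modℤ q ] → χ p ≡ 𝕨²
    χp≡𝕨² eq = χp-unique 𝕨² (Zq.trans w²≡ (2P+1≡z⇒P≡ (Zq.trans eq (≡⇒≡mod (lemma w)))))
      where
      lemma : ∀ w → - (+ 2 * w + + 1) ≡ + 2 * (- w - + 1) + + 1
      lemma = solve-∀
      lemma′ : ∀ w → w * w ≡ (w * w + w + + 1) + (- w - + 1)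
      lemma′ = solve-∀
      w²≡ : w * w ≡ - w - + 1 [modℤ q ]
      w²≡ = Zq.trans (≡⇒≡mod (lemma′ w)) (Zq.trans (+-≡modʳ (- w - + 1) w-root) (≡⇒≡mod (ℤ.+-identityˡ _)))

  pe : ℚ
  pe = P // (+ 1)

  r₁ r₂ : ℚ
  r₁ = (+ 9 * M) // L
  r₂ = L // (+ 3 * M)

  private
    q∤3M : ¬ + 3 * M ≡ + 0 [modℤ q ]
    q∤3M = q.*-≢0 3≢0 M≢0

    half : ∀ {r u v} → r Rq.≃ u ÷ v → pe ≡ (ℚ.- 1ℚ ℚ.+ r) ℚ.* ½ [modℚ q ] → v * (+ 2 * P + + 1) ≡ u [modℤ q ]
    half {r} {u} {v} r≃ eq = begin
      v * (+ 2 * P + + 1) ≡⟨ lemma₁ v P ⟩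
      P * (+ 1 * v * + 2) + v ≈⟨ +-≡modʳ v (Rq.≡modℚ⇒÷ P≃ (Rq.÷-* (Rq.÷-+ (Rq.÷-neg Rq.÷-1) r≃) (Rq.÷-½ 2≢0)) eq) ⟩
      (- + 1 * v + u * + 1) * + 1 * + 1 + v ≡⟨ lemma₂ u v ⟩
      u  ∎
      where
      open SetoidReasoning Zq.setoid
      lemma₁ : ∀ v P → v * (+ 2 * P + + 1) ≡ P * (+ 1 * v * + 2) + v
      lemma₁ = solve-∀
      lemma₂ : ∀ u v → (- + 1 * v + u * + 1) * + 1 * + 1 + v ≡ u
      lemma₂ = solve-∀

    r₁≃ : r₁ Rq.≃ (+ 9 * M) ÷ L
    r₁≃ = Rq.÷-// (+ 9 * M) L L≢0

    r₂≃ : r₂ Rq.≃ L ÷ (+ 3 * M)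
    r₂≃ = Rq.÷-// L (+ 3 * M) q∤3M

    -- L² ≡ -27M² makes L/(3M) ≡ -9M/L ≡ -(2w+1).
    from-3M : ∀ z s → + 3 * M * z ≡ s * L [modℤ q ] → z ≡ - s * (+ 2 * w + + 1) [modℤ q ]
    from-3M z s eq = q.*-cancelˡ (L * L) (q.*-≢0 L≢0 L≢0) (begin
      L * L * z ≈⟨ *-≡modʳ z L²≡-27M² ⟩
      - (+ 27 * (M * M)) * z ≡⟨ lemma₁ M z ⟩
      - (+ 9 * M) * (+ 3 * M * z) ≈⟨ *-≡mod (neg-≡mod (Zq.sym L[2w+1]≡9M)) eq ⟩
      - (L * (+ 2 * w + + 1)) * (s * L) ≡⟨ lemma₂ L w s ⟩
      L * L * (- s * (+ 2 * w + + 1))  ∎)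
      where
      open SetoidReasoning Zq.setoid
      lemma₁ : ∀ M z → - (+ 27 * (M * M)) * z ≡ - (+ 9 * M) * (+ 3 * M * z)
      lemma₁ = solve-∀
      lemma₂ : ∀ L w s → - (L * (+ 2 * w + + 1)) * (s * L) ≡ L * L * (- s * (+ 2 * w + + 1))
      lemma₂ = solve-∀

  pe≡1⇒χp≡𝟙 : pe ≡ 1ℚ [modℚ q ] → χ p ≡ 𝟙
  pe≡1⇒χp≡𝟙 eq = χp-unique 𝟙 (Zq.sym (Zq.trans (≡⇒≡mod (sym (ℤ.*-identityʳ P))) (Rq.≡modℚ⇒÷ P≃ Rq.÷-1 eq)))

  r₁⇒χp≡𝕨 : pe ≡ (ℚ.- 1ℚ ℚ.+ r₁) ℚ.* ½ [modℚ q ] → χ p ≡ 𝕨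
  r₁⇒χp≡𝕨 eq = χp≡𝕨 (q.*-cancelˡ L L≢0 (Zq.trans (half r₁≃ eq) (Zq.sym L[2w+1]≡9M)))

  -r₁⇒χp≡𝕨² : pe ≡ (ℚ.- 1ℚ ℚ.- r₁) ℚ.* ½ [modℚ q ] → χ p ≡ 𝕨²
  -r₁⇒χp≡𝕨² eq = χp≡𝕨² (q.*-cancelˡ L L≢0 (Zq.trans (half (Rq.÷-neg r₁≃) eq)
    (Zq.trans (neg-≡mod (Zq.sym L[2w+1]≡9M)) (≡⇒≡mod (ℤ.neg-distribʳ-* L (+ 2 * w + + 1))))))

  -- Because r₂ ≡ -r₁ modulo q, the plus sign now belongs to 𝕨². Together with the opposite sign of
  -- T₂ this restores the stated correspondence of signs.
  r₂⇒χp≡𝕨² : pe ≡ (ℚ.- 1ℚ ℚ.+ r₂) ℚ.* ½ [modℚ q ] → χ p ≡ 𝕨²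
  r₂⇒χp≡𝕨² eq = χp≡𝕨² (Zq.trans (from-3M (+ 2 * P + + 1) (+ 1) (Zq.trans (half r₂≃ eq) (≡⇒≡mod (sym (ℤ.*-identityˡ L)))))
    (≡⇒≡mod (ℤ.-1*i≡-i (+ 2 * w + + 1))))

  -r₂⇒χp≡𝕨 : pe ≡ (ℚ.- 1ℚ ℚ.- r₂) ℚ.* ½ [modℚ q ] → χ p ≡ 𝕨
  -r₂⇒χp≡𝕨 eq = χp≡𝕨 (Zq.trans (from-3M (+ 2 * P + + 1) (- + 1) (Zq.trans (half (Rq.÷-neg r₂≃) eq) (≡⇒≡mod (sym (ℤ.-1*i≡-i L)))))
    (≡⇒≡mod (ℤ.*-identityˡ (+ 2 * w + + 1))))

  sum₁ sum₂ : ℚ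
  sum₁ = sumFromTo ((p ℕ.+ 1) / 2) ((2 ℕ.* p) / 3) (λ k → (+ ((3 ℕ.* k) C k) * M ℤ.^ (2 ℕ.* k)) // (+ (q ^ k)))
  sum₂ = sumFromTo ((p ℕ.+ 1) / 2) ((2 ℕ.* p) / 3) (λ k → (+ ((3 ℕ.* k) C k) * L ℤ.^ (2 ℕ.* k)) // (+ ((27 ℕ.* q) ^ k)))

  private
    T₁*L≡ : ∀ {v} → χ p ≡ v → S₁.T * L ≡ + 3 * M * im v * + 1 [modℤ p ]
    T₁*L≡ refl = Zp.trans (≡⇒≡mod (ℤ.*-comm S₁.T L)) (Zp.trans L*T₁≡3M*σ (≡⇒≡mod (sym (ℤ.*-identityʳ _))))

    T₂*9M≡ : ∀ {v} → χ p ≡ v → S₂.T * (+ 9 * M) ≡ L * - im v * + 1 [modℤ p ]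
    T₂*9M≡ refl = Zp.trans (≡⇒≡mod (ℤ.*-comm S₂.T (+ 9 * M))) (Zp.trans 9M*T₂≡-L*σ (≡⇒≡mod (sym (ℤ.*-identityʳ _))))

    x*1 : ∀ x → x * + 1 * + 1 ≡ x * + 1
    x*1 = solve-∀

    x*-1 : ∀ x → x * - + 1 * + 1 ≡ - x * + 1
    x*-1 = solve-∀

    3M/L≃ : ((+ 3 * M) // L) Rp.≃ (+ 3 * M) ÷ L
    3M/L≃ = Rp.÷-// (+ 3 * M) L p∤L

    L/9M≃ : (L // (+ 9 * M)) Rp.≃ L ÷ (+ 9 * M)
    L/9M≃ = Rp.÷-// L (+ 9 * M) p∤9M

    0/v≃ : ∀ v → ¬ v ≡ + 0 [modℤ p ] → 0ℚ Rp.≃ + 0 ÷ v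
    0/v≃ v v≢0 = Rp.÷-cong Rp.÷-0 v≢0 Zp.refl

    0≡ : ∀ x → x * + 0 * + 1 ≡ + 0 * + 1
    0≡ = solve-∀

  sum₁-𝟙 : χ p ≡ 𝟙 → sum₁ ≡ 0ℚ [modℚ p ]
  sum₁-𝟙 eq = Rp.÷⇒≡modℚ S₁.sum≃T (0/v≃ L p∤L) (Zp.trans (T₁*L≡ eq) (≡⇒≡mod (0≡ (+ 3 * M))))

  sum₁-𝕨 : χ p ≡ 𝕨 → sum₁ ≡ (+ 3 * M) // L [modℚ p ]
  sum₁-𝕨 eq = Rp.÷⇒≡modℚ S₁.sum≃T 3M/L≃ (Zp.trans (T₁*L≡ eq) (≡⇒≡mod (x*1 (+ 3 * M))))

  sum₁-𝕨² : χ p ≡ 𝕨² → sum₁ ≡ ℚ.- ((+ 3 * M) // L) [modℚ p ]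
  sum₁-𝕨² eq = Rp.÷⇒≡modℚ S₁.sum≃T (Rp.÷-neg 3M/L≃) (Zp.trans (T₁*L≡ eq) (≡⇒≡mod (x*-1 (+ 3 * M))))

  sum₂-𝟙 : χ p ≡ 𝟙 → sum₂ ≡ 0ℚ [modℚ p ]
  sum₂-𝟙 eq = Rp.÷⇒≡modℚ S₂.sum≃T (0/v≃ (+ 9 * M) p∤9M) (Zp.trans (T₂*9M≡ eq) (≡⇒≡mod (0≡ L)))

  sum₂-𝕨² : χ p ≡ 𝕨² → sum₂ ≡ L // (+ 9 * M) [modℚ p ]
  sum₂-𝕨² eq = Rp.÷⇒≡modℚ S₂.sum≃T L/9M≃ (Zp.trans (T₂*9M≡ eq) (≡⇒≡mod (x*1 L)))

  sum₂-𝕨 : χ p ≡ 𝕨 → sum₂ ≡ ℚ.- (L // (+ 9 * M)) [modℚ p ]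
  sum₂-𝕨 eq = Rp.÷⇒≡modℚ S₂.sum≃T (Rp.÷-neg L/9M≃) (Zp.trans (T₂*9M≡ eq) (≡⇒≡mod (x*-1 L)))

theorem25 : (q : ℕ) → Prime q → (+ 3) ∣ (+ q ℤ.- + 1) →
  (L M : ℤ) → + (4 ℕ.* q) ≡ L ℤ.^ 2 ℤ.+ + 27 ℤ.* M ℤ.^ 2 → (+ 3) ∣ (L ℤ.- + 1) →
  (p : ℕ) → Prime p → p ≢ 2 → p ≢ 3 → p ≢ q → ¬ ((+ p) ∣ (L ℤ.* M)) →
  let e = (q ∸ 1) / 3
      pe = (+ (p ^ e)) // (+ 1)
      S₁ = sumFromTo ((p ℕ.+ 1) / 2) ((2 ℕ.* p) / 3)
          (λ k → (+ ((3 ℕ.* k) C k) ℤ.* M ℤ.^ (2 ℕ.* k)) // (+ (q ^ k)))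
      S₂ = sumFromTo ((p ℕ.+ 1) / 2) ((2 ℕ.* p) / 3)
          (λ k → (+ ((3 ℕ.* k) C k) ℤ.* L ℤ.^ (2 ℕ.* k)) // (+ ((27 ℕ.* q) ^ k)))
      r₁ = (+ 9 ℤ.* M) // L
      r₂ = L // (+ 3 ℤ.* M)
  in ((pe ≡ 1ℚ [modℚ q ] → S₁ ≡ 0ℚ [modℚ p ])
      × (pe ≡ (ℚ.- 1ℚ ℚ.+ r₁) ℚ.* ½ [modℚ q ] → S₁ ≡ (+ 3 ℤ.* M) // L [modℚ p ])
      × (pe ≡ (ℚ.- 1ℚ ℚ.- r₁) ℚ.* ½ [modℚ q ] → S₁ ≡ ℚ.- ((+ 3 ℤ.* M) // L) [modℚ p ]))
   × ((pe ≡ 1ℚ [modℚ q ] → S₂ ≡ 0ℚ [modℚ p ])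
      × (pe ≡ (ℚ.- 1ℚ ℚ.+ r₂) ℚ.* ½ [modℚ q ] → S₂ ≡ L // (+ 9 ℤ.* M) [modℚ p ])
      × (pe ≡ (ℚ.- 1ℚ ℚ.- r₂) ℚ.* ½ [modℚ q ] → S₂ ≡ ℚ.- (L // (+ 9 ℤ.* M)) [modℚ p ]))
theorem25 q qPrime 3∣q-1 L M 4q≡L²+27M² _ p pPrime p≢2 p≢3 p≢q p∤LM =
  ( (λ h → sum₁-𝟙 (pe≡1⇒χp≡𝟙 h)) , (λ h → sum₁-𝕨 (r₁⇒χp≡𝕨 h)) , (λ h → sum₁-𝕨² (-r₁⇒χp≡𝕨² h)) ) ,
  ( (λ h → sum₂-𝟙 (pe≡1⇒χp≡𝟙 h)) , (λ h → sum₂-𝕨² (r₂⇒χp≡𝕨² h)) , (λ h → sum₂-𝕨 (-r₂⇒χp≡𝕨 h)) )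
  where open CubicResidues q qPrime 3∣q-1 L M 4q≡L²+27M² p pPrime p≢2 p≢3 p≢q p∤LM
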